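{- Let $R$ be a finite group with an abelian subgroup $M$ of index $2$. Then the number of subsets $S$ of $R\setminus M$ such that $\mathrm{Cay}(R,S)$ is a DRR (i.e. $\mathrm{Aut}(\mathrm{Cay}(R,S))=R$) is at least $$2^{\frac{|R|}{2}}-5\cdot 2^{\frac{3|R|}{8}+\log_2|R|\cdot \log_2(|R|/2)}.$$
   Context: For a group $R$ and $S\subseteq R$, the Cayley digraph $\mathrm{Cay}(R,S)$ has vertex set $R$ and $(g,h)$ is an arc if and only if $gh^{ -1}\in S$. The group $R$ acts regularly on it as a group of automorphisms by right multiplication, and is identified with a subgroup of $\mathrm{Aut}(\mathrm{Cay}(R,S))$. $\mathrm{Cay}(R,S)$ is a DRR (digraphical regular representation) if $\mathrm{Aut}(\mathrm{Cay}(R,S))=R$. When $S\subseteq R\setminus M$ for a subgroup $M$ of index 2, the digraph is bipartite with bipartition $\{M,R\setminus M\}$. -}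

module Defs where

open import Data.Nat using (ℕ; _+_; _*_; _∸_; _^_; _≤_; _<_; ⌊_/2⌋)
open import Data.Fin using (Fin)
open import Data.Fin.Subset using (Subset; _∈_; _∉_; ∣_∣; _⊆_; ∁)
open import Data.Fin.Permutation using (Permutation′; _⟨$⟩ʳ_)
open import Data.Product using (Σ; ∃; _×_)
open import Function.Bundles using (_⇔_)
open import Relation.Binary.PropositionalEquality using (_≡_)

-- A finite group of order n is represented with carrier Fin n, a
-- multiplication table, identity and inverse (satisfying IsGroup _≡_,
-- imposed in the statement).

module _ {n : ℕ} (_·_ : Fin n → Fin n → Fin n) (e : Fin n) (_⁻¹ : Fin n → Fin n) where

  IsSubgroup : Subset n → Set
  IsSubgroup M = (e ∈ M)
               × (∀ x y → x ∈ M → y ∈ M → (x · y) ∈ M)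
               × (∀ x → x ∈ M → (x ⁻¹) ∈ M)

  IsAbelianSub : Subset n → Set
  IsAbelianSub M = ∀ x y → x ∈ M → y ∈ M → (x · y) ≡ (y · x)

  Arc : Subset n → Fin n → Fin n → Set
  Arc S g h = (g · (h ⁻¹)) ∈ S

  IsAut : Subset n → Permutation′ n → Set
  IsAut S φ = ∀ g h → Arc S g h ⇔ Arc S (φ ⟨$⟩ʳ g) (φ ⟨$⟩ʳ h)

  -- Cay(R,S) is a DRR: every automorphism is a right translation g ↦ g r
  -- (R ≤ Aut always holds, so this is Aut(Cay(R,S)) = R)
  IsDRR : Subset n → Set
  IsDRR S = ∀ (φ : Permutation′ n) → IsAut S φ →
            ∃ λ (r : Fin n) → ∀ g → (φ ⟨$⟩ʳ g) ≡ (g · r)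

-- Exact real-number-free encoding of the inequality
--   c ≥ 2^(n/2) - 5 · 2^(3n/8 + log₂ n · log₂ (n/2))      (n ≥ 2 even).
-- With D = 2^(n/2) ∸ c and u = log₂ n, the inequality is
--   D · n ≤ 5 · 2^(3n/8) · 2^(u²),
-- i.e. u² ≥ w := log₂ (D n / (5 · 2^(3n/8))).  This holds iff every
-- nonnegative rational p/(8s) with (p/(8s))² < w satisfies p/(8s) ≤ u,
-- i.e. 2^p ≤ n^(8s).  Raising (p/(8s))² < w to powers gives the
-- hypothesis below.
DRRCountBound : ℕ → ℕ → Set
DRRCountBound n c =
  ∀ (p s : ℕ) → 1 ≤ s →
    2 ^ (p * p) * 5 ^ (64 * s * s) * 2 ^ (24 * n * s * s)
      < ((2 ^ ⌊ n /2⌋ ∸ c) * n) ^ (64 * s * s) →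
    2 ^ p ≤ n ^ (8 * s)

{-# OPTIONS --safe #-}

-- A permutation of R ∖ M fixing at most half of R ∖ M leaves at most 2^(3|M|/4) subsets S invariant, and one without
-- fixed points at most 2^(|M|/2). So it suffices to exhibit permutations, about |M|^(1 + log₂ |M|) of the first kind or
-- correspondingly more of the second, one of which leaves S invariant whenever Cay(R, S) is not a DRR.
--
-- If an automorphism with a fixed point normalises M, it acts on R ∖ M like such an f, and it is determined by the
-- images of a generating set of M. Otherwise choose an automorphism k ≠ 1 with a fixed point whose centraliser Z in M is
-- maximal. In the group H of automorphisms centralising Z, distinct conjugates of M meet in Z, so H / Z is a Frobenius
-- group with complement M / Z. Since M is semiregular and transitive on each half, counting identifies the Frobenius
-- kernel with H₁ Z for every point stabiliser H₁: elements of H with a fixed point map every g to g c(g) with c(g) ∈ Z.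
-- Then S restricted to each coset vZ has periods, the values c(vw) c(w)⁻¹. Taking c with values in a smallest possible
-- subgroup X ≤ Z, the period groups in X of any two cosets of Z in R ∖ M generate X. If some coset has no period, all
-- others share one. If all have periods and |Z| ≥ 16, there are at most |Z|^(|M|/|Z|) ≤ 2^(|M|/4) ways to choose one for
-- each coset. If |Z| < 16, a second-moment argument shows that all but |X| cosets have the same period group X.
module Submission where

open import Defs
open import Data.Nat using (ℕ; _*_)
open import Data.Fin using (Fin)
open import Data.Fin.Subset using (Subset; _∈_; _∉_; ∣_∣)
open import Data.List using (List; length)
open import Data.List.Relation.Unary.All using (All)
open import Data.List.Relation.Unary.Unique.Propositional using (Unique)
open import Data.Product using (Σ; ∃; _×_)
open import Algebra.Structures using (IsGroup)
open import Relation.Binary.PropositionalEquality using (_≡_)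

open import Data.Bool using (Bool; true; false; not)
import Data.Bool.Properties as Bool
open import Data.Empty using (⊥; ⊥-elim)
open import Data.Fin using (zero; suc)
import Data.Fin as Fin
open import Data.Fin.Induction using () renaming (<-wellFounded to <ᶠ-wellFounded)
open import Data.Fin.Permutation as Perm using (_⟨$⟩ʳ_; _⟨$⟩ˡ_)
import Data.Fin.Properties as Fin
open import Data.Fin.Subset using (∁; ⊤; ⁅_⁆; _∩_) renaming (⊥ to ∅)
open import Data.Fin.Subset.Properties using (_∈?_; ∈⊤; ∉⊥; ⊆-antisym; drop-there; x∈⁅x⁆; x∈⁅y⁆⇒x≡y;
  x∈∁p⇒x∉p; x∉p⇒x∈∁p; ∣∁p∣≡n∸∣p∣; x∈p∩q⁺; x∈p∩q⁻; ∩-idem)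
open import Data.List using ([]; _∷_; _++_; map; filter; allFin; concatMap; cartesianProduct; cartesianProductWith; replicate)
open import Data.List.Membership.Propositional using (lose; find) renaming (_∈_ to _∈ˡ_; _∉_ to _∉ˡ_)
open import Data.List.Membership.Propositional.Properties using (∈-filter⁺; ∈-filter⁻; ∈-map⁺; ∈-map⁻; ∈-++⁺ˡ; ∈-++⁺ʳ;
  ∈-++⁻; ∈-∃++; ∈-allFin; ∈-concatMap⁺; ∈-cartesianProduct⁺; ∈-cartesianProduct⁻; ∈-cartesianProductWith⁺)
open import Data.List.Properties using (length-++; length-map; length-tabulate; length-replicate; ++-assoc; ++-identityʳ;
  ∷-injectiveˡ; ∷-injectiveʳ)
open import Data.List.Relation.Unary.All as All using ([]; _∷_)
open import Data.List.Relation.Unary.AllPairs using (AllPairs; []; _∷_)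
open import Data.List.Relation.Unary.Any as Any using (here; there)
import Data.List.Relation.Unary.Unique.Propositional.Properties as Unique
open import Data.Nat using (zero; suc; _+_; _∸_; _^_; _≤_; _<_; _≤′_; z≤n; s≤s; s≤s⁻¹; ≤′-refl; ≤′-step; ⌊_/2⌋; NonZero; >-nonZero)
open import Data.Nat.DivMod using (_/_; _%_; m≡m%n+[m/n]*n; m%n<n)
open import Data.Nat.Properties hiding (_≟_)
open import Data.Nat.Tactic.RingSolver using (solve-∀)
open import Data.Product using (_,_; proj₁; proj₂)
open import Data.Sum using (_⊎_; inj₁; inj₂)
open import Data.Vec as Vec using (Vec; []; _∷_; here; there; lookup; tabulate)
import Data.Vec.Properties as Vec
open import Function using (_∘_; id)
open import Function.Bundles using (Equivalence)
open import Induction.WellFounded using (Acc; acc)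
open import Relation.Binary.PropositionalEquality
open import Relation.Nullary using (¬_; Dec; yes; no; does; contradiction)
open import Relation.Nullary.Decidable using (dec-true; _×-dec_; _→-dec_; ¬?)

-- The permutations are listed without reference to S, so each obstruction must be coded by few
-- group elements: a subgroup by generators, each of which at least doubles the order, and a period
-- by a point of the coset on which it acts. With D the integer part of log₂ |M|, a budget of D + 1
-- elements of M is affordable because |M|^(D+1) |R| ≤ 2^((log₂ |R|)²). The Frobenius count becomes
-- an iteration: writing b = ρ x ∘ h with h in a point stabiliser, b ↦ h ∘ ρ x ∘ h⁻¹ is an injection
-- of a finite set into itself, so every b with x outside Z is a conjugate of a translation.
-- Minimality of X is used through commutators with translations. They replace c(g) by the
-- difference c(gx) c(g)⁻¹, which lies in the product of two period groups, and they are again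
-- non-trivial; so this product cannot be smaller than X. Automorphisms that mix the halves M and R
-- ∖ M need a separate argument: they confine S to one coset of a proper subgroup of M. The
-- threshold 16 is where z^4 ≤ 2^z begins to hold, and the factor 5 is the number of lists of
-- exceptional sets.

-- Counting in finite lists and subsets of Fin n

-- Pigeonhole principle: the partner of the head is cut out of `ys`, and injectivity keeps the
-- partners of the tail away from it.
length-≤-by : ∀ {A B : Set} (R : A → B → Set) {xs : List A} {ys : List B} → Unique xs →
  (∀ {x} → x ∈ˡ xs → ∃ λ y → y ∈ˡ ys × R x y) →
  (∀ {x x′ y} → x ∈ˡ xs → x′ ∈ˡ xs → R x y → R x′ y → x ≡ x′) →
  length xs ≤ length ys
length-≤-by R [] tot inj = z≤n
length-≤-by {A} {B} R {x ∷ xs} {ys} (x∉xs ∷ uniq) tot inj with tot (here refl)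
... | y , y∈ys , Rxy with ∈-∃++ y∈ys
... | as , bs , refl = begin
  suc (length xs)               ≤⟨ s≤s (length-≤-by R uniq tot′ (λ p q → inj (there p) (there q))) ⟩
  suc (length (as ++ bs))       ≡⟨ cong suc (length-++ as) ⟩
  suc (length as + length bs)   ≡⟨ +-suc (length as) (length bs) ⟨
  length as + suc (length bs)   ≡⟨ length-++ as ⟨
  length (as ++ y ∷ bs)         ∎
  where
  open ≤-Reasoning
  tot′ : ∀ {z} → z ∈ˡ xs → ∃ λ w → w ∈ˡ (as ++ bs) × R z w
  tot′ {z} z∈ with tot (there z∈)
  ... | w , w∈ , Rzw with ∈-++⁻ as w∈
  ... | inj₁ w∈as = w , ∈-++⁺ˡ w∈as , Rzw
  ... | inj₂ (there w∈bs) = w , ∈-++⁺ʳ as w∈bs , Rzw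
  ... | inj₂ (here refl) = contradiction (inj (here refl) (there z∈) Rxy Rzw) (All.lookup x∉xs z∈)

length-≤-inj : ∀ {A B : Set} (f : A → B) {xs : List A} {ys : List B} → Unique xs →
  (∀ {x} → x ∈ˡ xs → f x ∈ˡ ys) →
  (∀ {x x′} → x ∈ˡ xs → x′ ∈ˡ xs → f x ≡ f x′ → x ≡ x′) →
  length xs ≤ length ys
length-≤-inj f uniq into inj = length-≤-by (λ x y → f x ≡ y) uniq (λ {x} p → f x , into p , refl)
  (λ p q r s → inj p q (trans r (sym s)))

length-⊆ : ∀ {A : Set} {xs ys : List A} → Unique xs → (∀ {x} → x ∈ˡ xs → x ∈ˡ ys) → length xs ≤ length ys
length-⊆ uniq sub = length-≤-inj id uniq sub (λ _ _ eq → eq)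

length-filter-split : ∀ {A : Set} {P : A → Set} (P? : ∀ x → Dec (P x)) xs →
  length (filter P? xs) + length (filter (λ x → ¬? (P? x)) xs) ≡ length xs
length-filter-split P? [] = refl
length-filter-split P? (x ∷ xs) with P? x
... | yes _ = cong suc (length-filter-split P? xs)
... | no _ = trans (+-suc _ _) (cong suc (length-filter-split P? xs))

map-agree : ∀ {A B : Set} {f g : A → B} xs → map f xs ≡ map g xs → ∀ {x} → x ∈ˡ xs → f x ≡ g x
map-agree (x ∷ xs) eq (here refl) = ∷-injectiveˡ eq
map-agree (x ∷ xs) eq (there p) = map-agree xs (∷-injectiveʳ eq) p

tuples : ∀ {A : Set} → List A → ℕ → List (List A)
tuples xs zero = [] ∷ []
tuples xs (suc k) = cartesianProductWith _∷_ xs (tuples xs k)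

product-length : ∀ {A B C : Set} (f : A → B → C) xs ys →
  length (cartesianProductWith f xs ys) ≡ length xs * length ys
product-length f [] ys = refl
product-length f (x ∷ xs) ys =
  trans (length-++ (map (f x) ys)) (cong₂ _+_ (length-map (f x) ys) (product-length f xs ys))

tuples-length : ∀ {A : Set} (xs : List A) k → length (tuples xs k) ≡ length xs ^ k
tuples-length xs zero = refl
tuples-length xs (suc k) =
  trans (product-length _∷_ xs (tuples xs k)) (cong (length xs *_) (tuples-length xs k))

∈-tuples : ∀ {A : Set} {xs : List A} {l} → (∀ {x} → x ∈ˡ l → x ∈ˡ xs) → l ∈ˡ tuples xs (length l)
∈-tuples {l = []} sub = here refl
∈-tuples {l = x ∷ l} sub = ∈-cartesianProductWith⁺ _∷_ (sub (here refl)) (∈-tuples (sub ∘ there))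

concatMap-length : ∀ {A B : Set} (f : A → List B) {c} xs → (∀ x → length (f x) ≤ c) →
  length (concatMap f xs) ≤ length xs * c
concatMap-length f [] le = z≤n
concatMap-length f (x ∷ xs) le =
  ≤-trans (≤-reflexive (length-++ (f x))) (+-mono-≤ (le x) (concatMap-length f xs le))

⟪_⟫ : ∀ {n} {P : Fin n → Set} → (∀ x → Dec (P x)) → Subset n
⟪ P? ⟫ = tabulate (λ x → does (P? x))

∊⁺ : ∀ {n} {P : Fin n → Set} (P? : ∀ x → Dec (P x)) {x} → P x → x ∈ ⟪ P? ⟫
∊⁺ P? {x} p = Vec.lookup⇒[]= x _ (trans (Vec.lookup∘tabulate _ x) (dec-true (P? x) p))

∊⁻ : ∀ {n} {P : Fin n → Set} (P? : ∀ x → Dec (P x)) {x} → x ∈ ⟪ P? ⟫ → P x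
∊⁻ P? {x} q with P? x | trans (sym (Vec.lookup∘tabulate (λ x → does (P? x)) x)) (Vec.[]=⇒lookup q)
... | yes p | _ = p
... | no _ | ()

Vec-ext : ∀ {A : Set} {n} {u v : Vec A n} → (∀ i → lookup u i ≡ lookup v i) → u ≡ v
Vec-ext {u = u} {v} eq =
  trans (sym (Vec.tabulate∘lookup u)) (trans (Vec.tabulate-cong eq) (Vec.tabulate∘lookup v))

lookup-∉ : ∀ {n} {P : Subset n} {x} → ¬ x ∈ P → lookup P x ≡ false
lookup-∉ {P = P} {x} x∉ with lookup P x in eq
... | false = refl
... | true = contradiction (Vec.lookup⇒[]= x P eq) x∉

elems : ∀ {n} → Subset n → List (Fin n)
elems {n} P = filter (_∈? P) (allFin n)

card : ∀ {n} → Subset n → ℕ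
card P = length (elems P)

elems-unique : ∀ {n} (P : Subset n) → Unique (elems P)
elems-unique {n} P = Unique.filter⁺ (_∈? P) (Unique.allFin⁺ n)

∈-elems : ∀ {n} {P : Subset n} {x} → x ∈ P → x ∈ˡ elems P
∈-elems {P = P} {x} p = ∈-filter⁺ (_∈? P) (∈-allFin x) p

∈-elems⁻ : ∀ {n} {P : Subset n} {x} → x ∈ˡ elems P → x ∈ P
∈-elems⁻ {n} {P} q = proj₂ (∈-filter⁻ (_∈? P) {xs = allFin n} q)

card-mono : ∀ {n} {P Q : Subset n} → (∀ {x} → x ∈ P → x ∈ Q) → card P ≤ card Q
card-mono {P = P} sub = length-⊆ (elems-unique P) (∈-elems ∘ sub ∘ ∈-elems⁻)

card-mono-< : ∀ {n} {P Q : Subset n} {y} → (∀ {x} → x ∈ P → x ∈ Q) → y ∈ Q → ¬ y ∈ P → card P < card Q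
card-mono-< {P = P} {Q} {y} sub y∊Q y∉P =
  length-⊆ {xs = y ∷ elems P} (All.tabulate (λ { z∈ refl → y∉P (∈-elems⁻ z∈) }) ∷ elems-unique P)
    λ { (here refl) → ∈-elems y∊Q ; (there z∈) → ∈-elems (sub (∈-elems⁻ z∈)) }

card-⊆-≡ : ∀ {n} {P Q : Subset n} → (∀ {x} → x ∈ P → x ∈ Q) → card Q ≤ card P → P ≡ Q
card-⊆-≡ {P = P} {Q} sub le = ⊆-antisym sub (λ {x} x∊Q → back x∊Q (x ∈? P))
  where
  back : ∀ {x} → x ∈ Q → Dec (x ∈ P) → x ∈ P
  back _ (yes p) = p
  back x∊Q (no x∉P) = contradiction le (<⇒≱ (card-mono-< sub x∊Q x∉P))

card-empty : ∀ {n} {P : Subset n} → (∀ {x} → x ∉ P) → card P ≡ 0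
card-empty {P = P} none with elems P in eq
... | [] = refl
... | x ∷ _ = contradiction (∈-elems⁻ {P = P} (subst (x ∈ˡ_) (sym eq) (here refl))) none

subsetsOf : ∀ {n} → Subset n → List (Subset n)
subsetsOf [] = [] ∷ []
subsetsOf (false ∷ P) = map (false ∷_) (subsetsOf P)
subsetsOf (true ∷ P) = map (false ∷_) (subsetsOf P) ++ map (true ∷_) (subsetsOf P)

subsetsOf-length : ∀ {n} (P : Subset n) → length (subsetsOf P) ≡ 2 ^ ∣ P ∣
subsetsOf-length [] = refl
subsetsOf-length (false ∷ P) = trans (length-map _ (subsetsOf P)) (subsetsOf-length P)
subsetsOf-length (true ∷ P) = trans (length-++ (map (false ∷_) (subsetsOf P)))
  (cong₂ _+_ (trans (length-map _ (subsetsOf P)) (subsetsOf-length P))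
    (trans (trans (length-map _ (subsetsOf P)) (subsetsOf-length P)) (sym (+-identityʳ _))))

subsetsOf-unique : ∀ {n} (P : Subset n) → Unique (subsetsOf P)
subsetsOf-unique [] = [] ∷ []
subsetsOf-unique (false ∷ P) = Unique.map⁺ Vec.∷-injectiveʳ (subsetsOf-unique P)
subsetsOf-unique (true ∷ P) = Unique.++⁺ (Unique.map⁺ Vec.∷-injectiveʳ (subsetsOf-unique P))
  (Unique.map⁺ Vec.∷-injectiveʳ (subsetsOf-unique P)) disjoint
  where
  disjoint : ∀ {S} → ¬ (S ∈ˡ map (false ∷_) (subsetsOf P) × S ∈ˡ map (true ∷_) (subsetsOf P))
  disjoint (p , q) with ∈-map⁻ _ p | ∈-map⁻ _ q
  ... | _ , _ , refl | _ , _ , ()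

subsetsOf-⊆ : ∀ {n} (P : Subset n) {S} → S ∈ˡ subsetsOf P → ∀ {x} → x ∈ S → x ∈ P
subsetsOf-⊆ (false ∷ P) p q with ∈-map⁻ _ p
subsetsOf-⊆ (false ∷ P) p (there q) | S , S∈ , refl = there (subsetsOf-⊆ P S∈ q)
subsetsOf-⊆ (true ∷ P) p here = here
subsetsOf-⊆ (true ∷ P) p (there q) with ∈-++⁻ (map (false ∷_) (subsetsOf P)) p
... | inj₁ r with ∈-map⁻ _ r
... | S , S∈ , refl = there (subsetsOf-⊆ P S∈ q)
subsetsOf-⊆ (true ∷ P) p (there q) | inj₂ r with ∈-map⁻ _ r
... | S , S∈ , refl = there (subsetsOf-⊆ P S∈ q)

∈-subsetsOf : ∀ {n} (P : Subset n) {S} → (∀ {x} → x ∈ S → x ∈ P) → S ∈ˡ subsetsOf P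
∈-subsetsOf [] {[]} sub = here refl
∈-subsetsOf (false ∷ P) {false ∷ S} sub = ∈-map⁺ _ (∈-subsetsOf P (drop-there ∘ sub ∘ there))
∈-subsetsOf (false ∷ P) {true ∷ S} sub = contradiction (sub here) λ ()
∈-subsetsOf (true ∷ P) {false ∷ S} sub = ∈-++⁺ˡ (∈-map⁺ _ (∈-subsetsOf P (drop-there ∘ sub ∘ there)))
∈-subsetsOf (true ∷ P) {true ∷ S} sub =
  ∈-++⁺ʳ (map (false ∷_) (subsetsOf P)) (∈-map⁺ _ (∈-subsetsOf P (drop-there ∘ sub ∘ there)))

∀-subset? : ∀ {n} {P : Subset n → Set} → (∀ Q → Dec (P Q)) → Dec (∀ Q → P Q)
∀-subset? P? with All.all? P? (subsetsOf ⊤)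
... | yes all = yes λ Q → All.lookup all (∈-subsetsOf ⊤ (λ _ → ∈⊤))
... | no ¬all = no λ all → ¬all (All.tabulate (λ {Q} _ → all Q))

card-∣∣ : ∀ {n} (P : Subset n) → card P ≡ ∣ P ∣
card-∣∣ P = trans (unmap P) (go P)
  where
  elems′ : ∀ {n} → Subset n → List (Fin n)
  elems′ [] = []
  elems′ (true ∷ P) = zero ∷ map suc (elems′ P)
  elems′ (false ∷ P) = map suc (elems′ P)
  go : ∀ {n} (P : Subset n) → length (elems′ P) ≡ ∣ P ∣
  go [] = refl
  go (true ∷ P) = cong suc (trans (length-map suc (elems′ P)) (go P))
  go (false ∷ P) = trans (length-map suc (elems′ P)) (go P)
  sound : ∀ {n} (P : Subset n) {x} → x ∈ˡ elems′ P → x ∈ P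
  sound (true ∷ P) (here refl) = here
  sound (true ∷ P) (there q) with ∈-map⁻ suc q
  ... | x , x∈ , refl = there (sound P x∈)
  sound (false ∷ P) q with ∈-map⁻ suc q
  ... | x , x∈ , refl = there (sound P x∈)
  complete : ∀ {n} (P : Subset n) {x} → x ∈ P → x ∈ˡ elems′ P
  complete (true ∷ P) here = here refl
  complete (true ∷ P) (there q) = there (∈-map⁺ suc (complete P q))
  complete (false ∷ P) (there q) = ∈-map⁺ suc (complete P q)
  uniq : ∀ {n} (P : Subset n) → Unique (elems′ P)
  uniq [] = []
  uniq (true ∷ P) = All.tabulate (λ q → zero≢ q) ∷ Unique.map⁺ Fin.suc-injective (uniq P)
    where
    zero≢ : ∀ {x} → x ∈ˡ map suc (elems′ P) → zero ≢ x
    zero≢ q refl with ∈-map⁻ suc q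
    ... | _ , _ , ()
  uniq (false ∷ P) = Unique.map⁺ Fin.suc-injective (uniq P)
  unmap : ∀ {n} (P : Subset n) → length (elems P) ≡ length (elems′ P)
  unmap P = ≤-antisym (length-⊆ (elems-unique P) (complete P ∘ ∈-elems⁻))
    (length-⊆ (uniq P) (∈-elems ∘ sound P))

module _ {n : ℕ} (mask : Subset n) (f : Fin n → Fin n) where

  Invariant : Subset n → Set
  Invariant S = ∀ v → v ∈ mask → lookup S (f v) ≡ lookup S v

  invariant? : ∀ S → Dec (Invariant S)
  invariant? S = Fin.all? λ v → (v ∈? mask) →-dec (lookup S (f v) Bool.≟ lookup S v)

  invariants : List (Subset n)
  invariants = filter invariant? (subsetsOf mask)

  fixedIn? : ∀ v → Dec (v ∈ mask × f v ≡ v)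
  fixedIn? v = (v ∈? mask) ×-dec (f v Fin.≟ v)

  Fixed : Subset n
  Fixed = ⟪ fixedIn? ⟫

  -- An invariant set is determined, by induction along Fin n, by its trace on the v that are minimal
  -- among f⁻¹ v, v, f v; a minimal v that is not fixed is sent by f to a non-minimal point.
  invariants-length : (∀ {u v} → u ∈ mask → v ∈ mask → f u ≡ f v → u ≡ v) → (∀ {v} → v ∈ mask → f v ∈ mask) →
    ∃ λ k → length invariants ≤ 2 ^ k × k + k ≤ card mask + card Fixed
  invariants-length f-inj f-mask = length F , count , bound
    where
    Free : Fin n → Set
    Free v = ¬ (f v Fin.< v) × (∀ u → u ∈ mask → f u ≡ v → ¬ (u Fin.< v))
    free? : ∀ v → Dec (Free v)
    free? v = ¬? (f v Fin.<? v) ×-dec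
      Fin.all? λ u → (u ∈? mask) →-dec ((f u Fin.≟ v) →-dec ¬? (u Fin.<? v))
    F NF : List (Fin n)
    F = filter free? (elems mask)
    NF = filter (λ v → ¬? (free? v)) (elems mask)
    fixed? : ∀ v → Dec (f v ≡ v)
    fixed? v = f v Fin.≟ v
    F-unique = Unique.filter⁺ free? (elems-unique mask)
    fromF : ∀ {v} → v ∈ˡ F → v ∈ mask × Free v
    fromF q with ∈-filter⁻ free? {xs = elems mask} q
    ... | r , s = ∈-elems⁻ r , s
    split = length-filter-split fixed? F
    movedF = filter (λ v → ¬? (fixed? v)) F
    fixed-bound : length (filter fixed? F) ≤ card Fixed
    fixed-bound = length-⊆ {ys = elems Fixed} (Unique.filter⁺ fixed? F-unique) λ q →
      let r , s = ∈-filter⁻ fixed? {xs = F} q in ∈-elems {P = Fixed} (∊⁺ fixedIn? (proj₁ (fromF r) , s))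
    moved-bound : length movedF ≤ length NF
    moved-bound = length-≤-inj f (Unique.filter⁺ (λ v → ¬? (fixed? v)) F-unique) into
      (λ p q → f-inj (mask-of p) (mask-of q))
      where
      mask-of : ∀ {v} → v ∈ˡ movedF → v ∈ mask
      mask-of p = proj₁ (fromF (proj₁ (∈-filter⁻ (λ v → ¬? (fixed? v)) {xs = F} p)))
      into : ∀ {v} → v ∈ˡ movedF → f v ∈ˡ NF
      into {v} p = let r , moved = ∈-filter⁻ (λ v → ¬? (fixed? v)) {xs = F} p
                       v∊ , (¬< , _) = fromF r in
        ∈-filter⁺ (λ v → ¬? (free? v)) (∈-elems (f-mask v∊))
          λ (_ , no-smaller) → no-smaller v v∊ refl
            (≤∧≢⇒< (≮⇒≥ ¬<) (λ eq → moved (sym (Fin.toℕ-injective eq))))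
    bound : length F + length F ≤ card mask + card Fixed
    bound = begin
      length F + length F ≡⟨ cong (length F +_) split ⟨
      length F + (length (filter fixed? F) + length movedF) ≤⟨ +-monoʳ-≤ (length F) (+-mono-≤ fixed-bound moved-bound) ⟩
      length F + (card Fixed + length NF) ≡⟨ cong (length F +_) (+-comm (card Fixed) _) ⟩
      length F + (length NF + card Fixed) ≡⟨ +-assoc (length F) _ _ ⟨
      length F + length NF + card Fixed ≡⟨ cong (_+ card Fixed) (length-filter-split free? (elems mask)) ⟩
      card mask + card Fixed ∎
      where open ≤-Reasoning
    bools = true ∷ false ∷ []
    bool∈ : ∀ b → b ∈ˡ bools
    bool∈ true = here refl
    bool∈ false = there (here refl)
    determined : ∀ {S S′} → S ∈ˡ invariants → S′ ∈ˡ invariants → map (lookup S) F ≡ map (lookup S′) F → S ≡ S′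
    determined {S} {S′} S∈ S′∈ eq = Vec-ext λ v → go v (<ᶠ-wellFounded v)
      where
      S-inv = ∈-filter⁻ invariant? {xs = subsetsOf mask} S∈
      S′-inv = ∈-filter⁻ invariant? {xs = subsetsOf mask} S′∈
      outside : ∀ {T v} → T ∈ˡ subsetsOf mask → ¬ v ∈ mask → lookup T v ≡ false
      outside T∈ v∉ = lookup-∉ (v∉ ∘ subsetsOf-⊆ mask T∈)
      go : ∀ v → Acc Fin._<_ v → lookup S v ≡ lookup S′ v
      go v (acc rec) with v ∈? mask
      ... | no v∉ = trans (outside {S} (proj₁ S-inv) v∉) (sym (outside {S′} (proj₁ S′-inv) v∉))
      ... | yes v∊ with f v Fin.<? v
      ...   | yes fv<v = trans (sym (proj₂ S-inv v v∊)) (trans (go (f v) (rec fv<v)) (proj₂ S′-inv v v∊))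
      ...   | no ¬fv<v with Fin.any? (λ u → (u ∈? mask) ×-dec ((f u Fin.≟ v) ×-dec (u Fin.<? v)))
      ...     | yes (u , u∊ , refl , u<v) = trans (proj₂ S-inv u u∊) (trans (go u (rec u<v)) (sym (proj₂ S′-inv u u∊)))
      ...     | no none = map-agree F eq (∈-filter⁺ free? (∈-elems v∊)
                  (¬fv<v , λ u u∊ fu≡v u<v → none (u , u∊ , fu≡v , u<v)))
    count : length invariants ≤ 2 ^ length F
    count = begin
      length invariants ≤⟨ length-≤-inj (λ S → map (lookup S) F) (Unique.filter⁺ invariant? (subsetsOf-unique mask))
                             (λ {S} _ → subst (λ k → map (lookup S) F ∈ˡ tuples bools k) (length-map (lookup S) F)
                               (∈-tuples (λ {b} _ → bool∈ b)))
                             determined ⟩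
      length (tuples bools (length F)) ≡⟨ tuples-length bools (length F) ⟩
      2 ^ length F ∎
      where open ≤-Reasoning

cap : ∀ {A : Set} → ℕ → List A → List A
cap N xs with length xs ≤? N
... | yes _ = xs
... | no _ = []

cap-length : ∀ {A : Set} N (xs : List A) → length (cap N xs) ≤ N
cap-length N xs with length xs ≤? N
... | yes le = le
... | no _ = z≤n

∈-cap : ∀ {A : Set} {N} {xs : List A} {x} → length xs ≤ N → x ∈ˡ xs → x ∈ˡ cap N xs
∈-cap {N = N} {xs} le p with length xs ≤? N
... | yes _ = p
... | no ¬le = contradiction le ¬le

∈-sublists : ∀ {A B : Set} (f : A → List B) {xs x y} → x ∈ˡ xs → y ∈ˡ f x → y ∈ˡ concatMap f xs
∈-sublists f x∈ y∈ = ∈-concatMap⁺ f (lose x∈ y∈)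

selections : ∀ {A B : Set} → (A → List B) → List A → List (List B)
selections f [] = [] ∷ []
selections f (x ∷ xs) = cartesianProductWith _∷_ (f x) (selections f xs)

selections-length : ∀ {A B : Set} (f : A → List B) {c} xs → (∀ x → length (f x) ≡ c) →
  length (selections f xs) ≡ c ^ length xs
selections-length f [] len = refl
selections-length f (x ∷ xs) len =
  trans (product-length _∷_ (f x) (selections f xs)) (cong₂ _*_ (len x) (selections-length f xs len))

∈-selections : ∀ {A B : Set} {f : A → List B} (g : A → B) xs → (∀ x → g x ∈ˡ f x) → map g xs ∈ˡ selections f xs
∈-selections g [] p = here refl
∈-selections g (x ∷ xs) p = ∈-cartesianProductWith⁺ _∷_ (p x) (∈-selections g xs p)

Unique⇒AllPairs : ∀ {A : Set} {Q : A → Set} {R : A → A → Set} {xs} → Unique xs → (∀ {x} → x ∈ˡ xs → Q x) →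
  (∀ {x y} → Q x → Q y → x ≢ y → R x y) → AllPairs R xs
Unique⇒AllPairs [] q r = []
Unique⇒AllPairs (x≢ ∷ uniq) q r =
  All.tabulate (λ y∈ → r (q (here refl)) (q (there y∈)) (All.lookup x≢ y∈)) ∷ Unique⇒AllPairs uniq (q ∘ there) r

funToFin-cong : ∀ {m n} {f g : Fin m → Fin n} → (∀ i → f i ≡ g i) → Fin.funToFin f ≡ Fin.funToFin g
funToFin-cong {zero} eq = refl
funToFin-cong {suc m} eq = cong₂ Fin.combine (eq zero) (funToFin-cong (eq ∘ suc))

double-half≤ : ∀ m → ⌊ m /2⌋ + ⌊ m /2⌋ ≤ m
double-half≤ m = ≤-trans (+-monoʳ-≤ ⌊ m /2⌋ (⌊n/2⌋≤⌈n/2⌉ m)) (≤-reflexive (⌊n/2⌋+⌈n/2⌉≡n m))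

half-≤ : ∀ {k m} → k + k ≤ m → k ≤ ⌊ m /2⌋
half-≤ {k} {m} le = ≤-trans (≤-reflexive (n≡⌊n+n/2⌋ k)) (⌊n/2⌋-mono le)

∈-replicate : ∀ {A : Set} {x y : A} k → y ∈ˡ replicate k x → y ≡ x
∈-replicate (suc k) (here refl) = refl
∈-replicate (suc k) (there p) = ∈-replicate k p

-- Arithmetic of the bound

^-distribʳ-* : ∀ k a b → (a * b) ^ k ≡ a ^ k * b ^ k
^-distribʳ-* zero a b = refl
^-distribʳ-* (suc k) a b =
  trans (cong (a * b *_) (^-distribʳ-* k a b)) (interchange a b (a ^ k) (b ^ k))
  where
  interchange : ∀ a b c d → a * b * (c * d) ≡ a * c * (b * d)
  interchange = solve-∀

-- (p − K)(p − E K) ≥ 0, with both sides moved so that no subtraction occurs.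
quadratic : ∀ E K p → K ≤ p → E * K ≤ p → p * ((E + 1) * K) ≤ p * p + E * (K * K)
quadratic E K p K≤p EK≤p with m≤n⇒∃[o]m+o≡n K≤p
... | d , refl with m≤n⇒∃[o]m+o≡n EK≤p
... | c , eq = begin
  (K + d) * ((E + 1) * K) ≡⟨ step E K d ⟩
  (E * K) * (K + d) + K * (K + d) ≤⟨ m≤m+n _ (d * c) ⟩
  (E * K) * (K + d) + K * (K + d) + d * c ≡⟨ step₂ (E * K) K d c ⟩
  (E * K) * K + d * (E * K + c) + K * (K + d) ≡⟨ cong (λ z → (E * K) * K + d * z + K * (K + d)) eq ⟩
  (E * K) * K + d * (K + d) + K * (K + d) ≡⟨ step₃ E K d ⟩
  (K + d) * (K + d) + E * (K * K) ∎
  where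
  open ≤-Reasoning
  step : ∀ E K d → (K + d) * ((E + 1) * K) ≡ (E * K) * (K + d) + K * (K + d)
  step = solve-∀
  step₂ : ∀ F K d c → F * (K + d) + K * (K + d) + d * c ≡ F * K + d * (F + c) + K * (K + d)
  step₂ = solve-∀
  step₃ : ∀ E K d → (E * K) * K + d * (K + d) + K * (K + d) ≡ (K + d) * (K + d) + E * (K * K)
  step₃ = solve-∀

2^-pos : ∀ k → 1 ≤ 2 ^ k
2^-pos k = m^n>0 2 k

module _ {m E q : ℕ} (E≥1 : 1 ≤ E) (E-log : 2 ^ E ≤ m * 2) (4q≤3m : 4 * q ≤ 3 * m) where

  -- With u = log₂ n and E ≤ u, the deficit 5 m^E 2^q is admissible because m^E n ≤ 2^(u²).
  deficit-bound : ∀ D → D ≤ 5 * (m ^ E * 2 ^ q) → ∀ p s → 1 ≤ s →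
    2 ^ (p * p) * 5 ^ (64 * s * s) * 2 ^ (24 * (m * 2) * s * s) < (D * (m * 2)) ^ (64 * s * s) →
    2 ^ p ≤ (m * 2) ^ (8 * s)
  deficit-bound D D≤ p s s≥1 hyp with 2 ^ p ≤? (m * 2) ^ (8 * s)
  ... | yes le = le
  ... | no ¬le = contradiction hyp (≤⇒≯ (begin
    (D * n) ^ N ≤⟨ ^-monoˡ-≤ N (*-monoˡ-≤ n D≤) ⟩
    (5 * (m ^ E * 2 ^ q) * n) ^ N ≡⟨ cong (_^ N) (rearrange (m ^ E) (2 ^ q) n) ⟩
    (m ^ E * n * (5 * 2 ^ q)) ^ N ≡⟨ ^-distribʳ-* N (m ^ E * n) (5 * 2 ^ q) ⟩
    (m ^ E * n) ^ N * (5 * 2 ^ q) ^ N ≡⟨ cong ((m ^ E * n) ^ N *_) (^-distribʳ-* N 5 (2 ^ q)) ⟩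
    (m ^ E * n) ^ N * (5 ^ N * (2 ^ q) ^ N) ≤⟨ *-mono-≤ main (*-monoʳ-≤ (5 ^ N) q-part) ⟩
    2 ^ (p * p) * (5 ^ N * 2 ^ (24 * n * s * s)) ≡⟨ *-assoc (2 ^ (p * p)) (5 ^ N) _ ⟨
    2 ^ (p * p) * 5 ^ N * 2 ^ (24 * n * s * s) ∎))
    where
    open ≤-Reasoning
    n = m * 2
    K = 8 * s
    N = 64 * s * s
    rearrange : ∀ a b c → 5 * (a * b) * c ≡ a * c * (5 * b)
    rearrange = solve-∀
    N≡KK : N ≡ K * K
    N≡KK = lemma s
      where
      lemma : ∀ s → 64 * s * s ≡ (8 * s) * (8 * s)
      lemma = solve-∀
    small : n ^ K ≤ 2 ^ p
    small = <⇒≤ (≰⇒> ¬le)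
    EK≤p : E * K ≤ p
    EK≤p with E * K ≤? p
    ... | yes le = le
    ... | no ¬p = contradiction (≰⇒> ¬le) (≤⇒≯ (begin
      2 ^ p ≤⟨ ^-monoʳ-≤ 2 (<⇒≤ (≰⇒> ¬p)) ⟩
      2 ^ (E * K) ≡⟨ ^-*-assoc 2 E K ⟨
      (2 ^ E) ^ K ≤⟨ ^-monoˡ-≤ K E-log ⟩
      n ^ K ∎))
    K≤p : K ≤ p
    K≤p = ≤-trans (m≤n*m K E {{>-nonZero E≥1}}) EK≤p
    -- With u = log₂ n, m^E n = n^(E+1) / 2^E has logarithm (E + 1) u - E, which is at most u²
    -- because (u - 1)(u - E) ≥ 0. Here p / K replaces u, and the factor 2^(E N) clears the
    -- denominator.
    main : (m ^ E * n) ^ N ≤ 2 ^ (p * p)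
    main = *-cancelʳ-≤ _ _ (2 ^ (E * N)) {{>-nonZero (2^-pos (E * N))}} (begin
      (m ^ E * n) ^ N * 2 ^ (E * N) ≡⟨ cong ((m ^ E * n) ^ N *_) (^-*-assoc 2 E N) ⟨
      (m ^ E * n) ^ N * (2 ^ E) ^ N ≡⟨ ^-distribʳ-* N (m ^ E * n) (2 ^ E) ⟨
      (m ^ E * n * 2 ^ E) ^ N ≡⟨ cong (_^ N) (trans (swap (m ^ E) n (2 ^ E)) (cong (_* n) (sym (^-distribʳ-* E m 2)))) ⟩
      (n ^ E * n) ^ N ≡⟨ cong (λ z → (n ^ E * z) ^ N) (^-identityʳ n) ⟨
      (n ^ E * n ^ 1) ^ N ≡⟨ cong (_^ N) (^-distribˡ-+-* n E 1) ⟨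
      (n ^ (E + 1)) ^ N ≡⟨ ^-*-assoc n (E + 1) N ⟩
      n ^ ((E + 1) * N) ≡⟨ cong (n ^_) (trans (cong ((E + 1) *_) N≡KK) (assoc′ (E + 1) K)) ⟩
      n ^ (K * ((E + 1) * K)) ≡⟨ ^-*-assoc n K ((E + 1) * K) ⟨
      (n ^ K) ^ ((E + 1) * K) ≤⟨ ^-monoˡ-≤ ((E + 1) * K) small ⟩
      (2 ^ p) ^ ((E + 1) * K) ≡⟨ ^-*-assoc 2 p ((E + 1) * K) ⟩
      2 ^ (p * ((E + 1) * K)) ≤⟨ ^-monoʳ-≤ 2 (quadratic E K p K≤p EK≤p) ⟩
      2 ^ (p * p + E * (K * K)) ≡⟨ cong (λ z → 2 ^ (p * p + E * z)) N≡KK ⟨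
      2 ^ (p * p + E * N) ≡⟨ ^-distribˡ-+-* 2 (p * p) (E * N) ⟩
      2 ^ (p * p) * 2 ^ (E * N) ∎)
      where
      swap : ∀ a b c → a * b * c ≡ a * c * b
      swap = solve-∀
      assoc′ : ∀ a b → a * (b * b) ≡ b * (a * b)
      assoc′ = solve-∀
    q-part : (2 ^ q) ^ N ≤ 2 ^ (24 * n * s * s)
    q-part = begin
      (2 ^ q) ^ N ≡⟨ ^-*-assoc 2 q N ⟩
      2 ^ (q * N) ≡⟨ cong (2 ^_) (e₁ q s) ⟩
      2 ^ (4 * q * (16 * s * s)) ≤⟨ ^-monoʳ-≤ 2 (*-monoˡ-≤ (16 * s * s) 4q≤3m) ⟩
      2 ^ (3 * m * (16 * s * s)) ≡⟨ cong (2 ^_) (e₂ m s) ⟩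
      2 ^ (24 * n * s * s) ∎
      where
      e₁ : ∀ q s → q * (64 * s * s) ≡ 4 * q * (16 * s * s)
      e₁ = solve-∀
      e₂ : ∀ m s → 3 * m * (16 * s * s) ≡ 24 * (m * 2) * s * s
      e₂ = solve-∀

^-cancel-≤ : ∀ k {a b} → 1 ≤ k → a ^ k ≤ b ^ k → a ≤ b
^-cancel-≤ k {a} {b} k≥1 le with a ≤? b
... | yes a≤b = a≤b
... | no a≰b = contradiction le (<⇒≱ (^-monoˡ-< k {{>-nonZero k≥1}} (≰⇒> a≰b)))

-- Equality holds at 16, which is why 16 separates large from small subgroups. The induction step
-- needs (1 + z)^4 ≤ 2 z^4; it follows from (1 + z)² ≤ (6/5) z², as 36/25 < 2.
fourth-power≤2^ : ∀ {z} → 16 ≤ z → z ^ 4 ≤ 2 ^ z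
fourth-power≤2^ = go ∘ ≤⇒≤′
  where
  open ≤-Reasoning
  e₁ : ∀ z → 25 * (z * (z * (z * (z * 1)))) ≡ (5 * (z * z)) * (5 * (z * z))
  e₁ = solve-∀
  e₂ : ∀ z → (6 * (z * z)) * (6 * (z * z)) + 14 * (z * (z * (z * (z * 1)))) ≡ 25 * (2 * (z * (z * (z * (z * 1)))))
  e₂ = solve-∀
  e₃ : ∀ z → 5 * ((1 + z) * (1 + z)) ≡ 5 + 10 * z + 5 * (z * z)
  e₃ = solve-∀
  e₄ : ∀ z → 6 * z + 10 * z + 5 * (z * z) ≡ 16 * z + 5 * (z * z)
  e₄ = solve-∀
  e₅ : ∀ z → z * z + 5 * (z * z) ≡ 6 * (z * z)
  e₅ = solve-∀
  square : ∀ z → 16 ≤ z → 5 * ((1 + z) * (1 + z)) ≤ 6 * (z * z)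
  square z 16≤z = begin
    5 * ((1 + z) * (1 + z))         ≡⟨ e₃ z ⟩
    5 + 10 * z + 5 * (z * z)        ≤⟨ +-monoˡ-≤ (5 * (z * z)) (+-monoˡ-≤ (10 * z) 5≤6z) ⟩
    6 * z + 10 * z + 5 * (z * z)    ≡⟨ e₄ z ⟩
    16 * z + 5 * (z * z)            ≤⟨ +-monoˡ-≤ (5 * (z * z)) (*-monoˡ-≤ z 16≤z) ⟩
    z * z + 5 * (z * z)             ≡⟨ e₅ z ⟩
    6 * (z * z)                     ∎
    where
    5≤6z : 5 ≤ 6 * z
    5≤6z = ≤-trans (m≤m+n 5 1) (*-monoʳ-≤ 6 (≤-trans (s≤s z≤n) 16≤z))
  double : ∀ z → 16 ≤ z → (1 + z) ^ 4 ≤ 2 * z ^ 4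
  double z 16≤z = *-cancelˡ-≤ 25 (begin
    25 * (1 + z) ^ 4                      ≡⟨ e₁ (1 + z) ⟩
    (5 * ((1 + z) * (1 + z))) * (5 * ((1 + z) * (1 + z)))
                                          ≤⟨ *-mono-≤ (square z 16≤z) (square z 16≤z) ⟩
    (6 * (z * z)) * (6 * (z * z))         ≤⟨ m≤m+n _ (14 * z ^ 4) ⟩
    (6 * (z * z)) * (6 * (z * z)) + 14 * z ^ 4   ≡⟨ e₂ z ⟩
    25 * (2 * z ^ 4)                      ∎)
  go : ∀ {z} → 16 ≤′ z → z ^ 4 ≤ 2 ^ z
  go ≤′-refl = ≤-refl
  go (≤′-step {z} 16≤′z) = ≤-trans (double z (≤′⇒≤ 16≤′z)) (*-monoʳ-≤ 2 (go 16≤′z))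

-- z^r counts the ways to pick one of z elements for each of r cosets of size z; fourth powers stand
-- in for the exponent m/4.
letters-bound : ∀ {m z} r → 16 ≤ z → r * z ≤ m → (z ^ r) ^ 4 ≤ 2 ^ m
letters-bound {m} {z} r 16≤z rz≤m = begin
  (z ^ r) ^ 4   ≡⟨ ^-*-assoc z r 4 ⟩
  z ^ (r * 4)   ≡⟨ cong (z ^_) (*-comm r 4) ⟩
  z ^ (4 * r)   ≡⟨ ^-*-assoc z 4 r ⟨
  (z ^ 4) ^ r   ≤⟨ ^-monoˡ-≤ r (fourth-power≤2^ 16≤z) ⟩
  (2 ^ z) ^ r   ≡⟨ ^-*-assoc 2 z r ⟩
  2 ^ (z * r)   ≤⟨ ^-monoʳ-≤ 2 (≤-trans (≤-reflexive (*-comm z r)) rz≤m) ⟩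
  2 ^ m         ∎
  where open ≤-Reasoning

module _ (m : ℕ) where

  ⌊3m/4⌋ : ℕ
  ⌊3m/4⌋ = (3 * m) / 4

  4q≤3m : 4 * ⌊3m/4⌋ ≤ 3 * m
  4q≤3m = ≤-trans (≤-reflexive (*-comm 4 ⌊3m/4⌋)) (≤-trans (m≤n+m _ ((3 * m) % 4)) (≤-reflexive (sym (m≡m%n+[m/n]*n (3 * m) 4))))

  3m≤4q+3 : 3 * m ≤ 4 * ⌊3m/4⌋ + 3
  3m≤4q+3 = begin
    3 * m                   ≡⟨ m≡m%n+[m/n]*n (3 * m) 4 ⟩
    (3 * m) % 4 + ⌊3m/4⌋ * 4     ≤⟨ +-monoˡ-≤ (⌊3m/4⌋ * 4) (s≤s⁻¹ (m%n<n (3 * m) 4)) ⟩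
    3 + ⌊3m/4⌋ * 4               ≡⟨ trans (+-comm 3 (⌊3m/4⌋ * 4)) (cong (_+ 3) (*-comm ⌊3m/4⌋ 4)) ⟩
    4 * ⌊3m/4⌋ + 3               ∎
    where open ≤-Reasoning

  half-fixed-exponent : ∀ k fix → k + k ≤ m + fix → fix + fix ≤ m → k ≤ ⌊3m/4⌋
  half-fixed-exponent k fix 2k≤ 2fix≤ = s≤s⁻¹ (*-cancelˡ-< 4 k (suc ⌊3m/4⌋) (begin-strict
    4 * k                         ≡⟨ e₁ k ⟩
    (k + k) + (k + k)             ≤⟨ +-mono-≤ 2k≤ 2k≤ ⟩
    (m + fix) + (m + fix)         ≡⟨ e₂ m fix ⟩
    m + m + (fix + fix)           ≤⟨ +-monoʳ-≤ (m + m) 2fix≤ ⟩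
    m + m + m                     ≡⟨ e₃ m ⟩
    3 * m                         ≤⟨ 3m≤4q+3 ⟩
    4 * ⌊3m/4⌋ + 3                     <⟨ ≤-refl ⟩
    suc (4 * ⌊3m/4⌋ + 3)               ≡⟨ e₄ ⌊3m/4⌋ ⟩
    4 * suc ⌊3m/4⌋                     ∎))
    where
    open ≤-Reasoning
    e₁ : ∀ k → 4 * k ≡ (k + k) + (k + k)
    e₁ = solve-∀
    e₂ : ∀ m x → (m + x) + (m + x) ≡ m + m + (x + x)
    e₂ = solve-∀
    e₃ : ∀ m → m + m + m ≡ 3 * m
    e₃ = solve-∀
    e₄ : ∀ q → suc (4 * q + 3) ≡ 4 * suc q
    e₄ = solve-∀

  -- 2^(m/4) · 2^(m/2) = 2^(3m/4); rounding that exponent down loses less than one, hence `1 +`.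
  letters-total : ∀ a h → a ^ 4 ≤ 2 ^ m → h + h ≤ m → a * 2 ^ h ≤ 2 ^ (1 + ⌊3m/4⌋)
  letters-total a h a⁴≤ 2h≤m = ^-cancel-≤ 4 (s≤s z≤n) (begin
    (a * 2 ^ h) ^ 4               ≡⟨ ^-distribʳ-* 4 a (2 ^ h) ⟩
    a ^ 4 * (2 ^ h) ^ 4           ≤⟨ *-monoˡ-≤ ((2 ^ h) ^ 4) a⁴≤ ⟩
    2 ^ m * (2 ^ h) ^ 4           ≡⟨ cong (2 ^ m *_) (^-*-assoc 2 h 4) ⟩
    2 ^ m * 2 ^ (h * 4)           ≡⟨ ^-distribˡ-+-* 2 m (h * 4) ⟨
    2 ^ (m + h * 4)               ≤⟨ ^-monoʳ-≤ 2 exponents ⟩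
    2 ^ ((1 + ⌊3m/4⌋) * 4)             ≡⟨ ^-*-assoc 2 (1 + ⌊3m/4⌋) 4 ⟨
    (2 ^ (1 + ⌊3m/4⌋)) ^ 4             ∎)
    where
    open ≤-Reasoning
    e₁ : ∀ m h → m + h * 4 ≡ m + ((h + h) + (h + h))
    e₁ = solve-∀
    e₂ : ∀ m → m + (m + m) ≡ 3 * m
    e₂ = solve-∀
    e₃ : ∀ q → (1 + q) * 4 ≡ 4 * q + 4
    e₃ = solve-∀
    exponents : m + h * 4 ≤ (1 + ⌊3m/4⌋) * 4
    exponents = begin
      m + h * 4                   ≡⟨ e₁ m h ⟩
      m + ((h + h) + (h + h))     ≤⟨ +-monoʳ-≤ m (+-mono-≤ 2h≤m 2h≤m) ⟩
      m + (m + m)                 ≡⟨ e₂ m ⟩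
      3 * m                       ≤⟨ 3m≤4q+3 ⟩
      4 * ⌊3m/4⌋ + 3                   ≤⟨ +-monoʳ-≤ (4 * ⌊3m/4⌋) (n≤1+n 3) ⟩
      4 * ⌊3m/4⌋ + 4                   ≡⟨ e₃ ⌊3m/4⌋ ⟨
      (1 + ⌊3m/4⌋) * 4                 ∎

  -- The hypothesis keeps A below about 2^(m/4), so A · 2^(m/2) is below 2^(3m/4). Multiplying by
  -- 2^⌊3m/4⌋ makes the hypothesis applicable, and 5 > 2 covers the rounding in m + h ≤ 1 + 2⌊3m/4⌋.
  few-letters-total : ∀ A h → 5 * (A * 2 ^ ⌊3m/4⌋) < 2 ^ m → h + h ≤ m → A * 2 ^ h ≤ 2 ^ ⌊3m/4⌋
  few-letters-total A h A< 2h≤m = *-cancelʳ-≤ _ _ (2 ^ ⌊3m/4⌋) {{>-nonZero (2^-pos ⌊3m/4⌋)}} (*-cancelˡ-≤ 2 (begin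
    2 * (A * 2 ^ h * 2 ^ ⌊3m/4⌋)       ≤⟨ *-monoˡ-≤ (A * 2 ^ h * 2 ^ ⌊3m/4⌋) (s≤s (s≤s (z≤n {3}))) ⟩
    5 * (A * 2 ^ h * 2 ^ ⌊3m/4⌋)       ≡⟨ e₁ A (2 ^ h) (2 ^ ⌊3m/4⌋) ⟩
    5 * (A * 2 ^ ⌊3m/4⌋) * 2 ^ h       ≤⟨ *-monoˡ-≤ (2 ^ h) (<⇒≤ A<) ⟩
    2 ^ m * 2 ^ h                 ≡⟨ ^-distribˡ-+-* 2 m h ⟨
    2 ^ (m + h)                   ≤⟨ ^-monoʳ-≤ 2 exponents ⟩
    2 ^ (1 + (⌊3m/4⌋ + ⌊3m/4⌋))             ≡⟨ cong (2 *_) (^-distribˡ-+-* 2 ⌊3m/4⌋ ⌊3m/4⌋) ⟩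
    2 * (2 ^ ⌊3m/4⌋ * 2 ^ ⌊3m/4⌋)           ∎))
    where
    open ≤-Reasoning
    e₁ : ∀ a b c → 5 * (a * b * c) ≡ 5 * (a * c) * b
    e₁ = solve-∀
    e₂ : ∀ m h → 4 * (m + h) ≡ 4 * m + ((h + h) + (h + h))
    e₂ = solve-∀
    e₃ : ∀ m → 4 * m + (m + m) ≡ 3 * m + 3 * m
    e₃ = solve-∀
    e₄ : ∀ q → (4 * q + 3) + (4 * q + 3) + 2 ≡ 4 * (2 + (q + q))
    e₄ = solve-∀
    exponents : m + h ≤ 1 + (⌊3m/4⌋ + ⌊3m/4⌋)
    exponents = s≤s⁻¹ (*-cancelˡ-< 4 (m + h) (2 + (⌊3m/4⌋ + ⌊3m/4⌋)) (begin-strict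
      4 * (m + h)                 ≡⟨ e₂ m h ⟩
      4 * m + ((h + h) + (h + h)) ≤⟨ +-monoʳ-≤ (4 * m) (+-mono-≤ 2h≤m 2h≤m) ⟩
      4 * m + (m + m)             ≡⟨ e₃ m ⟩
      3 * m + 3 * m               ≤⟨ +-mono-≤ 3m≤4q+3 3m≤4q+3 ⟩
      (4 * ⌊3m/4⌋ + 3) + (4 * ⌊3m/4⌋ + 3)   <⟨ m<m+n _ (s≤s z≤n) ⟩
      (4 * ⌊3m/4⌋ + 3) + (4 * ⌊3m/4⌋ + 3) + 2 ≡⟨ e₄ ⌊3m/4⌋ ⟩
      4 * (2 + (⌊3m/4⌋ + ⌊3m/4⌋))           ∎))

  -- For D ≤ 7 the term to be subtracted is already at least 2^m, by a numerical check on each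
  -- dyadic range of m. The value 8 is what m^18 ≤ m^(2 (D + 1)) requires in the final count.
  large-log : ∀ D → 2 ^ D ≤ m → m < 2 ^ suc D → 5 * (m ^ suc D * 2 ^ ⌊3m/4⌋) < 2 ^ m → 8 ≤ D
  large-log D 2^D≤m m<2^D+1 hyp with 8 ≤? D
  ... | yes le = le
  ... | no D<8 = contradiction hyp (≤⇒≯ (enough D (s≤s⁻¹ (≰⇒> D<8)) 2^D≤m m<2^D+1))
    where
    open ≤-Reasoning
    from-exponent : ∀ c E → m ≤ c + ⌊3m/4⌋ → 2 ^ c ≤ 5 * m ^ E → 2 ^ m ≤ 5 * (m ^ E * 2 ^ ⌊3m/4⌋)
    from-exponent c E m≤ le = begin
      2 ^ m                 ≤⟨ ^-monoʳ-≤ 2 m≤ ⟩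
      2 ^ (c + ⌊3m/4⌋)           ≡⟨ ^-distribˡ-+-* 2 c ⌊3m/4⌋ ⟩
      2 ^ c * 2 ^ ⌊3m/4⌋         ≤⟨ *-monoˡ-≤ (2 ^ ⌊3m/4⌋) le ⟩
      5 * m ^ E * 2 ^ ⌊3m/4⌋     ≡⟨ *-assoc 5 (m ^ E) (2 ^ ⌊3m/4⌋) ⟩
      5 * (m ^ E * 2 ^ ⌊3m/4⌋)   ∎
    quarter : ∀ c → m ≤ 4 * c → m ≤ c + ⌊3m/4⌋
    quarter c m≤4c = s≤s⁻¹ (*-cancelˡ-< 4 m (suc (c + ⌊3m/4⌋)) (begin-strict
      4 * m                       ≡⟨ e₁ m ⟩
      m + 3 * m                   ≤⟨ +-mono-≤ m≤4c 3m≤4q+3 ⟩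
      4 * c + (4 * ⌊3m/4⌋ + 3)         <⟨ ≤-refl ⟩
      suc (4 * c + (4 * ⌊3m/4⌋ + 3))   ≡⟨ e₂ c ⌊3m/4⌋ ⟩
      4 * suc (c + ⌊3m/4⌋)             ∎))
      where
      e₁ : ∀ m → 4 * m ≡ m + 3 * m
      e₁ = solve-∀
      e₂ : ∀ c q → suc (4 * c + (4 * q + 3)) ≡ 4 * suc (c + q)
      e₂ = solve-∀
    via : ∀ c E b → m ≤ 4 * c → b ≤ m → 2 ^ c ≤ 5 * b ^ E → 2 ^ m ≤ 5 * (m ^ E * 2 ^ ⌊3m/4⌋)
    via c E b m≤ b≤m le = from-exponent c E (quarter c m≤) (≤-trans le (*-monoʳ-≤ 5 (^-monoˡ-≤ E b≤m)))
    enough : ∀ D → D ≤ 7 → 2 ^ D ≤ m → m < 2 ^ suc D → 2 ^ m ≤ 5 * (m ^ suc D * 2 ^ ⌊3m/4⌋)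
    enough 0 _ l u = via 1 1 1 (≤-trans (s≤s⁻¹ u) (s≤s z≤n)) l (≤ᵇ⇒≤ _ _ _)
    enough 1 _ l u = via 1 2 2 (<⇒≤ u) l (≤ᵇ⇒≤ _ _ _)
    enough 2 _ l u = via 2 3 4 (<⇒≤ u) l (≤ᵇ⇒≤ _ _ _)
    enough 3 _ l u = via 4 4 8 (<⇒≤ u) l (≤ᵇ⇒≤ _ _ _)
    enough 4 _ l u = via 8 5 16 (<⇒≤ u) l (≤ᵇ⇒≤ _ _ _)
    enough 5 _ l u = via 16 6 32 (<⇒≤ u) l (≤ᵇ⇒≤ _ _ _)
    enough 6 _ l u = via 32 7 64 (<⇒≤ u) l (≤ᵇ⇒≤ _ _ _)
    -- 5 · 128^8 = 5 · 2^56 exceeds 2^58 but not 2^59, so the lower bound 128 for m reaches only m ≤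
    -- 4 · 58 = 232; beyond that the lower bound 232 suffices.
    enough 7 _ l u with m ≤? 232
    ... | yes m≤ = via 58 8 128 m≤ l (≤ᵇ⇒≤ _ _ _)
    ... | no m≰ = via 64 8 232 (<⇒≤ u) (<⇒≤ (≰⇒> m≰)) (≤ᵇ⇒≤ _ _ _)
    enough (suc (suc (suc (suc (suc (suc (suc (suc D)))))))) (s≤s (s≤s (s≤s (s≤s (s≤s (s≤s (s≤s ()))))))) _ _

log-exists : ∀ m → 1 ≤ m → ∃ λ D → 2 ^ D ≤ m × m < 2 ^ suc D
log-exists (suc zero) _ = 0 , ≤-refl , ≤-refl
log-exists (suc m@(suc _)) _ with log-exists m (s≤s z≤n)
... | D , l , u with suc m <? 2 ^ suc D
... | yes lt = D , m≤n⇒m≤1+n l , lt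
... | no ≮ = suc D , ≮⇒≥ ≮ , ≤-<-trans u (^-monoʳ-< 2 ≤-refl {suc D} ≤-refl)

-- Groups

infixl 7 _⊕_
data Expr (k : ℕ) : Set where
  var : Fin k → Expr k
  ε : Expr k
  _⊕_ : Expr k → Expr k → Expr k
  ι : Expr k → Expr k

pattern v₀ = var zero
pattern v₁ = var (suc zero)
pattern v₂ = var (suc (suc zero))
pattern v₃ = var (suc (suc (suc zero)))
pattern v₄ = var (suc (suc (suc (suc zero))))

-- Free reduction of words: a letter is a variable with a sign, true for the variable itself.
module _ {k : ℕ} where
  Word : Set
  Word = List (Bool × Fin k)

  push : Bool × Fin k → Word → Word
  push l [] = l ∷ []
  push (s , i) ((s′ , j) ∷ w) with i Fin.≟ j | s Bool.≟ not s′
  ... | yes _ | yes _ = w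
  ... | _ | _ = (s , i) ∷ (s′ , j) ∷ w

  reduce reduce⁻ : Expr k → Word → Word
  reduce (var i) w = push (true , i) w
  reduce ε w = w
  reduce (a ⊕ b) w = reduce a (reduce b w)
  reduce (ι a) w = reduce⁻ a w
  reduce⁻ (var i) w = push (false , i) w
  reduce⁻ ε w = w
  reduce⁻ (a ⊕ b) w = reduce⁻ b (reduce⁻ a w)
  reduce⁻ (ι a) w = reduce a w

module GroupTheory {n : ℕ} (_·_ : Fin n → Fin n → Fin n) (e : Fin n) (_⁻¹ : Fin n → Fin n)
  (isGroup : IsGroup _≡_ _·_ e _⁻¹) where

  infixl 7 _∙_
  _∙_ : Fin n → Fin n → Fin n
  _∙_ = _·_
  infix 8 _⁻
  _⁻ : Fin n → Fin n
  _⁻ = _⁻¹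

  open IsGroup isGroup public using (assoc; identityˡ; identityʳ; inverseˡ; inverseʳ)

  module _ {k : ℕ} (ρ : Vec (Fin n) k) where
    ⟦_⟧ : Expr k → Fin n
    ⟦ var i ⟧ = lookup ρ i
    ⟦ ε ⟧ = e
    ⟦ a ⊕ b ⟧ = ⟦ a ⟧ ∙ ⟦ b ⟧
    ⟦ ι a ⟧ = ⟦ a ⟧ ⁻

    letter : Bool × Fin k → Fin n
    letter (true , i) = lookup ρ i
    letter (false , i) = lookup ρ i ⁻

    word : Word → Fin n
    word [] = e
    word (l ∷ w) = letter l ∙ word w

    cancelˡ : ∀ x w → x ⁻ ∙ (x ∙ w) ≡ w
    cancelˡ x w = trans (sym (assoc _ _ _)) (trans (cong (_∙ w) (inverseˡ x)) (identityˡ w))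

    cancelʳ : ∀ x w → x ∙ (x ⁻ ∙ w) ≡ w
    cancelʳ x w = trans (sym (assoc _ _ _)) (trans (cong (_∙ w) (inverseʳ x)) (identityˡ w))

    push-sound : ∀ l w → word (push l w) ≡ letter l ∙ word w
    push-sound l [] = refl
    push-sound (s , i) ((s′ , j) ∷ w) with i Fin.≟ j | s Bool.≟ not s′
    push-sound (s , i) ((true , i) ∷ w) | yes refl | yes refl = sym (cancelˡ (lookup ρ i) (word w))
    push-sound (s , i) ((false , i) ∷ w) | yes refl | yes refl = sym (cancelʳ (lookup ρ i) (word w))
    push-sound (s , i) ((s′ , j) ∷ w) | yes _ | no _ = refl
    push-sound (s , i) ((s′ , j) ∷ w) | no _ | _ = refl

    inverse-unique : ∀ {x y} → x ∙ y ≡ e → x ⁻ ≡ y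
    inverse-unique {x} {y} eq = trans (sym (identityʳ _)) (trans (cong (x ⁻ ∙_) (sym eq)) (cancelˡ x y))

    inverse-∙ : ∀ x y → (x ∙ y) ⁻ ≡ y ⁻ ∙ x ⁻
    inverse-∙ x y = inverse-unique (trans (assoc _ _ _) (trans (cong (x ∙_) (cancelʳ y (x ⁻))) (inverseʳ x)))

    reduce-sound : ∀ a w → word (reduce a w) ≡ ⟦ a ⟧ ∙ word w
    reduce⁻-sound : ∀ a w → word (reduce⁻ a w) ≡ ⟦ a ⟧ ⁻ ∙ word w
    reduce-sound (var i) w = push-sound (true , i) w
    reduce-sound ε w = sym (identityˡ _)
    reduce-sound (a ⊕ b) w = trans (reduce-sound a _) (trans (cong (⟦ a ⟧ ∙_) (reduce-sound b w)) (sym (assoc _ _ _)))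
    reduce-sound (ι a) w = reduce⁻-sound a w
    reduce⁻-sound (var i) w = push-sound (false , i) w
    reduce⁻-sound ε w = sym (trans (cong (_∙ word w) (inverse-unique (identityˡ e))) (identityˡ _))
    reduce⁻-sound (a ⊕ b) w = trans (reduce⁻-sound b _) (trans (cong (⟦ b ⟧ ⁻ ∙_) (reduce⁻-sound a w))
      (trans (sym (assoc _ _ _)) (cong (_∙ word w) (sym (inverse-∙ _ _)))))
    reduce⁻-sound (ι a) w = trans (reduce-sound a w) (cong (_∙ word w) (sym (inverse-unique (inverseˡ _))))

    solve : ∀ a b → reduce a [] ≡ reduce b [] → ⟦ a ⟧ ≡ ⟦ b ⟧
    solve a b eq = trans (sym (trans (reduce-sound a []) (identityʳ _)))
      (trans (cong word eq) (trans (reduce-sound b []) (identityʳ _)))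

  ∙-cancelˡ : ∀ x {y z} → x ∙ y ≡ x ∙ z → y ≡ z
  ∙-cancelˡ x {y} {z} eq = trans (solve (x ∷ y ∷ []) v₁ (ι v₀ ⊕ (v₀ ⊕ v₁)) refl)
    (trans (cong (x ⁻ ∙_) eq) (solve (x ∷ z ∷ []) (ι v₀ ⊕ (v₀ ⊕ v₁)) v₁ refl))

  ∙-cancelʳ : ∀ x {y z} → y ∙ x ≡ z ∙ x → y ≡ z
  ∙-cancelʳ x {y} {z} eq = trans (solve (x ∷ y ∷ []) v₁ (v₁ ⊕ v₀ ⊕ ι v₀) refl)
    (trans (cong (_∙ x ⁻) eq) (solve (x ∷ z ∷ []) (v₁ ⊕ v₀ ⊕ ι v₀) v₁ refl))

  record Subgroup (P : Subset n) : Set where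
    field
      has-e : e ∈ P
      has-∙ : ∀ {x y} → x ∈ P → y ∈ P → x ∙ y ∈ P
      has-⁻ : ∀ {x} → x ∈ P → x ⁻ ∈ P

  open Subgroup public

  subgroup? : ∀ P → Dec (Subgroup P)
  subgroup? P with (e ∈? P) ×-dec ((Fin.all? λ x → Fin.all? λ y → (x ∈? P) →-dec ((y ∈? P) →-dec (x ∙ y ∈? P)))
    ×-dec (Fin.all? λ x → (x ∈? P) →-dec (x ⁻ ∈? P)))
  ... | yes (a , b , c) = yes record { has-e = a ; has-∙ = b _ _ ; has-⁻ = c _ }
  ... | no ¬p = no λ s → ¬p (has-e s , (λ _ _ → has-∙ s) , λ _ → has-⁻ s)

  card-pos : ∀ {P} → Subgroup P → 1 ≤ card P
  card-pos sub = length-⊆ {xs = e ∷ []} ([] ∷ []) λ { (here refl) → ∈-elems (has-e sub) }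

  translate-unique : ∀ x (P : Subset n) → Unique (map (x ∙_) (elems P))
  translate-unique x P = Unique.map⁺ (∙-cancelˡ x) (elems-unique P)

  translate-disjoint : ∀ {P} → Subgroup P → ∀ {x} → x ∉ P →
    ∀ {z} → ¬ (z ∈ˡ map (x ∙_) (elems P) × z ∈ˡ elems P)
  translate-disjoint {P} sub {x} x∉P (p , q) with ∈-map⁻ _ p
  ... | y , y∈ , refl = x∉P (subst (_∈ P) (solve (x ∷ y ∷ []) (v₀ ⊕ v₁ ⊕ ι v₁) v₀ refl)
    (has-∙ sub (∈-elems⁻ q) (has-⁻ sub (∈-elems⁻ y∈))))

  translate-length : ∀ x (P : Subset n) → length (map (x ∙_) (elems P) ++ elems P) ≡ card P + card P
  translate-length x P = trans (length-++ (map (x ∙_) (elems P))) (cong (_+ card P) (length-map _ (elems P)))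

  -- P and its translate xP are disjoint parts of Q. This factor 2 drives both the number of
  -- generators and the bounds of the form "at most half".
  proper-card : ∀ {P Q} → Subgroup P → Subgroup Q → (∀ {x} → x ∈ P → x ∈ Q) → ∀ {x} → x ∈ Q → x ∉ P →
    card P + card P ≤ card Q
  proper-card {P} {Q} P-sub Q-sub P⊆Q {x} x∈Q x∉P = ≤-trans (≤-reflexive (sym (translate-length x P)))
    (length-⊆ (Unique.++⁺ (translate-unique x P) (elems-unique P) (translate-disjoint P-sub x∉P)) into)
    where
    into : ∀ {z} → z ∈ˡ map (x ∙_) (elems P) ++ elems P → z ∈ˡ elems Q
    into z∈ with ∈-++⁻ (map (x ∙_) (elems P)) z∈
    ... | inj₂ q = ∈-elems (P⊆Q (∈-elems⁻ q))
    ... | inj₁ q with ∈-map⁻ _ q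
    ... | y , y∈ , refl = ∈-elems (has-∙ Q-sub x∈Q (P⊆Q (∈-elems⁻ y∈)))

  -- M and xM already exhaust the group; a y in neither would give n + 1 distinct elements.
  index-2 : ∀ {M} → Subgroup M → card M * 2 ≡ n → ∀ {x y} → x ∉ M → y ∉ M → x ⁻ ∙ y ∈ M
  index-2 {M} sub 2m≡n {x} {y} x∉M y∉M with x ⁻ ∙ y ∈? M
  ... | yes p = p
  ... | no ¬p = contradiction too-many (≤⇒≯ (≤-reflexive (trans (length-tabulate id)
      (sym (trans (translate-length x M) (trans (cong (card M +_) (sym (+-identityʳ _))) (trans (*-comm 2 (card M)) 2m≡n)))))))
    where
    cosets = map (x ∙_) (elems M) ++ elems M
    y∉ : ∀ {z} → z ∈ˡ cosets → y ≢ z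
    y∉ z∈ refl with ∈-++⁻ (map (x ∙_) (elems M)) z∈
    ... | inj₂ q = y∉M (∈-elems⁻ q)
    ... | inj₁ q with ∈-map⁻ _ q
    ... | w , w∈ , refl = ¬p (subst (_∈ M) (solve (x ∷ w ∷ []) v₁ (ι v₀ ⊕ (v₀ ⊕ v₁)) refl) (∈-elems⁻ w∈))
    too-many : length cosets < length (allFin n)
    too-many = length-⊆ {xs = y ∷ cosets} (All.tabulate y∉ ∷
        Unique.++⁺ (translate-unique x M) (elems-unique M) (translate-disjoint sub x∉M)) (λ {z} _ → ∈-allFin z)

  -- Intersecting all subgroups makes the generated subgroup decidable without orders of elements.
  closure? : ∀ gs x → Dec (∀ Q → Subgroup Q → (∀ g → g ∈ˡ gs → g ∈ Q) → x ∈ Q)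
  closure? gs x = ∀-subset? λ Q → subgroup? Q →-dec (all-in? Q →-dec (x ∈? Q))
    where
    all-in? : ∀ Q → Dec (∀ g → g ∈ˡ gs → g ∈ Q)
    all-in? Q with All.all? (_∈? Q) gs
    ... | yes p = yes λ _ → All.lookup p
    ... | no ¬p = no λ p → ¬p (All.tabulate (p _))

  closure : List (Fin n) → Subset n
  closure gs = ⟪ closure? gs ⟫

  closure-sub : ∀ gs → Subgroup (closure gs)
  closure-sub gs = record
    { has-e = ∊⁺ (closure? gs) λ Q sub _ → has-e sub
    ; has-∙ = λ p q → ∊⁺ (closure? gs) λ Q sub gs⊆ → has-∙ sub (∊⁻ (closure? gs) p Q sub gs⊆) (∊⁻ (closure? gs) q Q sub gs⊆)
    ; has-⁻ = λ p → ∊⁺ (closure? gs) λ Q sub gs⊆ → has-⁻ sub (∊⁻ (closure? gs) p Q sub gs⊆)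
    }

  closure-∋ : ∀ {gs g} → g ∈ˡ gs → g ∈ closure gs
  closure-∋ {gs} g∈ = ∊⁺ (closure? gs) λ Q _ gs⊆ → gs⊆ _ g∈

  closure-min : ∀ {gs Q} → Subgroup Q → (∀ {g} → g ∈ˡ gs → g ∈ Q) → ∀ {x} → x ∈ closure gs → x ∈ Q
  closure-min {gs} sub gs⊆ x∈ = ∊⁻ (closure? gs) x∈ _ sub (λ _ → gs⊆)

  -- Every element added from outside the closure at least doubles it, so the gap of less than
  -- 2^(k+1) is closed after k steps. The list is padded with e to length exactly k, so that it can
  -- be found among the `tuples` of that length.
  generators : ∀ {P} → Subgroup P → ∀ k gs → (∀ {g} → g ∈ˡ gs → g ∈ P) → card P < 2 ^ suc k * card (closure gs) →
    ∃ λ hs → length hs ≡ k × (∀ {h} → h ∈ˡ hs → h ∈ P) × closure (hs ++ gs) ≡ P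
  generators {P} sub k gs gs⊆ small with Fin.any? (λ x → (x ∈? P) ×-dec ¬? (x ∈? closure gs))
  generators {P} sub zero gs gs⊆ small | no none = [] , refl , (λ ()) , ⊆-antisym (closure-min sub gs⊆) all-in
    where
    all-in : ∀ {x} → x ∈ P → x ∈ closure gs
    all-in {x} x∈ with x ∈? closure gs
    ... | yes p = p
    ... | no ¬p = contradiction (x , x∈ , ¬p) none
  generators {P} sub zero gs gs⊆ small | yes (x , x∈P , x∉) =
    contradiction (proper-card (closure-sub gs) sub (closure-min sub gs⊆) x∈P x∉)
      (<⇒≱ (<-≤-trans small (≤-reflexive (cong (card (closure gs) +_) (+-identityʳ _)))))
  generators {P} sub (suc k) gs gs⊆ small | found with extend found
    where
    extend : Dec (∃ λ x → x ∈ P × x ∉ closure gs) → ∃ λ x → x ∈ P × card P < 2 ^ suc k * card (closure (x ∷ gs))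
    extend (no none) = e , has-e sub , <-≤-trans (m<m+n (card P) (card-pos sub)) (≤-trans (≤-reflexive (cong (card P +_) (sym (+-identityʳ _))))
      (*-mono-≤ (*-monoʳ-≤ 2 (m^n>0 2 k)) (card-mono all-in)))
      where
      all-in : ∀ {x} → x ∈ P → x ∈ closure (e ∷ gs)
      all-in {x} x∈ with x ∈? closure gs
      ... | yes p = closure-min (closure-sub _) (closure-∋ ∘ there) p
      ... | no ¬p = contradiction (x , x∈ , ¬p) none
    extend (yes (x , x∈P , x∉)) = x , x∈P , (begin-strict
      card P <⟨ small ⟩
      2 ^ suc (suc k) * card (closure gs) ≡⟨ cong (_* card (closure gs)) (*-comm 2 (2 ^ suc k)) ⟩
      2 ^ suc k * 2 * card (closure gs) ≡⟨ *-assoc (2 ^ suc k) 2 _ ⟩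
      2 ^ suc k * (card (closure gs) + (card (closure gs) + 0)) ≡⟨ cong (λ z → 2 ^ suc k * (card (closure gs) + z)) (+-identityʳ _) ⟩
      2 ^ suc k * (card (closure gs) + card (closure gs)) ≤⟨ *-monoʳ-≤ (2 ^ suc k)
        (proper-card (closure-sub gs) (closure-sub (x ∷ gs)) (closure-min (closure-sub _) (closure-∋ ∘ there)) (closure-∋ (here refl)) x∉) ⟩
      2 ^ suc k * card (closure (x ∷ gs)) ∎)
      where open ≤-Reasoning
  ... | x , x∈P , small′ with generators sub k (x ∷ gs) (λ { (here refl) → x∈P ; (there p) → gs⊆ p }) small′
  ... | hs , len , hs⊆ , eq = hs ++ x ∷ [] ,
      trans (length-++ hs) (trans (+-comm (length hs) 1) (cong suc len)) ,
      (λ h∈ → into (∈-++⁻ hs h∈)) ,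
      trans (cong closure (++-assoc hs (x ∷ []) gs)) eq
    where
    into : ∀ {h} → h ∈ˡ hs ⊎ h ∈ˡ (x ∷ []) → h ∈ P
    into (inj₁ p) = hs⊆ p
    into (inj₂ (here refl)) = x∈P

-- Pairwise supplementing subgroups

module Correlation where
  open import Data.Nat as ℕ using ()
  import Data.Nat.Properties as ℕ
  open import Data.Integer as ℤ using (ℤ; +_; -_; _-_; 0ℤ; 1ℤ)
  import Data.Integer.Properties as ℤ
  open import Data.Integer.Tactic.RingSolver using () renaming (solve-∀ to solveℤ-∀)

  ∑ : ∀ {A : Set} → List A → (A → ℤ) → ℤ
  ∑ [] f = 0ℤ
  ∑ (x ∷ xs) f = f x ℤ.+ ∑ xs f

  module _ {A : Set} where

    ∑-cong : ∀ (xs : List A) {f g} → (∀ x → f x ≡ g x) → ∑ xs f ≡ ∑ xs g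
    ∑-cong [] eq = refl
    ∑-cong (x ∷ xs) eq = cong₂ ℤ._+_ (eq x) (∑-cong xs eq)

    ∑-+ : ∀ (xs : List A) f g → ∑ xs (λ x → f x ℤ.+ g x) ≡ ∑ xs f ℤ.+ ∑ xs g
    ∑-+ [] f g = refl
    ∑-+ (x ∷ xs) f g = trans (cong (λ t → f x ℤ.+ g x ℤ.+ t) (∑-+ xs f g)) (interchange (f x) (g x) (∑ xs f) (∑ xs g))
      where
      interchange : ∀ a b c d → a ℤ.+ b ℤ.+ (c ℤ.+ d) ≡ a ℤ.+ c ℤ.+ (b ℤ.+ d)
      interchange = solveℤ-∀

    ∑-* : ∀ (xs : List A) c f → ∑ xs (λ x → c ℤ.* f x) ≡ c ℤ.* ∑ xs f
    ∑-* [] c f = sym (ℤ.*-zeroʳ c)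
    ∑-* (x ∷ xs) c f = trans (cong (λ t → c ℤ.* f x ℤ.+ t) (∑-* xs c f)) (sym (ℤ.*-distribˡ-+ c _ _))

    ∑-const : ∀ (xs : List A) c → ∑ xs (λ _ → c) ≡ c ℤ.* + length xs
    ∑-const [] c = sym (ℤ.*-zeroʳ c)
    ∑-const (x ∷ xs) c = trans (cong (λ t → c ℤ.+ t) (∑-const xs c)) (sym (ℤ.*-suc c (+ length xs)))

    ∑-linear : ∀ (xs : List A) f g h a b c d →
      ∑ xs (λ x → a ℤ.* f x ℤ.+ (b ℤ.* g x ℤ.+ (c ℤ.* h x ℤ.+ d))) ≡
      a ℤ.* ∑ xs f ℤ.+ (b ℤ.* ∑ xs g ℤ.+ (c ℤ.* ∑ xs h ℤ.+ d ℤ.* + length xs))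
    ∑-linear xs f g h a b c d =
      trans (∑-+ xs (λ x → a ℤ.* f x) (λ x → b ℤ.* g x ℤ.+ (c ℤ.* h x ℤ.+ d))) (cong₂ ℤ._+_ (∑-* xs a f)
      (trans (∑-+ xs (λ x → b ℤ.* g x) (λ x → c ℤ.* h x ℤ.+ d)) (cong₂ ℤ._+_ (∑-* xs b g)
      (trans (∑-+ xs (λ x → c ℤ.* h x) (λ _ → d)) (cong₂ ℤ._+_ (∑-* xs c h) (∑-const xs d))))))

    ∑-mono : ∀ (xs : List A) {f g} → (∀ {x} → x ∈ˡ xs → f x ℤ.≤ g x) → ∑ xs f ℤ.≤ ∑ xs g
    ∑-mono [] le = ℤ.≤-refl
    ∑-mono (x ∷ xs) le = ℤ.+-mono-≤ (le (here refl)) (∑-mono xs (le ∘ there))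

    ∑-nonneg : ∀ (xs : List A) {f} → (∀ x → 0ℤ ℤ.≤ f x) → 0ℤ ℤ.≤ ∑ xs f
    ∑-nonneg [] pos = ℤ.≤-refl
    ∑-nonneg (x ∷ xs) pos = ℤ.+-mono-≤ (pos x) (∑-nonneg xs pos)

    term≤∑ : ∀ (xs : List A) {f x} → (∀ x → 0ℤ ℤ.≤ f x) → x ∈ˡ xs → f x ℤ.≤ ∑ xs f
    term≤∑ (x ∷ xs) {f} pos (here refl) = subst (ℤ._≤ ∑ (x ∷ xs) f) (ℤ.+-identityʳ (f x)) (ℤ.+-monoʳ-≤ (f x) (∑-nonneg xs pos))
    term≤∑ (y ∷ xs) {f} {x} pos (there p) = subst (ℤ._≤ ∑ (y ∷ xs) f) (ℤ.+-identityˡ (f x)) (ℤ.+-mono-≤ (pos y) (term≤∑ xs pos p))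

  square-nonneg : ∀ i → 0ℤ ℤ.≤ i ℤ.* i
  square-nonneg (+ n) = subst (0ℤ ℤ.≤_) (ℤ.pos-* n n) (ℤ.+≤+ z≤n)
  square-nonneg ℤ.-[1+ n ] = ℤ.+≤+ z≤n

  -- Chebyshev's inequality at a single point x₀, for functions that are pairwise non-positively correlated.
  module _ {A I : Set} (xs : List A) (h : I → A → ℤ) (C : ℤ) where

    total : List I → A → ℤ
    total is x = ∑ is λ i → h i x

    cross : ∀ j is → ∑ xs (λ x → h j x ℤ.* total is x) ≡ ∑ is (λ i → ∑ xs λ x → h j x ℤ.* h i x)
    cross j [] = trans (∑-cong xs (λ x → ℤ.*-zeroʳ (h j x))) (∑-const xs 0ℤ)
    cross j (i ∷ is) = begin
      ∑ xs (λ x → h j x ℤ.* (h i x ℤ.+ total is x))         ≡⟨ ∑-cong xs (λ x → ℤ.*-distribˡ-+ (h j x) _ _) ⟩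
      ∑ xs (λ x → h j x ℤ.* h i x ℤ.+ h j x ℤ.* total is x) ≡⟨ ∑-+ xs _ _ ⟩
      ∑ xs (λ x → h j x ℤ.* h i x) ℤ.+ ∑ xs (λ x → h j x ℤ.* total is x) ≡⟨ cong (λ t → ∑ xs (λ x → h j x ℤ.* h i x) ℤ.+ t) (cross j is) ⟩
      ∑ xs (λ x → h j x ℤ.* h i x) ℤ.+ ∑ is (λ i → ∑ xs λ x → h j x ℤ.* h i x) ∎
      where open ≡-Reasoning

    -- Expanding the square of the total leaves the diagonal terms and non-positive cross terms. The
    -- weights `w` are abstract here and become the values at x₀.
    second-moment : ∀ (w : I → ℤ) is → AllPairs (λ i j → ∑ xs (λ x → h i x ℤ.* h j x) ℤ.≤ 0ℤ) is →
      All (λ i → + 2 ℤ.* ∑ xs (λ x → h i x ℤ.* h i x) ℤ.≤ C ℤ.* w i) is →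
      + 2 ℤ.* ∑ xs (λ x → total is x ℤ.* total is x) ℤ.≤ C ℤ.* ∑ is w
    second-moment w [] _ _ = ℤ.≤-reflexive (trans (cong (λ t → + 2 ℤ.* t) (∑-const xs 0ℤ)) (sym (ℤ.*-zeroʳ C)))
    second-moment w (i ∷ is) (neg ∷ negs) (diag ∷ diags) = begin
      + 2 ℤ.* ∑ xs (λ x → (h i x ℤ.+ total is x) ℤ.* (h i x ℤ.+ total is x))
        ≡⟨ cong (λ t → + 2 ℤ.* t) (trans (∑-cong xs (λ x → binomial (h i x) (total is x)))
             (trans (∑-+ xs _ _) (cong₂ ℤ._+_ (∑-+ xs _ _) (∑-* xs (+ 2) _)))) ⟩
      + 2 ℤ.* (∑ xs (λ x → h i x ℤ.* h i x) ℤ.+ ∑ xs (λ x → total is x ℤ.* total is x) ℤ.+ + 2 ℤ.* ∑ xs (λ x → h i x ℤ.* total is x))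
        ≡⟨ regroup (∑ xs (λ x → h i x ℤ.* h i x)) (∑ xs (λ x → total is x ℤ.* total is x)) _ ⟩
      + 2 ℤ.* ∑ xs (λ x → h i x ℤ.* h i x) ℤ.+ + 2 ℤ.* ∑ xs (λ x → total is x ℤ.* total is x) ℤ.+ + 4 ℤ.* ∑ xs (λ x → h i x ℤ.* total is x)
        ≤⟨ ℤ.+-mono-≤ (ℤ.+-mono-≤ diag (second-moment w is negs diags)) (ℤ.*-monoˡ-≤-nonNeg (+ 4) cross≤0) ⟩
      C ℤ.* w i ℤ.+ C ℤ.* ∑ is w ℤ.+ + 4 ℤ.* 0ℤ
        ≡⟨ trans (ℤ.+-identityʳ _) (sym (ℤ.*-distribˡ-+ C _ _)) ⟩
      C ℤ.* (w i ℤ.+ ∑ is w) ∎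
      where
      open ℤ.≤-Reasoning
      binomial : ∀ a b → (a ℤ.+ b) ℤ.* (a ℤ.+ b) ≡ a ℤ.* a ℤ.+ b ℤ.* b ℤ.+ + 2 ℤ.* (a ℤ.* b)
      binomial = solveℤ-∀
      regroup : ∀ a b c → + 2 ℤ.* (a ℤ.+ b ℤ.+ + 2 ℤ.* c) ≡ + 2 ℤ.* a ℤ.+ + 2 ℤ.* b ℤ.+ + 4 ℤ.* c
      regroup = solveℤ-∀
      cross≤0 : ∑ xs (λ x → h i x ℤ.* total is x) ℤ.≤ 0ℤ
      cross≤0 = ℤ.≤-trans (ℤ.≤-reflexive (cross i is))
        (ℤ.≤-trans (∑-mono is (All.lookup neg)) (ℤ.≤-reflexive (∑-const is 0ℤ)))

    concentration : ∀ {x₀} is → x₀ ∈ˡ xs → AllPairs (λ i j → ∑ xs (λ x → h i x ℤ.* h j x) ℤ.≤ 0ℤ) is →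
      All (λ i → + 2 ℤ.* ∑ xs (λ x → h i x ℤ.* h i x) ℤ.≤ C ℤ.* h i x₀) is →
      + 2 ℤ.* (total is x₀ ℤ.* total is x₀) ℤ.≤ C ℤ.* total is x₀
    concentration {x₀} is x₀∈ neg diag = ℤ.≤-trans
      (ℤ.*-monoˡ-≤-nonNeg (+ 2) (term≤∑ xs (λ x → square-nonneg (total is x)) x₀∈))
      (second-moment (λ i → h i x₀) is neg diag)

  indicator : ∀ {n} → Subset n → Fin n → ℤ
  indicator P x with x ∈? P
  ... | yes _ = 1ℤ
  ... | no _ = 0ℤ

  ∑-indicator : ∀ {n} (P : Subset n) xs → ∑ xs (indicator P) ≡ + length (filter (_∈? P) xs)
  ∑-indicator P [] = refl
  ∑-indicator P (x ∷ xs) with x ∈? P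
  ... | yes _ = cong (λ t → 1ℤ ℤ.+ t) (∑-indicator P xs)
  ... | no _ = trans (ℤ.+-identityˡ _) (∑-indicator P xs)

  indicator-∩ : ∀ {n} (P Q : Subset n) x → indicator P x ℤ.* indicator Q x ≡ indicator (P ∩ Q) x
  indicator-∩ P Q x with x ∈? P | x ∈? Q | x ∈? (P ∩ Q)
  ... | yes _ | yes _ | yes _ = refl
  ... | yes p | yes q | no ¬r = contradiction (x∈p∩q⁺ (p , q)) ¬r
  ... | yes _ | no ¬q | yes r = contradiction (proj₂ (x∈p∩q⁻ P Q r)) ¬q
  ... | yes _ | no _ | no _ = refl
  ... | no ¬p | _ | yes r = contradiction (proj₁ (x∈p∩q⁻ P Q r)) ¬p
  ... | no _ | yes _ | no _ = refl
  ... | no _ | no _ | no _ = refl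

  module Supplements {n : ℕ} (_·_ : Fin n → Fin n → Fin n) (e : Fin n) (_⁻¹ : Fin n → Fin n)
    (isGroup : IsGroup _≡_ _·_ e _⁻¹) where

    open GroupTheory _·_ e _⁻¹ isGroup

    Supplement : Subset n → Subset n → Subset n → Set
    Supplement X D D′ = ∀ {a} → a ∈ X → ∃ λ p → p ∈ D × p ⁻ ∙ a ∈ D′

    -- Write a = f(a) g(a) with f(a) ∈ D and g(a) ∈ D′. The pair (f(a) c, c⁻¹ g(a)) has product a
    -- and therefore determines a, then c. After division by |X|² this says that D and D′, as events
    -- in X, are not positively correlated.
    intersection-card : ∀ {X D D′} → Subgroup D → Subgroup D′ → Supplement X D D′ →
      card (D ∩ D′) ℕ.* card X ℕ.≤ card D ℕ.* card D′
    intersection-card {X} {D} {D′} D-sub D′-sub supp = subst₂ ℕ._≤_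
      (product-length _,_ (elems (D ∩ D′)) (elems X)) (product-length _,_ (elems D) (elems D′))
      (length-≤-by Image (Unique.cartesianProduct⁺ (elems-unique (D ∩ D′)) (elems-unique X)) image
        (λ {ca} {c′a′} m m′ → injective {ca} {c′a′} m m′))
      where
      Pair = Fin n × Fin n
      factor : Fin n → Fin n
      factor a with a ∈? X
      ... | yes a∈ = proj₁ (supp a∈)
      ... | no _ = e
      factor∈ : ∀ {a} → a ∈ X → factor a ∈ D × factor a ⁻ ∙ a ∈ D′
      factor∈ {a} a∈ with a ∈? X
      ... | yes a∈ = proj₂ (supp a∈)
      ... | no a∉ = contradiction a∈ a∉
      Image : Pair → Pair → Set
      Image (c , a) (u , v) = u ≡ factor a ∙ c × v ≡ c ⁻ ∙ (factor a ⁻ ∙ a)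
      domain = cartesianProduct (elems (D ∩ D′)) (elems X)
      image : ∀ {ca} → ca ∈ˡ domain → ∃ λ uv → uv ∈ˡ cartesianProduct (elems D) (elems D′) × Image ca uv
      image {c , a} m =
        let c∈ , a∈ = ∈-cartesianProduct⁻ (elems (D ∩ D′)) (elems X) m
            c∈D , c∈D′ = x∈p∩q⁻ D D′ (∈-elems⁻ c∈)
            f∈ , g∈ = factor∈ (∈-elems⁻ a∈)
        in (factor a ∙ c , c ⁻ ∙ (factor a ⁻ ∙ a)) ,
          ∈-cartesianProduct⁺ (∈-elems (has-∙ D-sub f∈ c∈D)) (∈-elems (has-∙ D′-sub (has-⁻ D′-sub c∈D′) g∈)) , refl , refl
      injective : ∀ {ca c′a′ uv} → ca ∈ˡ domain → c′a′ ∈ˡ domain → Image ca uv → Image c′a′ uv → ca ≡ c′a′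
      injective {c , a} {c′ , a′} {u , v} _ _ (refl , refl) (eq₁ , eq₂) = cong₂ _,_ c≡ a≡
        where
        a≡ : a ≡ a′
        a≡ = trans (solve (factor a ∷ c ∷ a ∷ []) v₂ (v₀ ⊕ v₁ ⊕ (ι v₁ ⊕ (ι v₀ ⊕ v₂))) refl)
          (trans (cong₂ _∙_ eq₁ eq₂) (solve (factor a′ ∷ c′ ∷ a′ ∷ []) (v₀ ⊕ v₁ ⊕ (ι v₁ ⊕ (ι v₀ ⊕ v₂))) v₂ refl))
        c≡ : c ≡ c′
        c≡ = ∙-cancelˡ (factor a) (trans eq₁ (cong (λ t → factor t ∙ c′) (sym a≡)))

    -- Pairwise supplementing proper subgroups of X are pairwise independent events of probability at most 1/2 in X,
    -- and e lies in all of them.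
    supplements-length : ∀ {X} → Subgroup X → (Ds : List (Subset n)) →
      All (λ D → Subgroup D × (∀ {a} → a ∈ D → a ∈ X) × card D ℕ.+ card D ℕ.≤ card X) Ds →
      AllPairs (Supplement X) Ds → length Ds ℕ.≤ card X
    supplements-length {X} X-sub Ds proper pairs = main
      where
      open ℤ.≤-Reasoning
      xs = elems X
      N = card X
      α : Subset n → ℤ
      α D = + card D
      -- The indicator of D minus its mean on X, scaled by N to stay integral.
      h : Subset n → Fin n → ℤ
      h D x = + N ℤ.* indicator D x - α D
      Proper : Subset n → Set
      Proper D = Subgroup D × (∀ {a} → a ∈ D → a ∈ X) × card D ℕ.+ card D ℕ.≤ card X
      count : ∀ {D} → (∀ {a} → a ∈ D → a ∈ X) → ∑ xs (indicator D) ≡ + card D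
      count {D} D⊆X = trans (∑-indicator D xs) (cong (λ t → + t) (ℕ.≤-antisym
        (length-⊆ (Unique.filter⁺ (_∈? D) (elems-unique X)) (λ p → ∈-elems (proj₂ (∈-filter⁻ (_∈? D) {xs = xs} p))))
        (length-⊆ (elems-unique D) (λ p → ∈-filter⁺ (_∈? D) (∈-elems (D⊆X (∈-elems⁻ p))) (∈-elems⁻ p)))))
      ∑hh : ∀ {D D′} → (∀ {a} → a ∈ D → a ∈ X) → (∀ {a} → a ∈ D′ → a ∈ X) →
        ∑ xs (λ x → h D x ℤ.* h D′ x) ≡ + N ℤ.* (+ N ℤ.* α (D ∩ D′) - α D ℤ.* α D′)
      ∑hh {D} {D′} D⊆ D′⊆ = begin-equality
        ∑ xs (λ x → h D x ℤ.* h D′ x)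
          ≡⟨ ∑-cong xs (λ x → trans (expand (+ N) (indicator D x) (indicator D′ x) (α D) (α D′))
               (cong (λ t → + N ℤ.* + N ℤ.* t ℤ.+ (- (+ N ℤ.* α D′) ℤ.* indicator D x ℤ.+ (- (+ N ℤ.* α D) ℤ.* indicator D′ x ℤ.+ α D ℤ.* α D′)))
                 (indicator-∩ D D′ x))) ⟩
        ∑ xs (λ x → + N ℤ.* + N ℤ.* indicator (D ∩ D′) x ℤ.+ (- (+ N ℤ.* α D′) ℤ.* indicator D x ℤ.+ (- (+ N ℤ.* α D) ℤ.* indicator D′ x ℤ.+ α D ℤ.* α D′)))
          ≡⟨ ∑-linear xs (indicator (D ∩ D′)) (indicator D) (indicator D′) (+ N ℤ.* + N) (- (+ N ℤ.* α D′)) (- (+ N ℤ.* α D)) (α D ℤ.* α D′) ⟩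
        + N ℤ.* + N ℤ.* ∑ xs (indicator (D ∩ D′)) ℤ.+ (- (+ N ℤ.* α D′) ℤ.* ∑ xs (indicator D) ℤ.+ (- (+ N ℤ.* α D) ℤ.* ∑ xs (indicator D′) ℤ.+ α D ℤ.* α D′ ℤ.* + N))
          ≡⟨ cong₂ (λ s t → + N ℤ.* + N ℤ.* s ℤ.+ (- (+ N ℤ.* α D′) ℤ.* t ℤ.+ (- (+ N ℤ.* α D) ℤ.* ∑ xs (indicator D′) ℤ.+ α D ℤ.* α D′ ℤ.* + N)))
               (count {D ∩ D′} (λ p → D⊆ (proj₁ (x∈p∩q⁻ D D′ p)))) (count D⊆) ⟩
        + N ℤ.* + N ℤ.* α (D ∩ D′) ℤ.+ (- (+ N ℤ.* α D′) ℤ.* α D ℤ.+ (- (+ N ℤ.* α D) ℤ.* ∑ xs (indicator D′) ℤ.+ α D ℤ.* α D′ ℤ.* + N))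
          ≡⟨ cong (λ t → + N ℤ.* + N ℤ.* α (D ∩ D′) ℤ.+ (- (+ N ℤ.* α D′) ℤ.* α D ℤ.+ (- (+ N ℤ.* α D) ℤ.* t ℤ.+ α D ℤ.* α D′ ℤ.* + N))) (count D′⊆) ⟩
        + N ℤ.* + N ℤ.* α (D ∩ D′) ℤ.+ (- (+ N ℤ.* α D′) ℤ.* α D ℤ.+ (- (+ N ℤ.* α D) ℤ.* α D′ ℤ.+ α D ℤ.* α D′ ℤ.* + N))
          ≡⟨ collect (+ N) (α (D ∩ D′)) (α D) (α D′) ⟩
        + N ℤ.* (+ N ℤ.* α (D ∩ D′) - α D ℤ.* α D′) ∎
        where
        expand : ∀ N i j a b → (N ℤ.* i - a) ℤ.* (N ℤ.* j - b) ≡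
          N ℤ.* N ℤ.* (i ℤ.* j) ℤ.+ (- (N ℤ.* b) ℤ.* i ℤ.+ (- (N ℤ.* a) ℤ.* j ℤ.+ a ℤ.* b))
        expand = solveℤ-∀
        collect : ∀ N i a b → N ℤ.* N ℤ.* i ℤ.+ (- (N ℤ.* b) ℤ.* a ℤ.+ (- (N ℤ.* a) ℤ.* b ℤ.+ a ℤ.* b ℤ.* N)) ≡ N ℤ.* (N ℤ.* i - a ℤ.* b)
        collect = solveℤ-∀
      h-e : ∀ {D} → Subgroup D → h D e ≡ + N - α D
      h-e {D} sub with e ∈? D
      ... | yes _ = cong (_- α D) (ℤ.*-identityʳ (+ N))
      ... | no e∉ = contradiction (has-e sub) e∉
      negative : ∀ {D D′} → Proper D → Proper D′ → Supplement X D D′ → ∑ xs (λ x → h D x ℤ.* h D′ x) ℤ.≤ 0ℤ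
      negative {D} {D′} (sub , D⊆ , _) (sub′ , D′⊆ , _) supp = begin
        ∑ xs (λ x → h D x ℤ.* h D′ x) ≡⟨ ∑hh D⊆ D′⊆ ⟩
        + N ℤ.* (+ N ℤ.* α (D ∩ D′) - α D ℤ.* α D′) ≤⟨ ℤ.*-monoˡ-≤-nonNeg (+ N) (ℤ.i≤j⇒i-j≤0 (subst₂ ℤ._≤_
            (trans (ℤ.pos-* (card (D ∩ D′)) N) (ℤ.*-comm (α (D ∩ D′)) (+ N))) (ℤ.pos-* (card D) (card D′))
            (ℤ.+≤+ (intersection-card sub sub′ supp)))) ⟩
        + N ℤ.* 0ℤ ≡⟨ ℤ.*-zeroʳ (+ N) ⟩
        0ℤ ∎
      2α≤N : ∀ {D} → Proper D → + 2 ℤ.* α D ℤ.≤ + N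
      2α≤N {D} (_ , _ , le) = subst (ℤ._≤ + N) (trans (cong (λ t → + t) (cong (card D ℕ.+_) (sym (ℕ.+-identityʳ (card D))))) (ℤ.pos-* 2 (card D))) (ℤ.+≤+ le)
      α≤N : ∀ {D} → Proper D → 0ℤ ℤ.≤ + N - α D
      α≤N (_ , D⊆ , _) = ℤ.i≤j⇒0≤j-i (ℤ.+≤+ (card-mono D⊆))
      diagonal : ∀ {D} → Proper D → + 2 ℤ.* ∑ xs (λ x → h D x ℤ.* h D x) ℤ.≤ + N ℤ.* + N ℤ.* h D e
      diagonal {D} pD@(sub , D⊆ , le) = begin
        + 2 ℤ.* ∑ xs (λ x → h D x ℤ.* h D x) ≡⟨ cong (λ t → + 2 ℤ.* t) (trans (∑hh D⊆ D⊆) (cong (λ P → + N ℤ.* (+ N ℤ.* α P - α D ℤ.* α D)) (∩-idem D))) ⟩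
        + 2 ℤ.* (+ N ℤ.* (+ N ℤ.* α D - α D ℤ.* α D)) ≡⟨ factorise (+ N) (α D) ⟩
        + 2 ℤ.* α D ℤ.* (+ N ℤ.* (+ N - α D)) ≤⟨ ℤ.*-monoʳ-≤-nonNeg (+ N ℤ.* (+ N - α D)) {{ℤ.nonNegative (nonneg-* (+ N) (ℤ.+≤+ z≤n) (α≤N pD))}} (2α≤N pD) ⟩
        + N ℤ.* (+ N ℤ.* (+ N - α D)) ≡⟨ ℤ.*-assoc (+ N) (+ N) _ ⟨
        + N ℤ.* + N ℤ.* (+ N - α D) ≡⟨ cong (λ t → + N ℤ.* + N ℤ.* t) (h-e sub) ⟨
        + N ℤ.* + N ℤ.* h D e ∎
        where
        factorise : ∀ N a → + 2 ℤ.* (N ℤ.* (N ℤ.* a - a ℤ.* a)) ≡ + 2 ℤ.* a ℤ.* (N ℤ.* (N - a))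
        factorise = solveℤ-∀
        nonneg-* : ∀ i {j} → 0ℤ ℤ.≤ i → 0ℤ ℤ.≤ j → 0ℤ ℤ.≤ i ℤ.* j
        nonneg-* i i≥0 j≥0 = subst (ℤ._≤ i ℤ.* _) (ℤ.*-zeroʳ i) (ℤ.*-monoˡ-≤-nonNeg i {{ℤ.nonNegative i≥0}} j≥0)
      -- G is the sum of N - |D|: each subgroup contributes at least N/2 (`many`), while 2 G² ≤ N² G
      -- allows at most N²/2 altogether. Hence there are at most N subgroups.
      G = total xs h (+ N ℤ.* + N) Ds e
      G-bound : + 2 ℤ.* (G ℤ.* G) ℤ.≤ + N ℤ.* + N ℤ.* G
      G-bound = concentration xs h (+ N ℤ.* + N) Ds (∈-elems (has-e X-sub)) (negatives Ds proper pairs) (All.map diagonal proper)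
        where
        negatives : ∀ Ds → All Proper Ds → AllPairs (Supplement X) Ds →
          AllPairs (λ D D′ → ∑ xs (λ x → h D x ℤ.* h D′ x) ℤ.≤ 0ℤ) Ds
        negatives [] _ _ = []
        negatives (D ∷ Ds) (p ∷ ps) (s ∷ ss) = All.tabulate (λ D′∈ → negative p (All.lookup ps D′∈) (All.lookup s D′∈)) ∷ negatives Ds ps ss
      many : ∀ Ds → All Proper Ds → + N ℤ.* + length Ds ℤ.≤ + 2 ℤ.* ∑ Ds (λ D → h D e)
      many [] [] = ℤ.≤-reflexive (ℤ.*-zeroʳ (+ N))
      many (D ∷ Ds) (p ∷ ps) = begin
        + N ℤ.* + suc (length Ds) ≡⟨ ℤ.*-suc (+ N) (+ length Ds) ⟩
        + N ℤ.+ + N ℤ.* + length Ds ≤⟨ ℤ.+-mono-≤ here-bound (many Ds ps) ⟩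
        + 2 ℤ.* h D e ℤ.+ + 2 ℤ.* ∑ Ds (λ D → h D e) ≡⟨ ℤ.*-distribˡ-+ (+ 2) (h D e) _ ⟨
        + 2 ℤ.* (h D e ℤ.+ ∑ Ds (λ D → h D e)) ∎
        where
        here-bound : + N ℤ.≤ + 2 ℤ.* h D e
        here-bound = begin
          + N ≡⟨ e₁ (+ N) ⟩
          + 2 ℤ.* + N - + N ≤⟨ ℤ.+-monoʳ-≤ (+ 2 ℤ.* + N) (ℤ.neg-mono-≤ (2α≤N p)) ⟩
          + 2 ℤ.* + N - + 2 ℤ.* α D ≡⟨ e₂ (+ N) (α D) ⟩
          + 2 ℤ.* (+ N - α D) ≡⟨ cong (λ t → + 2 ℤ.* t) (h-e (proj₁ p)) ⟨
          + 2 ℤ.* h D e ∎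
          where
          e₁ : ∀ N → N ≡ + 2 ℤ.* N - N
          e₁ = solveℤ-∀
          e₂ : ∀ N a → + 2 ℤ.* N - + 2 ℤ.* a ≡ + 2 ℤ.* (N - a)
          e₂ = solveℤ-∀
      main : length Ds ℕ.≤ N
      main with length Ds ℕ.≤? N
      ... | yes le = le
      ... | no ¬le = contradiction G-bound (ℤ.<⇒≱ (begin-strict
          + N ℤ.* + N ℤ.* G <⟨ ℤ.*-monoʳ-<-pos G {{ℤ.positive G>0}} N²<2G ⟩
          + 2 ℤ.* G ℤ.* G ≡⟨ ℤ.*-assoc (+ 2) G G ⟩
          + 2 ℤ.* (G ℤ.* G) ∎))
        where
        N>0 : 0ℤ ℤ.< + N
        N>0 = ℤ.+<+ (card-pos X-sub)
        N²<2G : + N ℤ.* + N ℤ.< + 2 ℤ.* G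
        N²<2G = ℤ.<-≤-trans (ℤ.*-monoˡ-<-pos (+ N) {{ℤ.positive N>0}} (ℤ.+<+ (ℕ.≰⇒> ¬le))) (many Ds proper)
        G>0 : 0ℤ ℤ.< G
        G>0 with G in eq
        ... | + zero = contradiction (subst (λ g → + N ℤ.* + N ℤ.< + 2 ℤ.* g) eq N²<2G) (ℤ.≤⇒≯ (square-nonneg (+ N)))
        ... | + suc _ = ℤ.+<+ (s≤s z≤n)
        ... | ℤ.-[1+ _ ] = contradiction (subst (λ g → + N ℤ.* + N ℤ.< + 2 ℤ.* g) eq N²<2G) (ℤ.≤⇒≯ (ℤ.≤-trans ℤ.-≤+ (square-nonneg (+ N))))

-- Automorphisms of Cay(R, S) for S ⊆ R ∖ M

module Index2 {n : ℕ} (_·_ : Fin n → Fin n → Fin n) (e : Fin n) (_⁻¹ : Fin n → Fin n)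
  (isGroup : IsGroup _≡_ _·_ e _⁻¹) (M : Subset n)
  (M-sub : GroupTheory.Subgroup _·_ e _⁻¹ isGroup M)
  (M-comm : ∀ {x y} → x ∈ M → y ∈ M → x · y ≡ y · x)
  (2m≡n : card M * 2 ≡ n) where

  open GroupTheory _·_ e _⁻¹ isGroup
  open Correlation.Supplements _·_ e _⁻¹ isGroup

  infix 4 _~_
  _~_ : Fin n → Fin n → Set
  g ~ h = g ⁻ ∙ h ∈ M

  ~-sym : ∀ {g h} → g ~ h → h ~ g
  ~-sym {g} {h} p = subst (_∈ M) (solve (g ∷ h ∷ []) (ι (ι v₀ ⊕ v₁)) (ι v₁ ⊕ v₀) refl) (has-⁻ M-sub p)

  ~-trans : ∀ {f g h} → f ~ g → g ~ h → f ~ h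
  ~-trans {f} {g} {h} p q = subst (_∈ M)
    (solve (f ∷ g ∷ h ∷ []) (ι v₀ ⊕ v₁ ⊕ (ι v₁ ⊕ v₂)) (ι v₀ ⊕ v₂) refl) (has-∙ M-sub p q)

  ~-∙ : ∀ g {x} → x ∈ M → g ~ g ∙ x
  ~-∙ g {x} = subst (_∈ M) (solve (g ∷ x ∷ []) v₁ (ι v₀ ⊕ (v₀ ⊕ v₁)) refl)

  ≁-trans : ∀ {f g h} → ¬ f ~ g → ¬ f ~ h → g ~ h
  ≁-trans {f} {g} {h} p q = subst (_∈ M)
    (solve (f ∷ g ∷ h ∷ []) (ι (ι v₀ ⊕ v₁) ⊕ (ι v₀ ⊕ v₂)) (ι v₁ ⊕ v₂) refl) (index-2 M-sub 2m≡n p q)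

  ∙-∉ : ∀ {v x} → v ∉ M → x ∈ M → v ∙ x ∉ M
  ∙-∉ {v} {x} v∉ x∈ p = v∉ (subst (_∈ M) (solve (v ∷ x ∷ []) (v₀ ⊕ v₁ ⊕ ι v₁) v₀ refl) (has-∙ M-sub p (has-⁻ M-sub x∈)))

  ∉-∙ : ∀ {x v} → x ∈ M → v ∉ M → x ∙ v ∉ M
  ∉-∙ {x} {v} x∈ v∉ p = v∉ (subst (_∈ M) (solve (x ∷ v ∷ []) (ι v₀ ⊕ (v₀ ⊕ v₁)) v₁ refl) (has-∙ M-sub (has-⁻ M-sub x∈) p))

  conj-∈ : ∀ r {x} → x ∈ M → r ⁻ ∙ x ∙ r ∈ M
  conj-∈ r {x} x∈ with r ∈? M
  ... | yes r∈ = has-∙ M-sub (has-∙ M-sub (has-⁻ M-sub r∈) x∈) r∈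
  ... | no r∉ = subst (_∈ M) (sym (assoc _ _ _)) (index-2 M-sub 2m≡n r∉ (∉-∙ x∈ r∉))

  ~-∙ʳ : ∀ r {g h} → g ~ h → g ∙ r ~ h ∙ r
  ~-∙ʳ r {g} {h} p = subst (_∈ M)
    (solve (g ∷ h ∷ r ∷ []) (ι v₂ ⊕ (ι v₀ ⊕ v₁) ⊕ v₂) (ι (v₀ ⊕ v₂) ⊕ (v₁ ⊕ v₂)) refl) (conj-∈ r p)

  ∙-swap : ∀ {r x} → r ∈ M → x ∈ M → ∀ g → g ∙ x ∙ r ≡ g ∙ r ∙ x
  ∙-swap {r} {x} r∈ x∈ g = trans (assoc _ _ _) (trans (cong (g ∙_) (M-comm x∈ r∈)) (sym (assoc _ _ _)))

  -- Automorphisms of Cay(R, S) respecting the bipartition {M, R ∖ M}.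
  record Aut (S : Subset n) : Set where
    field
      fun inv : Fin n → Fin n
      inv-fun : ∀ g → inv (fun g) ≡ g
      fun-inv : ∀ g → fun (inv g) ≡ g
      arc : ∀ g h → lookup S (fun g ∙ fun h ⁻) ≡ lookup S (g ∙ h ⁻)
      half : ∀ {g h} → g ~ h → fun g ~ fun h
      half⁻ : ∀ {g h} → g ~ h → inv g ~ inv h

    fun-injective : ∀ {g h} → fun g ≡ fun h → g ≡ h
    fun-injective {g} {h} eq = trans (sym (inv-fun g)) (trans (cong inv eq) (inv-fun h))

  open Aut public

  module _ {S : Subset n} where

    infixr 9 _∘ᴬ_
    _∘ᴬ_ : Aut S → Aut S → Aut S
    a ∘ᴬ b = record
      { fun = fun a ∘ fun b
      ; inv = inv b ∘ inv a
      ; inv-fun = λ g → trans (cong (inv b) (inv-fun a _)) (inv-fun b g)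
      ; fun-inv = λ g → trans (cong (fun a) (fun-inv b _)) (fun-inv a g)
      ; arc = λ g h → trans (arc a _ _) (arc b g h)
      ; half = half a ∘ half b
      ; half⁻ = half⁻ b ∘ half⁻ a
      }

    infix 10 _⁻ᴬ
    _⁻ᴬ : Aut S → Aut S
    a ⁻ᴬ = record
      { fun = inv a
      ; inv = fun a
      ; inv-fun = fun-inv a
      ; fun-inv = inv-fun a
      ; arc = λ g h → trans (sym (arc a (inv a g) (inv a h)))
          (cong₂ (λ x y → lookup S (x ∙ y ⁻)) (fun-inv a g) (fun-inv a h))
      ; half = half⁻ a
      ; half⁻ = half a
      }

    ρ : Fin n → Aut S
    ρ r = record
      { fun = _∙ r
      ; inv = _∙ r ⁻
      ; inv-fun = λ g → solve (g ∷ r ∷ []) (v₀ ⊕ v₁ ⊕ ι v₁) v₀ refl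
      ; fun-inv = λ g → solve (g ∷ r ∷ []) (v₀ ⊕ ι v₁ ⊕ v₁) v₀ refl
      ; arc = λ g h → cong (lookup S) (solve (g ∷ h ∷ r ∷ []) (v₀ ⊕ v₂ ⊕ ι (v₁ ⊕ v₂)) (v₀ ⊕ ι v₁) refl)
      ; half = ~-∙ʳ r
      ; half⁻ = ~-∙ʳ (r ⁻)
      }

    Commutes : Aut S → Fin n → Set
    Commutes a x = ∀ g → fun a (g ∙ x) ≡ fun a g ∙ x

    ∘-commutes : ∀ a b {x} → Commutes a x → Commutes b x → Commutes (a ∘ᴬ b) x
    ∘-commutes a b ca cb g = trans (cong (fun a) (cb g)) (ca _)

    ⁻-commutes : ∀ a {x} → Commutes a x → Commutes (a ⁻ᴬ) x
    ⁻-commutes a {x} ca g = fun-injective a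
      (trans (fun-inv a _) (trans (cong (_∙ x) (sym (fun-inv a g))) (sym (ca (inv a g)))))

    commutes? : ∀ a x → Dec (Commutes a x)
    commutes? a x = Fin.all? λ g → fun a (g ∙ x) Fin.≟ fun a g ∙ x

    inCentraliser? : ∀ a x → Dec (x ∈ M × Commutes a x)
    inCentraliser? a x = (x ∈? M) ×-dec commutes? a x

    Centraliser : Aut S → Subset n
    Centraliser a = ⟪ inCentraliser? a ⟫

  -- The condition on x and x′ says that k conjugates ρ x to ρ x′, so that k normalises the group of
  -- right translations by M.
  NormalRigid : Subset n → Set
  NormalRigid S = ∀ (k : Aut S) y → fun k y ≡ y →
    (∀ x → x ∈ M → ∃ λ x′ → x′ ∈ M × ∀ g → fun k (g ∙ x) ≡ fun k g ∙ x′) → ∀ g → fun k g ≡ g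

  -- k is a non-trivial automorphism with a fixed point whose centraliser Z in M is maximal. Conjugates of M by
  -- automorphisms commuting with Z then meet M in Z only, as in a Frobenius group.
  module MaximalCentraliser {S : Subset n} (rigid : NormalRigid S) (k : Aut S) (y₀ : Fin n) (k-fixes : fun k y₀ ≡ y₀)
    (k-moves : ¬ (∀ g → fun k g ≡ g))
    (maximal : ∀ (l : Aut S) y → fun l y ≡ y → (∀ {z} → z ∈ Centraliser k → z ∈ Centraliser l) →
      ∀ {x} → x ∈ Centraliser l → x ∉ Centraliser k → ∀ g → fun l g ≡ g) where

    Z : Subset n
    Z = Centraliser k

    Z⊆M : ∀ {z} → z ∈ Z → z ∈ M
    Z⊆M = proj₁ ∘ ∊⁻ (inCentraliser? k)

    Z-sub : Subgroup Z
    Z-sub = record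
      { has-e = ∊⁺ (inCentraliser? k) (has-e M-sub , λ g → trans (cong (fun k) (identityʳ g)) (sym (identityʳ _)))
      ; has-∙ = λ {x} {y} p q → let x∈ , cx = ∊⁻ (inCentraliser? k) p ; y∈ , cy = ∊⁻ (inCentraliser? k) q in
          ∊⁺ (inCentraliser? k) (has-∙ M-sub x∈ y∈ , λ g → trans (cong (fun k) (sym (assoc g x y)))
            (trans (cy _) (trans (cong (_∙ y) (cx g)) (assoc _ _ _))))
      ; has-⁻ = λ {x} p → let x∈ , cx = ∊⁻ (inCentraliser? k) p in
          ∊⁺ (inCentraliser? k) (has-⁻ M-sub x∈ , λ g → ∙-cancelʳ x
            (trans (sym (cx _)) (trans (cong (fun k) (solve (g ∷ x ∷ []) (v₀ ⊕ ι v₁ ⊕ v₁) v₀ refl))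
              (solve (fun k g ∷ x ∷ []) v₀ (v₀ ⊕ ι v₁ ⊕ v₁) refl))))
      }

    InH : Aut S → Set
    InH a = ∀ {z} → z ∈ Z → Commutes a z

    ∘-InH : ∀ a b → InH a → InH b → InH (a ∘ᴬ b)
    ∘-InH a b ha hb z∈ = ∘-commutes a b (ha z∈) (hb z∈)

    ⁻-InH : ∀ a → InH a → InH (a ⁻ᴬ)
    ⁻-InH a ha z∈ = ⁻-commutes a (ha z∈)

    ρ-InH : ∀ {r} → r ∈ M → InH (ρ r)
    ρ-InH r∈ z∈ = ∙-swap r∈ (Z⊆M z∈)

    -- For w ∈ M choose w′ so that l = ρ(w′)⁻¹ a ρ(w) a⁻¹ fixes y. As M is abelian, l commutes with
    -- x′, because a ρ(w) a⁻¹ commutes with a ρ(x) a⁻¹ = ρ(x′). Since x′ lies outside Z, maximality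
    -- gives l = 1. So a normalises M, and rigidity applies.
    trivial-intersection : ∀ (a : Aut S) → InH a → ∀ y → fun a y ≡ y → ∀ {x x′} → x ∈ M → x ∉ Z → x′ ∈ M →
      (∀ g → fun a (g ∙ x) ≡ fun a g ∙ x′) → ∀ g → fun a g ≡ g
    trivial-intersection a ha y ay {x} {x′} x∈ x∉ x′∈ ax = rigid a y ay normalises
      where
      x′∉ : x′ ∉ Z
      x′∉ p = x∉ (subst (_∈ Z) (∙-cancelˡ y (fun-injective a (trans (ha p y) (sym (ax y))))) p)
      normalises : ∀ w → w ∈ M → ∃ λ w′ → w′ ∈ M × ∀ g → fun a (g ∙ w) ≡ fun a g ∙ w′
      normalises w w∈ = w′ , w′∈ , λ g → trans (solve (fun a (g ∙ w) ∷ w′ ∷ []) v₀ (v₀ ⊕ ι v₁ ⊕ v₁) refl)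
          (cong (_∙ w′) (trans (cong (λ h → fun a (h ∙ w) ∙ w′ ⁻) (sym (inv-fun a g))) (l-id (fun a g))))
        where
        w′ = y ⁻ ∙ fun a (y ∙ w)
        w′∈ : w′ ∈ M
        w′∈ = subst (_~ fun a (y ∙ w)) ay (half a (~-∙ y w∈))
        l : Aut S
        l = ρ (w′ ⁻) ∘ᴬ a ∘ᴬ ρ w ∘ᴬ a ⁻ᴬ
        l-fixes : fun l y ≡ y
        l-fixes = trans (cong (λ h → fun a (h ∙ w) ∙ w′ ⁻) (trans (cong (inv a) (sym ay)) (inv-fun a y)))
          (solve (y ∷ fun a (y ∙ w) ∷ []) (v₁ ⊕ ι (ι v₀ ⊕ v₁)) v₀ refl)
        l-InH : InH l
        l-InH = ∘-InH (ρ (w′ ⁻)) (a ∘ᴬ ρ w ∘ᴬ a ⁻ᴬ) (ρ-InH (has-⁻ M-sub w′∈))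
          (∘-InH a (ρ w ∘ᴬ a ⁻ᴬ) ha (∘-InH (ρ w) (a ⁻ᴬ) (ρ-InH w∈) (⁻-InH a ha)))
        l-x′ : Commutes l x′
        l-x′ g = trans (cong (λ h → fun a (h ∙ w) ∙ w′ ⁻) a⁻x′)
          (trans (cong (λ h → fun a h ∙ w′ ⁻) (∙-swap w∈ x∈ (inv a g)))
          (trans (cong (_∙ w′ ⁻) (ax _)) (∙-swap (has-⁻ M-sub w′∈) x′∈ _)))
          where
          a⁻x′ : inv a (g ∙ x′) ≡ inv a g ∙ x
          a⁻x′ = fun-injective a (trans (fun-inv a _) (trans (cong (_∙ x′) (sym (fun-inv a g))) (sym (ax _))))
        l-id : ∀ g → fun l g ≡ g
        l-id = maximal l y l-fixes (λ z∈ → ∊⁺ (inCentraliser? l) (Z⊆M z∈ , l-InH z∈))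
          (∊⁺ (inCentraliser? l) (x′∈ , l-x′)) x′∉

    -- If b moves y by x ∈ M ∖ Z, write b = ρ x ∘ h with h y = y; Φ b = h ∘ ρ x ∘ h⁻¹ is injective on such b, so by
    -- finiteness every such b is itself conjugate to an element of M ∖ Z and has no fixed point.
    module Displacement (y : Fin n) where

      disp : Aut S → Fin n
      disp b = y ⁻ ∙ fun b y

      hᴬ Φ : Aut S → Aut S
      hᴬ b = ρ (disp b ⁻) ∘ᴬ b
      Φ b = hᴬ b ∘ᴬ ρ (disp b) ∘ᴬ hᴬ b ⁻ᴬ

      record Good (b : Aut S) : Set where
        field
          inH : InH b
          disp∈ : disp b ∈ M
          disp∉ : disp b ∉ Z
      open Good

      h-fixes : ∀ b → fun (hᴬ b) y ≡ y
      h-fixes b = solve (y ∷ fun b y ∷ []) (v₁ ⊕ ι (ι v₀ ⊕ v₁)) v₀ refl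

      h-InH : ∀ {b} → Good b → InH (hᴬ b)
      h-InH {b} gb = ∘-InH (ρ (disp b ⁻)) b (ρ-InH (has-⁻ M-sub (disp∈ gb))) (inH gb)

      h⁻-fixes : ∀ b → inv (hᴬ b) y ≡ y
      h⁻-fixes b = fun-injective (hᴬ b) (trans (fun-inv (hᴬ b) y) (sym (h-fixes b)))

      Φ-y : ∀ b → fun (Φ b) y ≡ fun (hᴬ b) (y ∙ disp b)
      Φ-y b = cong (λ g → fun (hᴬ b) (g ∙ disp b)) (h⁻-fixes b)

      Φ-good : ∀ {b} → Good b → Good (Φ b)
      Φ-good {b} gb = record
        { inH = ∘-InH (hᴬ b) (ρ (disp b) ∘ᴬ hᴬ b ⁻ᴬ) (h-InH gb)
            (∘-InH (ρ (disp b)) (hᴬ b ⁻ᴬ) (ρ-InH (disp∈ gb)) (⁻-InH (hᴬ b) (h-InH gb)))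
        ; disp∈ = subst (y ~_) (sym (Φ-y b)) (subst (_~ fun (hᴬ b) (y ∙ disp b)) (h-fixes b) (half (hᴬ b) (~-∙ y (disp∈ gb))))
        ; disp∉ = λ p → disp∉ gb (subst (_∈ Z) (∙-cancelˡ y (fun-injective (hᴬ b)
            (trans (h-InH gb p y) (trans (cong (_∙ disp (Φ b)) (h-fixes b))
              (trans (solve (y ∷ fun (Φ b) y ∷ []) (v₀ ⊕ (ι v₀ ⊕ v₁)) v₁ refl) (Φ-y b)))))) p)
        }

      -- If the images coincide, c = h_b⁻¹ h_a fixes y and conjugates `disp a` to `disp b`, both in
      -- M outside Z; then c is trivial by `trivial-intersection`.
      Φ-injective : ∀ {a b} → Good a → Good b → (∀ g → fun (Φ a) g ≡ fun (Φ b) g) → ∀ g → fun a g ≡ fun b g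
      Φ-injective {a} {b} ga gb eq g = begin
        fun a g                         ≡⟨ solve (fun a g ∷ disp a ∷ []) v₀ (v₀ ⊕ ι v₁ ⊕ v₁) refl ⟩
        fun (hᴬ a) g ∙ disp a           ≡⟨ cong₂ _∙_ h≡ disp≡ ⟩
        fun (hᴬ b) g ∙ disp b           ≡⟨ solve (fun b g ∷ disp b ∷ []) (v₀ ⊕ ι v₁ ⊕ v₁) v₀ refl ⟩
        fun b g                         ∎
        where
        open ≡-Reasoning
        c : Aut S
        c = hᴬ b ⁻ᴬ ∘ᴬ hᴬ a
        c-conj : ∀ g → fun c (g ∙ disp a) ≡ fun c g ∙ disp b
        c-conj g = trans (cong (λ g′ → inv (hᴬ b) (fun (hᴬ a) (g′ ∙ disp a))) (sym (inv-fun (hᴬ a) g)))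
          (trans (cong (inv (hᴬ b)) (eq (fun (hᴬ a) g))) (inv-fun (hᴬ b) _))
        c-id : ∀ g → fun c g ≡ g
        c-id = trivial-intersection c (∘-InH (hᴬ b ⁻ᴬ) (hᴬ a) (⁻-InH (hᴬ b) (h-InH gb)) (h-InH ga)) y
          (trans (cong (inv (hᴬ b)) (h-fixes a)) (h⁻-fixes b)) (disp∈ ga) (disp∉ ga) (disp∈ gb) c-conj
        h≡ : fun (hᴬ a) g ≡ fun (hᴬ b) g
        h≡ = trans (sym (fun-inv (hᴬ b) _)) (cong (fun (hᴬ b)) (c-id g))
        disp≡ : disp a ≡ disp b
        disp≡ = ∙-cancelˡ g (trans (sym (c-id _)) (trans (c-conj g) (cong (_∙ disp b) (c-id g))))

      module _ (a : Aut S) (ga : Good a) where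

        orbit : ℕ → Aut S
        orbit zero = a
        orbit (suc i) = Φ (orbit i)

        orbit-good : ∀ i → Good (orbit i)
        orbit-good zero = ga
        orbit-good (suc i) = Φ-good (orbit-good i)

        orbit-cancel : ∀ i j → (∀ g → fun (orbit i) g ≡ fun (orbit (i + j)) g) → ∀ g → fun a g ≡ fun (orbit j) g
        orbit-cancel zero j eq = eq
        orbit-cancel (suc i) j eq = orbit-cancel i j (Φ-injective (orbit-good i) (orbit-good (i + j)) eq)

        -- Among n^n + 1 iterates two agree as maps, and injectivity of `Φ` cancels the initial
        -- segment: `a` lies on a cycle of `Φ`.
        recurrence : ∃ λ j → ∀ g → fun a g ≡ fun (orbit (suc j)) g
        recurrence with Fin.pigeonhole (n<1+n (n ^ n)) (λ i → Fin.funToFin (fun (orbit (Fin.toℕ i))))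
        ... | i , j , i<j , eq with m≤n⇒∃[o]m+o≡n i<j
        ... | d , i+d≡j = d , orbit-cancel (Fin.toℕ i) (suc d) (λ g →
                trans (sym (Fin.finToFun-funToFin (fun (orbit (Fin.toℕ i))) g))
                (trans (cong (λ c → Fin.finToFun c g) eq)
                (trans (Fin.finToFun-funToFin (fun (orbit (Fin.toℕ j))) g)
                (cong (λ t → fun (orbit t) g) (trans (sym i+d≡j) (sym (+-suc (Fin.toℕ i) d)))))))

        no-fixed-point : ∀ y₁ → fun a y₁ ≢ y₁
        no-fixed-point y₁ fixed with recurrence
        -- Now a = h ρ(x) h⁻¹ with x outside Z. If a fixed y₁, then ρ(x) would fix h⁻¹ y₁, which
        -- forces x = e ∈ Z.
        ... | j , eq = disp∉ gb (subst (_∈ Z) (∙-cancelˡ (inv (hᴬ b) y₁) (trans (identityʳ _)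
                (fun-injective (hᴬ b) (trans (fun-inv (hᴬ b) y₁) (trans (sym fixed) (eq y₁)))))) (has-e Z-sub))
          where
          b = orbit j
          gb = orbit-good j

    -- Automorphisms that move every point by an element of Z

    shift : Aut S → Fin n → Fin n
    shift a g = g ⁻ ∙ fun a g

    fun-shift : ∀ a g → fun a g ≡ g ∙ shift a g
    fun-shift a g = solve (g ∷ fun a g ∷ []) v₁ (v₀ ⊕ (ι v₀ ⊕ v₁)) refl

    -- A map with a fixed point preserves both halves, so it moves y by an element of M; were this
    -- outside Z, `no-fixed-point` would apply.
    shift-∈Z : ∀ a → InH a → ∀ {y₁} → fun a y₁ ≡ y₁ → ∀ y → shift a y ∈ Z
    shift-∈Z a ha {y₁} fixed y with shift a y ∈? Z
    ... | yes p = p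
    ... | no ¬p = contradiction fixed (Displacement.no-fixed-point y a
            (record { inH = ha ; disp∈ = same-half ; disp∉ = ¬p }) y₁)
      where
      same-half : y ~ fun a y
      same-half with y₁ ⁻ ∙ y ∈? M
      ... | yes p = ~-trans (~-sym p) (subst (_~ fun a y) fixed (half a p))
      ... | no ¬q = ≁-trans ¬q λ q → ¬q (subst₂ _~_ (trans (cong (inv a) (sym fixed)) (inv-fun a y₁)) (inv-fun a y) (half⁻ a q))

    -- The Frobenius kernel with the translations removed. It is described by displacements instead
    -- of by a fixed point so as to be closed under the commutators `Δ x` with x ∈ M outside Z.
    record InN (a : Aut S) : Set where
      field
        inH : InH a
        shift∈ : ∀ g → shift a g ∈ Z
        nontrivial : ¬ (∀ x → x ∈ M → Commutes a x)
    open InN public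

    k-InH : InH k
    k-InH = proj₂ ∘ ∊⁻ (inCentraliser? k)

    k-InN : InN k
    k-InN = record
      { inH = k-InH
      ; shift∈ = shift-∈Z k k-InH k-fixes
      ; nontrivial = λ c → k-moves (rigid k y₀ k-fixes λ x x∈ → x , x∈ , c x x∈)
      }

    Z-comm : ∀ {x z} → x ∈ M → z ∈ Z → x ∙ z ≡ z ∙ x
    Z-comm x∈ z∈ = M-comm x∈ (Z⊆M z∈)

    shift-periodic : ∀ {a} → InN a → ∀ g {z} → z ∈ Z → shift a (g ∙ z) ≡ shift a g
    shift-periodic {a} na g {z} z∈ = begin
      (g ∙ z) ⁻ ∙ fun a (g ∙ z)       ≡⟨ cong ((g ∙ z) ⁻ ∙_) (inH na z∈ g) ⟩
      (g ∙ z) ⁻ ∙ (fun a g ∙ z)       ≡⟨ solve (g ∷ z ∷ fun a g ∷ []) (ι (v₀ ⊕ v₁) ⊕ (v₂ ⊕ v₁)) (ι v₁ ⊕ (ι v₀ ⊕ v₂ ⊕ v₁)) refl ⟩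
      z ⁻ ∙ (shift a g ∙ z)           ≡⟨ cong (z ⁻ ∙_) (Z-comm (Z⊆M (shift∈ na g)) z∈) ⟩
      z ⁻ ∙ (z ∙ shift a g)           ≡⟨ solve (z ∷ shift a g ∷ []) (ι v₀ ⊕ (v₀ ⊕ v₁)) v₁ refl ⟩
      shift a g                       ∎
      where open ≡-Reasoning

    -- A commutator of a with ρ x. It acts on displacements as a difference operator, see `shift-Δ`.
    Δ : Fin n → Aut S → Aut S
    Δ x a = ρ (x ⁻) ∘ᴬ a ∘ᴬ ρ x ∘ᴬ a ⁻ᴬ

    Δ-InH : ∀ {x a} → x ∈ M → InN a → InH (Δ x a)
    Δ-InH {x} {a} x∈ na = ∘-InH (ρ (x ⁻)) (a ∘ᴬ ρ x ∘ᴬ a ⁻ᴬ) (ρ-InH (has-⁻ M-sub x∈))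
      (∘-InH a (ρ x ∘ᴬ a ⁻ᴬ) (inH na) (∘-InH (ρ x) (a ⁻ᴬ) (ρ-InH x∈) (⁻-InH a (inH na))))

    shift-Δ : ∀ {x a} → x ∈ M → InN a → ∀ g → shift (Δ x a) g ≡ shift a (g ∙ x) ∙ shift a g ⁻
    shift-Δ {x} {a} x∈ na g = begin
      g ⁻ ∙ (fun a (inv a g ∙ x) ∙ x ⁻)           ≡⟨ cong (λ h → g ⁻ ∙ (fun a h ∙ x ⁻)) move ⟩
      g ⁻ ∙ (fun a (g ∙ x ∙ c ⁻) ∙ x ⁻)           ≡⟨ cong (λ h → g ⁻ ∙ (h ∙ x ⁻)) (inH na (has-⁻ Z-sub (shift∈ na g)) (g ∙ x)) ⟩
      g ⁻ ∙ (fun a (g ∙ x) ∙ c ⁻ ∙ x ⁻)           ≡⟨ solve (g ∷ fun a (g ∙ x) ∷ c ∷ x ∷ []) (ι v₀ ⊕ (v₁ ⊕ ι v₂ ⊕ ι v₃))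
                                                       (v₃ ⊕ ((ι (v₀ ⊕ v₃) ⊕ v₁ ⊕ ι v₂) ⊕ ι v₃)) refl ⟩
      x ∙ (shift a (g ∙ x) ∙ c ⁻ ∙ x ⁻)           ≡⟨ cong (x ∙_) (M-comm (has-∙ M-sub (Z⊆M (shift∈ na (g ∙ x))) (has-⁻ M-sub (Z⊆M (shift∈ na g)))) (has-⁻ M-sub x∈)) ⟩
      x ∙ (x ⁻ ∙ (shift a (g ∙ x) ∙ c ⁻))         ≡⟨ solve (x ∷ (shift a (g ∙ x) ∙ c ⁻) ∷ []) (v₀ ⊕ (ι v₀ ⊕ v₁)) v₁ refl ⟩
      shift a (g ∙ x) ∙ c ⁻                       ∎
      where
      open ≡-Reasoning
      c = shift a g
      a⁻g : inv a g ≡ g ∙ c ⁻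
      a⁻g = fun-injective a (trans (fun-inv a g) (sym (trans (inH na (has-⁻ Z-sub (shift∈ na g)) g)
        (solve (g ∷ fun a g ∷ []) (v₁ ⊕ ι (ι v₀ ⊕ v₁)) v₀ refl))))
      move : inv a g ∙ x ≡ g ∙ x ∙ c ⁻
      move = trans (cong (_∙ x) a⁻g) (trans (assoc _ _ _)
        (trans (cong (g ∙_) (M-comm (has-⁻ M-sub (Z⊆M (shift∈ na g))) x∈)) (sym (assoc _ _ _))))

    -- Suppose b = Δ x a commutes with M. Rigidity makes b a translation by some z′, so a conjugates
    -- x to x z′ ∈ M. Then a, corrected by the translation that makes it fix e, is trivial by
    -- `trivial-intersection`; so a itself is a translation by an element of Z, contrary to
    -- `nontrivial`.
    Δ-InN : ∀ {x a} → x ∈ M → x ∉ Z → InN a → InN (Δ x a)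
    Δ-InN {x} {a} x∈ x∉ na = record
      { inH = Δ-InH x∈ na
      ; shift∈ = Δ-shift∈
      ; nontrivial = λ trivial → nontrivial na (a-commutes trivial)
      }
      where
      b = Δ x a
      Δ-shift∈ : ∀ g → shift b g ∈ Z
      Δ-shift∈ g = subst (_∈ Z) (sym (shift-Δ x∈ na g)) (has-∙ Z-sub (shift∈ na (g ∙ x)) (has-⁻ Z-sub (shift∈ na g)))
      module _ (trivial : ∀ w → w ∈ M → Commutes b w) where
        open ≡-Reasoning
        z′ = shift b e
        b-const : ∀ g → fun b g ≡ g ∙ z′
        b-const g = trans (solve (fun b g ∷ z′ ∷ []) v₀ (v₀ ⊕ ι v₁ ⊕ v₁) refl) (cong (_∙ z′) (rigid (ρ (z′ ⁻) ∘ᴬ b) e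
          (solve (e ∷ fun b e ∷ []) (v₁ ⊕ ι (ι v₀ ⊕ v₁)) v₀ refl)
          (λ w w∈ → w , w∈ , ∘-commutes (ρ (z′ ⁻)) b (∙-swap (has-⁻ M-sub (Z⊆M (Δ-shift∈ e))) w∈) (trivial w w∈)) g))
        c₀ = shift a e
        a-conj : ∀ g → fun a (g ∙ x) ≡ fun a g ∙ (x ∙ z′)
        a-conj g = begin
          fun a (g ∙ x)                         ≡⟨ fun-shift a (g ∙ x) ⟩
          g ∙ x ∙ shift a (g ∙ x)               ≡⟨ cong (g ∙ x ∙_) (begin
            shift a (g ∙ x)                       ≡⟨ solve (shift a (g ∙ x) ∷ shift a g ∷ []) v₀ (v₀ ⊕ ι v₁ ⊕ v₁) refl ⟩
            shift a (g ∙ x) ∙ shift a g ⁻ ∙ shift a g ≡⟨ cong (_∙ shift a g) (trans (sym (shift-Δ x∈ na g))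
              (trans (cong (g ⁻ ∙_) (b-const g)) (solve (g ∷ z′ ∷ []) (ι v₀ ⊕ (v₀ ⊕ v₁)) v₁ refl))) ⟩
            z′ ∙ shift a g                        ∎) ⟩
          g ∙ x ∙ (z′ ∙ shift a g)              ≡⟨ solve (g ∷ x ∷ z′ ∷ shift a g ∷ []) (v₀ ⊕ v₁ ⊕ (v₂ ⊕ v₃)) (v₀ ⊕ (v₁ ⊕ v₂ ⊕ v₃)) refl ⟩
          g ∙ (x ∙ z′ ∙ shift a g)              ≡⟨ cong (g ∙_) (Z-comm (has-∙ M-sub x∈ (Z⊆M (Δ-shift∈ e))) (shift∈ na g)) ⟩
          g ∙ (shift a g ∙ (x ∙ z′))            ≡⟨ assoc _ _ _ ⟨
          g ∙ shift a g ∙ (x ∙ z′)              ≡⟨ cong (_∙ (x ∙ z′)) (fun-shift a g) ⟨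
          fun a g ∙ (x ∙ z′)                    ∎
        c₀∈ = has-⁻ M-sub (Z⊆M (shift∈ na e))
        a-id : ∀ g → fun a g ∙ c₀ ⁻ ≡ g
        a-id = trivial-intersection (ρ (c₀ ⁻) ∘ᴬ a) (∘-InH (ρ (c₀ ⁻)) a (ρ-InH c₀∈) (inH na)) e
          (solve (e ∷ fun a e ∷ []) (v₁ ⊕ ι (ι v₀ ⊕ v₁)) v₀ refl) x∈ x∉ (has-∙ M-sub x∈ (Z⊆M (Δ-shift∈ e)))
          (λ g → trans (cong (_∙ c₀ ⁻) (a-conj g)) (∙-swap c₀∈ (has-∙ M-sub x∈ (Z⊆M (Δ-shift∈ e))) (fun a g)))
        a-const : ∀ g → fun a g ≡ g ∙ c₀
        a-const g = trans (solve (fun a g ∷ c₀ ∷ []) v₀ (v₀ ⊕ ι v₁ ⊕ v₁) refl) (cong (_∙ c₀) (a-id g))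
        a-commutes : ∀ w → w ∈ M → Commutes a w
        a-commutes w w∈ g = trans (a-const (g ∙ w)) (trans (∙-swap (Z⊆M (shift∈ na e)) w∈ g) (cong (_∙ w) (sym (a-const g))))

    Z-proper : ∃ λ x → x ∈ M × x ∉ Z
    Z-proper with Fin.any? (λ x → (x ∈? M) ×-dec ¬? (x ∈? Z))
    ... | yes p = p
    ... | no none = contradiction all-commute (nontrivial k-InN)
      where
      all-commute : ∀ x → x ∈ M → Commutes k x
      all-commute x x∈ with x ∈? Z
      ... | yes x∈Z = inH k-InN x∈Z
      ... | no x∉ = contradiction (x , x∈ , x∉) none

    -- The pair (uw, w) has quotient u. Its image under a has quotient u w d w⁻¹, which is u d
    -- because d and w commute in M.
    shift-invariance : ∀ a {w} → InN a → w ∈ M → ∀ u → lookup S (u ∙ (shift a (u ∙ w) ∙ shift a w ⁻)) ≡ lookup S u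
    shift-invariance a {w} na w∈ u = begin
      lookup S (u ∙ d)                                    ≡⟨ cong (λ t → lookup S (u ∙ t)) (trans (solve (d ∷ w ∷ []) v₀ (v₀ ⊕ v₁ ⊕ ι v₁) refl)
                                                               (cong (_∙ w ⁻) (sym (M-comm w∈ d∈)))) ⟩
      lookup S (u ∙ (w ∙ d ∙ w ⁻))                        ≡⟨ cong (lookup S) (solve (u ∷ w ∷ fun a (u ∙ w) ∷ fun a w ∷ [])
                                                               (v₀ ⊕ (v₁ ⊕ (ι (v₀ ⊕ v₁) ⊕ v₂ ⊕ ι (ι v₁ ⊕ v₃)) ⊕ ι v₁)) (v₂ ⊕ ι v₃) refl) ⟩
      lookup S (fun a (u ∙ w) ∙ fun a w ⁻)                ≡⟨ arc a (u ∙ w) w ⟩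
      lookup S (u ∙ w ∙ w ⁻)                              ≡⟨ cong (lookup S) (solve (u ∷ w ∷ []) (v₀ ⊕ v₁ ⊕ ι v₁) v₀ refl) ⟩
      lookup S u                                          ∎
      where
      open ≡-Reasoning
      d = shift a (u ∙ w) ∙ shift a w ⁻
      d∈ : d ∈ M
      d∈ = Z⊆M (has-∙ Z-sub (shift∈ na _) (has-⁻ Z-sub (shift∈ na w)))

    -- Period subgroups of S on the cosets of Z

    module PeriodSubgroups {a : Aut S} (na : InN a) {X : Subset n} (X-sub : Subgroup X) (X⊆Z : ∀ {x} → x ∈ X → x ∈ Z)
      (shift∈X : ∀ g → shift a g ∈ X)
      (minimal : ∀ {b : Aut S} → InN b → ∀ {Y} → Subgroup Y → (∀ {x} → x ∈ Y → x ∈ X) → (∀ g → shift b g ∈ Y) → card X ≤ card Y) where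

      X⊆M : ∀ {x} → x ∈ X → x ∈ M
      X⊆M = Z⊆M ∘ X⊆Z

      isPeriod? : ∀ v z → Dec (z ∈ X × (∀ z′ → z′ ∈ Z → lookup S (v ∙ z′ ∙ z) ≡ lookup S (v ∙ z′)))
      isPeriod? v z = (z ∈? X) ×-dec Fin.all? λ z′ → (z′ ∈? Z) →-dec (lookup S (v ∙ z′ ∙ z) Bool.≟ lookup S (v ∙ z′))

      Period : Fin n → Subset n
      Period v = ⟪ isPeriod? v ⟫

      Period⊆X : ∀ {v z} → z ∈ Period v → z ∈ X
      Period⊆X {v} = proj₁ ∘ ∊⁻ (isPeriod? v)

      Period-sub : ∀ v → Subgroup (Period v)
      Period-sub v = record
        { has-e = ∊⁺ (isPeriod? v) (has-e X-sub , λ z′ _ → cong (lookup S) (identityʳ _))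
        ; has-∙ = λ {y} {z} p q → let y∈ , py = ∊⁻ (isPeriod? v) p ; z∈ , pz = ∊⁻ (isPeriod? v) q in
            ∊⁺ (isPeriod? v) (has-∙ X-sub y∈ z∈ , λ z′ z′∈ → begin
              lookup S (v ∙ z′ ∙ (y ∙ z))   ≡⟨ cong (lookup S) (solve (v ∷ z′ ∷ y ∷ z ∷ []) (v₀ ⊕ v₁ ⊕ (v₂ ⊕ v₃)) (v₀ ⊕ (v₁ ⊕ v₂) ⊕ v₃) refl) ⟩
              lookup S (v ∙ (z′ ∙ y) ∙ z)   ≡⟨ pz (z′ ∙ y) (has-∙ Z-sub z′∈ (X⊆Z y∈)) ⟩
              lookup S (v ∙ (z′ ∙ y))       ≡⟨ cong (lookup S) (sym (assoc _ _ _)) ⟩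
              lookup S (v ∙ z′ ∙ y)         ≡⟨ py z′ z′∈ ⟩
              lookup S (v ∙ z′)             ∎)
        ; has-⁻ = λ {z} p → let z∈ , pz = ∊⁻ (isPeriod? v) p in
            ∊⁺ (isPeriod? v) (has-⁻ X-sub z∈ , λ z′ z′∈ → begin
              lookup S (v ∙ z′ ∙ z ⁻)         ≡⟨ cong (lookup S) (assoc _ _ _) ⟩
              lookup S (v ∙ (z′ ∙ z ⁻))       ≡⟨ pz (z′ ∙ z ⁻) (has-∙ Z-sub z′∈ (has-⁻ Z-sub (X⊆Z z∈))) ⟨
              lookup S (v ∙ (z′ ∙ z ⁻) ∙ z)   ≡⟨ cong (lookup S) (solve (v ∷ z′ ∷ z ∷ []) (v₀ ⊕ (v₁ ⊕ ι v₂) ⊕ v₂) (v₀ ⊕ v₁) refl) ⟩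
              lookup S (v ∙ z′)               ∎)
        }
        where open ≡-Reasoning

      value∈Period : ∀ v {w} → w ∈ M → shift a (v ∙ w) ∙ shift a w ⁻ ∈ Period v
      value∈Period v {w} w∈ = ∊⁺ (isPeriod? v) (has-∙ X-sub (shift∈X _) (has-⁻ X-sub (shift∈X w)) , λ z′ z′∈ →
        trans (cong (λ c → lookup S (v ∙ z′ ∙ (c ∙ shift a w ⁻))) (sym (trans
            (cong (shift a) (∙-swap w∈ (Z⊆M z′∈) v)) (shift-periodic na (v ∙ w) z′∈))))
          (shift-invariance a na w∈ (v ∙ z′)))

      -- The values of Δ x a lie in the product of the two period subgroups, so that product is X by minimality.
      supplement : ∀ {v x} → v ∉ M → x ∈ M → x ∉ Z → Supplement X (Period v) (Period (v ∙ x))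
      supplement {v} {x} v∉ x∈ x∉ {y} y∈ = proj₂ (∊⁻ inProduct? (subst (y ∈_) (sym Y≡X) y∈))
        where
        inProduct? : ∀ y → Dec (y ∈ X × ∃ λ p → p ∈ Period v × p ⁻ ∙ y ∈ Period (v ∙ x))
        inProduct? y = (y ∈? X) ×-dec Fin.any? λ p → (p ∈? Period v) ×-dec (p ⁻ ∙ y ∈? Period (v ∙ x))
        Y = ⟪ inProduct? ⟫
        P-sub = Period-sub v
        Q-sub = Period-sub (v ∙ x)
        Y-sub : Subgroup Y
        Y-sub = record
          { has-e = ∊⁺ inProduct? (has-e X-sub , e , has-e P-sub , subst (_∈ Period (v ∙ x)) (sym (inverseˡ e)) (has-e Q-sub))
          ; has-∙ = λ {s} {t} ps pt → let s∈ , p , p∈ , ps∈ = ∊⁻ inProduct? ps ; t∈ , q , q∈ , qt∈ = ∊⁻ inProduct? pt in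
              ∊⁺ inProduct? (has-∙ X-sub s∈ t∈ , p ∙ q , has-∙ P-sub p∈ q∈ , subst (_∈ Period (v ∙ x))
                (trans (M-comm (X⊆M (Period⊆X ps∈)) (X⊆M (Period⊆X qt∈)))
                (trans (assoc _ _ _) (trans (cong (q ⁻ ∙_) (trans (M-comm (X⊆M t∈) (X⊆M (Period⊆X ps∈))) (assoc _ _ _)))
                  (solve (p ∷ q ∷ s ∷ t ∷ []) (ι v₁ ⊕ (ι v₀ ⊕ (v₂ ⊕ v₃))) (ι (v₀ ⊕ v₁) ⊕ (v₂ ⊕ v₃)) refl))))
                (has-∙ Q-sub ps∈ qt∈))
          ; has-⁻ = λ {s} ps → let s∈ , p , p∈ , ps∈ = ∊⁻ inProduct? ps in
              ∊⁺ inProduct? (has-⁻ X-sub s∈ , p ⁻ , has-⁻ P-sub p∈ , subst (_∈ Period (v ∙ x))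
                (trans (cong (_⁻) (M-comm (has-⁻ M-sub (X⊆M (Period⊆X p∈))) (X⊆M s∈))) (solve (s ∷ p ∷ []) (ι (v₀ ⊕ ι v₁)) (ι (ι v₁) ⊕ ι v₀) refl)) (has-⁻ Q-sub ps∈))
          }
        -- With c = `shift a`, the difference c(gx) c(g)⁻¹ telescopes through a value on the other
        -- half: through c(vgx) if g ∈ M, and through c(w) if g = vw lies outside M. Each factor or
        -- its inverse is supplied by `value∈Period`.
        values : ∀ g → shift (Δ x a) g ∈ Y
        values g with g ∈? M
        ... | yes g∈ = subst (_∈ Y) (sym (shift-Δ x∈ na g)) (∊⁺ inProduct?
            (has-∙ X-sub (shift∈X _) (has-⁻ X-sub (shift∈X g)) , (shift a (v ∙ (g ∙ x)) ∙ shift a (g ∙ x) ⁻) ⁻ ,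
             has-⁻ P-sub (value∈Period v (has-∙ M-sub g∈ x∈)) ,
             subst (_∈ Period (v ∙ x)) (trans (cong (λ t → shift a t ∙ shift a g ⁻) (trans (assoc _ _ _) (cong (v ∙_) (M-comm x∈ g∈))))
               (solve (shift a (v ∙ (g ∙ x)) ∷ shift a (g ∙ x) ∷ shift a g ∷ []) (v₀ ⊕ ι v₂) (ι (ι (v₀ ⊕ ι v₁)) ⊕ (v₁ ⊕ ι v₂)) refl))
               (value∈Period (v ∙ x) g∈)))
        ... | no g∉ = subst (_∈ Y) (sym (shift-Δ x∈ na g)) (∊⁺ inProduct?
            (has-∙ X-sub (shift∈X _) (has-⁻ X-sub (shift∈X g)) , (shift a (v ∙ w) ∙ shift a w ⁻) ⁻ ,
             has-⁻ P-sub (value∈Period v w∈) ,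
             subst (_∈ Period (v ∙ x)) vxw-value (value∈Period (v ∙ x) w∈)))
          where
          w = v ⁻ ∙ g
          w∈ : w ∈ M
          w∈ = index-2 M-sub 2m≡n v∉ g∉
          vw≡g : v ∙ w ≡ g
          vw≡g = solve (v ∷ g ∷ []) (v₀ ⊕ (ι v₀ ⊕ v₁)) v₁ refl
          c = shift a w
          cg = shift a g
          cgx = shift a (g ∙ x)
          vxw-value : shift a (v ∙ x ∙ w) ∙ c ⁻ ≡ (shift a (v ∙ w) ∙ c ⁻) ⁻ ⁻ ∙ (cgx ∙ cg ⁻)
          vxw-value = begin
            shift a (v ∙ x ∙ w) ∙ c ⁻           ≡⟨ cong (λ t → shift a t ∙ c ⁻) (trans (∙-swap w∈ x∈ v) (cong (_∙ x) vw≡g)) ⟩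
            cgx ∙ c ⁻                           ≡⟨ solve (cgx ∷ cg ∷ c ∷ []) (v₀ ⊕ ι v₂) (v₀ ⊕ ι v₁ ⊕ (v₁ ⊕ ι v₂)) refl ⟩
            cgx ∙ cg ⁻ ∙ (cg ∙ c ⁻)             ≡⟨ M-comm (X⊆M (has-∙ X-sub (shift∈X _) (has-⁻ X-sub (shift∈X g))))
                                                     (X⊆M (has-∙ X-sub (shift∈X g) (has-⁻ X-sub (shift∈X w)))) ⟩
            cg ∙ c ⁻ ∙ (cgx ∙ cg ⁻)             ≡⟨ cong (_∙ (cgx ∙ cg ⁻)) (trans (cong (λ t → shift a t ∙ c ⁻) (sym vw≡g))
                                                     (solve ((shift a (v ∙ w) ∙ c ⁻) ∷ []) v₀ (ι (ι v₀)) refl)) ⟩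
            (shift a (v ∙ w) ∙ c ⁻) ⁻ ⁻ ∙ (cgx ∙ cg ⁻) ∎
            where open ≡-Reasoning
        Y⊆X : ∀ {y} → y ∈ Y → y ∈ X
        Y⊆X = proj₁ ∘ ∊⁻ inProduct?
        Y≡X : Y ≡ X
        Y≡X = card-⊆-≡ Y⊆X (minimal (Δ-InN x∈ x∉ na) Y-sub Y⊆X values)

      period-letter : ∃ λ d → d ∈ X × d ≢ e
      period-letter with Fin.any? (λ d → (d ∈? X) ×-dec ¬? (d Fin.≟ e))
      ... | yes p = p
      ... | no none = contradiction (λ x _ g → trans (a-id (g ∙ x)) (cong (_∙ x) (sym (a-id g)))) (nontrivial na)
        where
        a-id : ∀ g → fun a g ≡ g
        a-id g with shift a g Fin.≟ e
        ... | yes eq = trans (fun-shift a g) (trans (cong (g ∙_) eq) (identityʳ g))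
        ... | no ne = contradiction (shift a g , shift∈X g , ne) none

      hasPeriod? : ∀ v → Dec (∃ λ z → z ∈ Period v × z ≢ e)
      hasPeriod? v = Fin.any? λ z → (z ∈? Period v) ×-dec ¬? (z Fin.≟ e)

      module AllPeriodic (all-periodic : ∀ v → v ∉ M → ∃ λ z → z ∈ Period v × z ≢ e) where

        d = proj₁ period-letter

        -- The common letter d is preferred wherever it is a period. A different value therefore
        -- certifies that `Period v` is a proper subgroup of X.
        δ : Fin n → Fin n
        δ v with d ∈? Period v | hasPeriod? v
        ... | yes _ | _ = d
        ... | no _ | yes (z , _) = z
        ... | no _ | no _ = e

        δ∈Period : ∀ v → δ v ∈ Period v
        δ∈Period v with d ∈? Period v | hasPeriod? v
        ... | yes p | _ = p
        ... | no _ | yes (_ , p , _) = p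
        ... | no _ | no _ = has-e (Period-sub v)

        δ≢e : ∀ {v} → v ∉ M → δ v ≢ e
        δ≢e {v} v∉ with d ∈? Period v | hasPeriod? v
        ... | yes _ | _ = proj₂ (proj₂ period-letter)
        ... | no _ | yes (_ , _ , p) = p
        ... | no _ | no ¬p = contradiction (all-periodic v v∉) ¬p

        exceptional : ∀ {v} → δ v ≢ d → d ∉ Period v
        exceptional {v} ne with d ∈? Period v | hasPeriod? v
        ... | yes _ | _ = contradiction refl ne
        ... | no p | _ = p

        -- The period groups of exceptional cosets are proper in X, and for distinct cosets they
        -- supplement each other, so `supplements-length` bounds their number by |X|.
        few-exceptions : ∀ vs → All (λ v → v ∉ M × δ v ≢ d) vs → AllPairs (λ v w → v ⁻ ∙ w ∉ Z) vs → length vs ≤ card Z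
        few-exceptions vs exc apart = ≤-trans (≤-reflexive (sym (length-map Period vs)))
          (≤-trans (supplements-length X-sub (map Period vs) (propers vs exc) (supplements vs exc apart)) (card-mono X⊆Z))
          where
          propers : ∀ vs → All (λ v → v ∉ M × δ v ≢ d) vs →
            All (λ D → Subgroup D × (∀ {y} → y ∈ D → y ∈ X) × card D + card D ≤ card X) (map Period vs)
          propers [] [] = []
          propers (v ∷ vs) ((_ , ne) ∷ ps) = (Period-sub v , Period⊆X ,
            proper-card (Period-sub v) X-sub Period⊆X (proj₁ (proj₂ period-letter)) (exceptional ne)) ∷ propers vs ps
          supplements : ∀ vs → All (λ v → v ∉ M × δ v ≢ d) vs → AllPairs (λ v w → v ⁻ ∙ w ∉ Z) vs →
            AllPairs (Supplement X) (map Period vs)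
          supplements [] _ _ = []
          supplements (v ∷ vs) ((v∉ , _) ∷ ps) (q ∷ qs) = row vs ps q ∷ supplements vs ps qs
            where
            row : ∀ ws → All (λ v → v ∉ M × δ v ≢ d) ws → All (λ w → v ⁻ ∙ w ∉ Z) ws →
              All (Supplement X (Period v)) (map Period ws)
            row [] _ _ = []
            row (w ∷ ws) ((w∉ , _) ∷ ps) (q ∷ qs) = subst (λ u → Supplement X (Period v) (Period u))
              (solve (v ∷ w ∷ []) (v₀ ⊕ (ι v₀ ⊕ v₁)) v₁ refl) (supplement v∉ (index-2 M-sub 2m≡n v∉ w∉) q) ∷ row ws ps qs

  -- Two kinds of periodicity as the obstructions to semiregularity

  ProperSubgroup : Subset n → Set
  ProperSubgroup P = Subgroup P × (∀ {x} → x ∈ P → x ∈ M) × ∃ λ x → x ∈ M × x ∉ P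

  -- The outcome when some coset has only the trivial period: the period group of any other coset is
  -- then all of X, and one d serves everywhere else. It also covers sets S lying inside a single
  -- coset of P.
  PeriodicOffCoset : Subset n → Set
  PeriodicOffCoset S = ∃ λ P → ProperSubgroup P × ∃ λ d → d ∈ P × d ≢ e × ∃ λ u₀ → u₀ ∉ M ×
    ∀ v → v ∉ M → u₀ ⁻ ∙ v ∉ P → lookup S (v ∙ d) ≡ lookup S v

  -- The outcome when every coset has a period, recorded by δ. The final clause is for small P,
  -- where only the cosets that deviate from d get listed.
  PeriodicOnCosets : Subset n → Set
  PeriodicOnCosets S = ∃ λ P → ProperSubgroup P × ∃ λ d → d ∈ P × d ≢ e × ∃ λ (δ : Fin n → Fin n) →
    (∀ v → δ v ∈ P) × (∀ v → v ∉ M → δ v ≢ e) ×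
    (∀ v z → v ∉ M → z ∈ P → lookup S (v ∙ z ∙ δ v) ≡ lookup S (v ∙ z)) ×
    (∀ vs → All (λ v → v ∉ M × δ v ≢ d) vs → AllPairs (λ v w → v ⁻ ∙ w ∉ P) vs → length vs ≤ card P)

  -- Two inductions provide the extremal choices. In `outer` the fuel exceeds n minus the order of
  -- the centraliser, so larger centralisers are settled and k is maximal. In `descent` the fuel
  -- exceeds |X|, so a smaller subgroup carrying the displacements of another such map has already
  -- been refuted.
  semiregular : ∀ {S} → NormalRigid S → ¬ PeriodicOffCoset S → ¬ PeriodicOnCosets S →
    ∀ (k : Aut S) y → fun k y ≡ y → ∀ g → fun k g ≡ g
  semiregular {S} rigid ¬off ¬on k y ky = outer (suc n) k y ky (m≤n⇒m≤n+o (card (Centraliser k)) ≤-refl)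
    where
    module Inner (k : Aut S) (y : Fin n) (ky : fun k y ≡ y) (moves : ¬ (∀ g → fun k g ≡ g))
      (maximal : ∀ (l : Aut S) y → fun l y ≡ y → (∀ {z} → z ∈ Centraliser k → z ∈ Centraliser l) →
        ∀ {x} → x ∈ Centraliser l → x ∉ Centraliser k → ∀ g → fun l g ≡ g) where

      open MaximalCentraliser rigid k y ky moves maximal

      Z-ProperSubgroup : ProperSubgroup Z
      Z-ProperSubgroup = Z-sub , Z⊆M , Z-proper

      descent : ∀ fuel {a : Aut S} → InN a → ∀ {X} → Subgroup X → (∀ {x} → x ∈ X → x ∈ Z) → (∀ g → shift a g ∈ X) → card X < fuel → ⊥
      descent (suc fuel) {a} na {X} X-sub X⊆Z shift∈X (s≤s le) =
        dichotomy (Fin.any? λ v → ¬? (v ∈? M) ×-dec ¬? (hasPeriod? v))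
        where
        minimal : ∀ {b : Aut S} → InN b → ∀ {Y} → Subgroup Y → (∀ {x} → x ∈ Y → x ∈ X) → (∀ g → shift b g ∈ Y) → card X ≤ card Y
        minimal {b} nb {Y} Y-sub Y⊆X shift∈Y with card X ≤? card Y
        ... | yes X≤Y = X≤Y
        ... | no X≰Y = ⊥-elim (descent fuel nb Y-sub (X⊆Z ∘ Y⊆X) shift∈Y (≤-trans (≰⇒> X≰Y) le))
        open PeriodSubgroups na X-sub X⊆Z shift∈X minimal
        dichotomy : Dec (∃ λ v → v ∉ M × ¬ (∃ λ z → z ∈ Period v × z ≢ e)) → ⊥
        dichotomy (yes (u₀ , u₀∉ , none)) = ¬off (Z , Z-ProperSubgroup , d , X⊆Z (proj₁ (proj₂ period-letter)) , proj₂ (proj₂ period-letter) , u₀ , u₀∉ , periodic)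
          where
          d = proj₁ period-letter
          periodic : ∀ v → v ∉ M → u₀ ⁻ ∙ v ∉ Z → lookup S (v ∙ d) ≡ lookup S v
          periodic v v∉ v∉u₀Z with supplement u₀∉ (index-2 M-sub 2m≡n u₀∉ v∉) v∉u₀Z (proj₁ (proj₂ period-letter))
          ... | p , p∈ , q∈ = trans (cong (λ u → lookup S (u ∙ d)) (sym (identityʳ v)))
                (trans (proj₂ (∊⁻ (isPeriod? v) d∈) e (has-e Z-sub)) (cong (lookup S) (identityʳ v)))
            where
            p≡e : p ≡ e
            p≡e with p Fin.≟ e
            ... | yes eq = eq
            ... | no ne = contradiction (p , p∈ , ne) none
            d∈ : d ∈ Period v
            d∈ = subst₂ (λ t u → t ∈ Period u) (trans (cong (λ t → t ⁻ ∙ d) p≡e) (solve (d ∷ []) (ι ε ⊕ v₀) v₀ refl))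
              (solve (u₀ ∷ v ∷ []) (v₀ ⊕ (ι v₀ ⊕ v₁)) v₁ refl) q∈
        dichotomy (no none) = ¬on (Z , Z-ProperSubgroup , d , X⊆Z (proj₁ (proj₂ period-letter)) , proj₂ (proj₂ period-letter) , δ ,
            (λ v → X⊆Z (Period⊆X (δ∈Period v))) , (λ v → δ≢e) , (λ v z v∉ → proj₂ (∊⁻ (isPeriod? v) (δ∈Period v)) z) , few-exceptions)
          where
          all-periodic : ∀ v → v ∉ M → ∃ λ z → z ∈ Period v × z ≢ e
          all-periodic v v∉ with hasPeriod? v
          ... | yes p = p
          ... | no ¬p = contradiction (v , v∉ , ¬p) none
          open AllPeriodic all-periodic

      impossible : ⊥
      impossible = descent (suc (card Z)) k-InN Z-sub id (shift∈ k-InN) ≤-refl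

    outer : ∀ fuel (k : Aut S) y → fun k y ≡ y → n < fuel + card (Centraliser k) → ∀ g → fun k g ≡ g
    outer zero k y ky lt = contradiction lt (≤⇒≯ (≤-trans (length-⊆ (elems-unique (Centraliser k)) (λ {x} _ → ∈-allFin x)) (≤-reflexive (length-tabulate id))))
    outer (suc fuel) k y ky lt with Fin.all? (λ g → fun k g Fin.≟ g)
    ... | yes p = p
    ... | no moves = ⊥-elim (Inner.impossible k y ky moves λ l y′ ly′ sub x∈ x∉ →
            outer fuel l y′ ly′ (≤-trans lt (≤-trans (≤-reflexive (sym (+-suc fuel _))) (+-monoʳ-≤ fuel (card-mono-< sub x∈ x∉)))))

  -- Sieving subsets of R ∖ M by invariance under listed maps

  m : ℕ
  m = card M

  Mᶜ : Subset n
  Mᶜ = ∁ M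

  card-Mᶜ : card Mᶜ ≡ m
  card-Mᶜ = begin
    card Mᶜ           ≡⟨ card-∣∣ Mᶜ ⟩
    ∣ Mᶜ ∣            ≡⟨ ∣∁p∣≡n∸∣p∣ M ⟩
    n ∸ ∣ M ∣         ≡⟨ cong (n ∸_) (card-∣∣ M) ⟨
    n ∸ m             ≡⟨ cong (_∸ m) (trans (sym 2m≡n) (trans (*-comm m 2) (cong (m +_) (+-identityʳ m)))) ⟩
    m + m ∸ m         ≡⟨ m+n∸n≡m m m ⟩
    m                 ∎
    where
    open ≡-Reasoning

  1≤m : 1 ≤ m
  1≤m = card-pos M-sub

  t : ∃ λ t → t ∉ M
  t with elems Mᶜ in eq
  ... | v ∷ _ = v , x∈∁p⇒x∉p (∈-elems⁻ (subst (v ∈ˡ_) (sym eq) (here refl)))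
  ... | [] = contradiction (subst (1 ≤_) (trans (sym card-Mᶜ) (cong length eq)) 1≤m) λ ()

  -- Capping the lists bounds the length for arbitrary fs, so only the f that occur for a given S need be analysed.
  sieve : ℕ → List (Fin n → Fin n) → List (Subset n)
  sieve h = concatMap λ f → cap (2 ^ h) (invariants Mᶜ f)

  sieve-length : ∀ h fs → length (sieve h fs) ≤ length fs * 2 ^ h
  sieve-length h fs = concatMap-length _ fs λ f → cap-length (2 ^ h) (invariants Mᶜ f)

  record Symmetry (S : Subset n) (f : Fin n → Fin n) : Set where
    field
      injective : ∀ {u v} → u ∈ Mᶜ → v ∈ Mᶜ → f u ≡ f v → u ≡ v
      preserves : ∀ {v} → v ∈ Mᶜ → f v ∈ Mᶜ
      invariant : Invariant Mᶜ f S

  module _ {S : Subset n} (S⊆Mᶜ : ∀ {x} → x ∈ S → x ∈ Mᶜ) {f : Fin n → Fin n} (sym-f : Symmetry S f) where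
    open Symmetry sym-f

    ∈-sieve : ∀ {h fs} → f ∈ˡ fs → (∀ k → k + k ≤ m + card (Fixed Mᶜ f) → k ≤ h) → S ∈ˡ sieve h fs
    ∈-sieve {h} f∈ bound = let k , len , k≤ = invariants-length Mᶜ f injective preserves in
      ∈-sublists _ f∈ (∈-cap (≤-trans len (^-monoʳ-≤ 2 (bound k (subst (λ c → k + k ≤ c + card (Fixed Mᶜ f)) card-Mᶜ k≤))))
        (∈-filter⁺ (invariant? Mᶜ f) (∈-subsetsOf Mᶜ S⊆Mᶜ) invariant))

    ∈-sieve-half : ∀ {fs} → f ∈ˡ fs → card (Fixed Mᶜ f) + card (Fixed Mᶜ f) ≤ m → S ∈ˡ sieve (⌊3m/4⌋ m) fs
    ∈-sieve-half f∈ le = ∈-sieve f∈ λ k k≤ → half-fixed-exponent m k _ k≤ le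

    ∈-sieve-none : ∀ {fs} → f ∈ˡ fs → (∀ v → v ∉ M → f v ≢ v) → S ∈ˡ sieve ⌊ m /2⌋ fs
    ∈-sieve-none f∈ moves = ∈-sieve f∈ λ k k≤ → half-≤ (≤-trans k≤ (≤-reflexive (trans (cong (m +_) none) (+-identityʳ m))))
      where
      none : card (Fixed Mᶜ f) ≡ 0
      none = card-empty {P = Fixed Mᶜ f} λ p → let v∈ , fv≡v = ∊⁻ (fixedIn? Mᶜ f) p in moves _ (x∈∁p⇒x∉p v∈) fv≡v

  -- The sets with at most one element, where the argument that automorphisms respect the halves may
  -- break down.
  degenerate : List (Subset n)
  degenerate = ∅ ∷ map ⁅_⁆ (allFin n)

  degenerate-length : length degenerate ≡ suc n
  degenerate-length = cong suc (trans (length-map ⁅_⁆ (allFin n)) (length-tabulate id))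

  ∈-degenerate : ∀ {S} → (∀ {x y} → x ∈ S → y ∈ S → x ≡ y) → S ∈ˡ degenerate
  ∈-degenerate {S} single with Fin.any? (_∈? S)
  ... | no none = here (⊆-antisym (λ {x} x∈ → contradiction (x , x∈) none) (λ x∈ → contradiction x∈ ∉⊥))
  ... | yes (s , s∈) = there (subst (_∈ˡ map ⁅_⁆ (allFin n)) (⊆-antisym
          (λ x∈ → subst (_∈ S) (sym (x∈⁅y⁆⇒x≡y s x∈)) s∈) (λ x∈ → subst (_∈ ⁅ s ⁆) (single s∈ x∈) (x∈⁅x⁆ s)))
          (∈-map⁺ ⁅_⁆ (∈-allFin s)))

  -- Automorphisms normalising M

  record MHomogeneous (f : Fin n → Fin n) : Set where
    field
      f-∙ : ∀ g x → x ∈ M → f (g ∙ x) ≡ f g ∙ f x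
      f-Mᶜ : ∀ v → v ∈ Mᶜ → f v ∈ Mᶜ
  open MHomogeneous

  mHomogeneous? : ∀ f → Dec (MHomogeneous f)
  mHomogeneous? f with (Fin.all? λ g → Fin.all? λ x → (x ∈? M) →-dec (f (g ∙ x) Fin.≟ f g ∙ f x))
    ×-dec (Fin.all? λ v → (v ∈? Mᶜ) →-dec (f v ∈? Mᶜ))
  ... | yes (p , q) = yes record { f-∙ = p ; f-Mᶜ = q }
  ... | no ¬p = no λ h → ¬p (f-∙ h , f-Mᶜ h)

  -- Maps are counted through codes because pointwise equal maps have equal codes, as injectivity of
  -- the count demands.
  decode : Fin (n ^ n) → Fin n → Fin n
  decode = Fin.finToFun

  homogeneousCodes : List (Fin (n ^ n))
  homogeneousCodes = filter (mHomogeneous? ∘ decode) (allFin (n ^ n))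

  -- The elements of M where f and g agree form a subgroup. Evaluating at t and at tx for generators
  -- x, instead of at x itself, keeps the recorded images in R ∖ M, with m possibilities each.
  homogeneous-agree : ∀ {f g} → MHomogeneous f → MHomogeneous g → ∀ {gs} → closure gs ≡ M →
    f (proj₁ t) ≡ g (proj₁ t) → (∀ {x} → x ∈ˡ gs → f (proj₁ t ∙ x) ≡ g (proj₁ t ∙ x)) → ∀ v → f v ≡ g v
  homogeneous-agree {f} {g} hf hg {gs} gen t≡ gs≡ = all
    where
    equal? : ∀ x → Dec (x ∈ M × f x ≡ g x)
    equal? x = (x ∈? M) ×-dec (f x Fin.≟ g x)
    idem : ∀ {f} → MHomogeneous f → f e ≡ e
    idem {f} h = ∙-cancelˡ (f e) (trans (sym (f-∙ h e e (has-e M-sub))) (trans (cong f (identityʳ e)) (sym (identityʳ _))))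
    inverse : ∀ {f} → MHomogeneous f → ∀ {x} → x ∈ M → f (x ⁻) ≡ f x ⁻
    inverse {f} h {x} x∈ = ∙-cancelʳ (f x) (trans (sym (f-∙ h (x ⁻) x x∈)) (trans (cong f (inverseˡ x)) (trans (idem h) (sym (inverseˡ (f x))))))
    E-sub : Subgroup ⟪ equal? ⟫
    E-sub = record
      { has-e = ∊⁺ equal? (has-e M-sub , trans (idem hf) (sym (idem hg)))
      ; has-∙ = λ p q → let x∈ , ex = ∊⁻ equal? p ; y∈ , ey = ∊⁻ equal? q in
          ∊⁺ equal? (has-∙ M-sub x∈ y∈ , trans (f-∙ hf _ _ y∈) (trans (cong₂ _∙_ ex ey) (sym (f-∙ hg _ _ y∈))))
      ; has-⁻ = λ p → let x∈ , ex = ∊⁻ equal? p in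
          ∊⁺ equal? (has-⁻ M-sub x∈ , trans (inverse hf x∈) (trans (cong (_⁻) ex) (sym (inverse hg x∈))))
      }
    gs⊆M : ∀ {x} → x ∈ˡ gs → x ∈ M
    gs⊆M p = subst (_ ∈_) gen (closure-∋ p)
    onM : ∀ x → x ∈ M → f x ≡ g x
    onM x x∈ = proj₂ (∊⁻ equal? (closure-min E-sub (λ {y} y∈ → ∊⁺ equal? (gs⊆M y∈ , ∙-cancelˡ (f (proj₁ t))
      (trans (sym (f-∙ hf _ y (gs⊆M y∈))) (trans (gs≡ y∈) (trans (f-∙ hg _ y (gs⊆M y∈)) (cong (_∙ g y) (sym t≡)))))))
      (subst (x ∈_) (sym gen) x∈)))
    all : ∀ v → f v ≡ g v
    all v with v ∈? M
    ... | yes v∈ = onM v v∈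
    ... | no v∉ = subst (λ v → f v ≡ g v) (solve (proj₁ t ∷ v ∷ []) (v₀ ⊕ (ι v₀ ⊕ v₁)) v₁ refl)
            (trans (f-∙ hf _ _ x∈) (trans (cong₂ _∙_ t≡ (onM _ x∈)) (sym (f-∙ hg _ _ x∈))))
      where x∈ = index-2 M-sub 2m≡n (proj₂ t) v∉

  homogeneousCodes-length : ∀ {gs} → closure gs ≡ M → length homogeneousCodes ≤ m ^ suc (length gs)
  homogeneousCodes-length {gs} gen = begin
    length homogeneousCodes
      ≤⟨ length-≤-inj image (Unique.filter⁺ (mHomogeneous? ∘ decode) (Unique.allFin⁺ (n ^ n))) into image-injective ⟩
    length (tuples (elems Mᶜ) (suc (length gs))) ≡⟨ tuples-length (elems Mᶜ) (suc (length gs)) ⟩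
    card Mᶜ ^ suc (length gs)                    ≡⟨ cong (_^ suc (length gs)) card-Mᶜ ⟩
    m ^ suc (length gs)                          ∎
    where
    open ≤-Reasoning
    points = proj₁ t ∷ map (proj₁ t ∙_) gs
    image : Fin (n ^ n) → List (Fin n)
    image c = map (decode c) points
    homogeneous : ∀ {c} → c ∈ˡ homogeneousCodes → MHomogeneous (decode c)
    homogeneous p = proj₂ (∈-filter⁻ (mHomogeneous? ∘ decode) {xs = allFin (n ^ n)} p)
    point∈ : ∀ {v} → v ∈ˡ points → v ∈ Mᶜ
    point∈ (here refl) = x∉p⇒x∈∁p (proj₂ t)
    point∈ (there p) with ∈-map⁻ (proj₁ t ∙_) p
    ... | x , x∈ , refl = x∉p⇒x∈∁p (∙-∉ (proj₂ t) (subst (x ∈_) gen (closure-∋ x∈)))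
    image-length : ∀ c → length (image c) ≡ suc (length gs)
    image-length c = trans (length-map (decode c) points) (cong suc (length-map (proj₁ t ∙_) gs))
    into : ∀ {c} → c ∈ˡ homogeneousCodes → image c ∈ˡ tuples (elems Mᶜ) (suc (length gs))
    into {c} p = subst (λ k → image c ∈ˡ tuples (elems Mᶜ) k) (image-length c) (∈-tuples entry)
      where
      entry : ∀ {y} → y ∈ˡ image c → y ∈ˡ elems Mᶜ
      entry q with ∈-map⁻ (decode c) q
      ... | v , v∈ , refl = ∈-elems (f-Mᶜ (homogeneous p) v (point∈ v∈))
    image-injective : ∀ {c c′} → c ∈ˡ homogeneousCodes → c′ ∈ˡ homogeneousCodes → image c ≡ image c′ → c ≡ c′
    image-injective {c} {c′} p p′ eq = trans (sym (Fin.funToFin-finToFin {n} {n} c)) (trans (funToFin-cong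
      (homogeneous-agree (homogeneous p) (homogeneous p′) gen (map-agree points eq (here refl))
        (λ x∈ → map-agree points eq (there (∈-map⁺ (proj₁ t ∙_) x∈))))) (Fin.funToFin-finToFin {n} {n} c′))

  normalBad : List (Subset n)
  normalBad = sieve (⌊3m/4⌋ m) (map decode homogeneousCodes)

  -- Translated so as to fix e, the automorphism is `MHomogeneous`, and it preserves S because the
  -- pair (v, e) goes to (κ v, e). If it fixes some u outside M, its fixed points there lie in u ·
  -- `FixM`, and `FixM` is a proper subgroup of M since otherwise k would be the identity. So at
  -- most half of R ∖ M is fixed.
  normalRigid : ∀ {S} → (∀ {x} → x ∈ S → x ∈ Mᶜ) → S ∉ˡ normalBad → NormalRigid S
  normalRigid {S} S⊆Mᶜ S∉ k y ky normalises with Fin.all? (λ g → fun k g Fin.≟ g)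
  ... | yes p = p
  ... | no moves = contradiction (∈-sieve-half S⊆Mᶜ symmetry (∈-map⁺ decode c∈) half-fixed) S∉
    where
    k′ : Aut S
    k′ = ρ (y ⁻) ∘ᴬ k ∘ᴬ ρ y
    κ = fun k′
    k′e : κ e ≡ e
    k′e = trans (cong (λ g → fun k g ∙ y ⁻) (identityˡ y)) (trans (cong (_∙ y ⁻) ky) (inverseʳ y))
    κ-∙ : ∀ g x → x ∈ M → κ (g ∙ x) ≡ κ g ∙ κ x
    κ-∙ g x x∈ = trans (step g) (cong (κ g ∙_) (sym (trans (trans (cong κ (sym (identityˡ x))) (step e))
        (trans (cong (_∙ (y ∙ x₂ ∙ y ⁻)) k′e) (identityˡ _)))))
      where
      x₁ = y ⁻ ∙ x ∙ y
      x₂ = proj₁ (normalises x₁ (conj-∈ y x∈))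
      step : ∀ g → κ (g ∙ x) ≡ κ g ∙ (y ∙ x₂ ∙ y ⁻)
      step g = begin
        fun k (g ∙ x ∙ y) ∙ y ⁻           ≡⟨ cong (λ h → fun k h ∙ y ⁻) (solve (g ∷ x ∷ y ∷ []) (v₀ ⊕ v₁ ⊕ v₂) (v₀ ⊕ v₂ ⊕ (ι v₂ ⊕ v₁ ⊕ v₂)) refl) ⟩
        fun k (g ∙ y ∙ x₁) ∙ y ⁻          ≡⟨ cong (_∙ y ⁻) (proj₂ (proj₂ (normalises x₁ (conj-∈ y x∈))) (g ∙ y)) ⟩
        fun k (g ∙ y) ∙ x₂ ∙ y ⁻          ≡⟨ solve (fun k (g ∙ y) ∷ x₂ ∷ y ∷ []) (v₀ ⊕ v₁ ⊕ ι v₂) (v₀ ⊕ ι v₂ ⊕ (v₂ ⊕ v₁ ⊕ ι v₂)) refl ⟩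
        fun k (g ∙ y) ∙ y ⁻ ∙ (y ∙ x₂ ∙ y ⁻) ∎
        where open ≡-Reasoning
    e~ : ∀ {v} → v ∈ M → e ~ v
    e~ {v} = subst (_∈ M) (solve (v ∷ []) v₀ (ι ε ⊕ v₀) refl)
    ~e : ∀ {v} → e ~ v → v ∈ M
    ~e {v} = subst (_∈ M) (solve (v ∷ []) (ι ε ⊕ v₀) v₀ refl)
    κ-Mᶜ : ∀ v → v ∈ Mᶜ → κ v ∈ Mᶜ
    κ-Mᶜ v v∈ = x∉p⇒x∈∁p λ κv∈ → x∈∁p⇒x∉p v∈ (~e (subst₂ _~_
      (fun-injective k′ (trans (fun-inv k′ e) (sym k′e))) (inv-fun k′ v) (half⁻ k′ (e~ κv∈))))
    c = Fin.funToFin κ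
    f = decode c
    f≡κ : ∀ g → f g ≡ κ g
    f≡κ = Fin.finToFun-funToFin κ
    f-homogeneous : MHomogeneous f
    f-homogeneous = record
      { f-∙ = λ g x x∈ → trans (f≡κ _) (trans (κ-∙ g x x∈) (sym (cong₂ _∙_ (f≡κ g) (f≡κ x))))
      ; f-Mᶜ = λ v v∈ → subst (_∈ Mᶜ) (sym (f≡κ v)) (κ-Mᶜ v v∈)
      }
    c∈ : c ∈ˡ homogeneousCodes
    c∈ = ∈-filter⁺ (mHomogeneous? ∘ decode) (∈-allFin c) f-homogeneous
    symmetry : Symmetry S f
    symmetry = record
      { injective = λ {u} {v} _ _ eq → fun-injective k′ (trans (sym (f≡κ u)) (trans eq (f≡κ v)))
      ; preserves = f-Mᶜ f-homogeneous _
      ; invariant = λ v _ → trans (cong (lookup S) (trans (f≡κ v) (trans (solve (κ v ∷ []) v₀ (v₀ ⊕ ι ε) refl) (cong (λ u → κ v ∙ u ⁻) (sym k′e)))))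
          (trans (arc k′ v e) (cong (lookup S) (solve (v ∷ []) (v₀ ⊕ ι ε) v₀ refl)))
      }
    fixedM? : ∀ x → Dec (x ∈ M × f x ≡ x)
    fixedM? x = (x ∈? M) ×-dec (f x Fin.≟ x)
    FixM = ⟪ fixedM? ⟫
    fe : f e ≡ e
    fe = trans (f≡κ e) k′e
    FixM-sub : Subgroup FixM
    FixM-sub = record
      { has-e = ∊⁺ fixedM? (has-e M-sub , fe)
      ; has-∙ = λ p q → let x∈ , ex = ∊⁻ fixedM? p ; y∈ , ey = ∊⁻ fixedM? q in
          ∊⁺ fixedM? (has-∙ M-sub x∈ y∈ , trans (f-∙ f-homogeneous _ _ y∈) (cong₂ _∙_ ex ey))
      ; has-⁻ = λ {x} p → let x∈ , ex = ∊⁻ fixedM? p in ∊⁺ fixedM? (has-⁻ M-sub x∈ , ∙-cancelʳ x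
          (trans (cong (f (x ⁻) ∙_) (sym ex)) (trans (sym (f-∙ f-homogeneous (x ⁻) x x∈)) (trans (cong f (inverseˡ x)) (trans fe (sym (inverseˡ x)))))))
      }
    all-fixed : ∀ u → u ∉ M → f u ≡ u → (∀ x → x ∈ M → f x ≡ x) → ⊥
    all-fixed u u∉ fu onM = moves λ g → begin
      fun k g                           ≡⟨ solve (fun k g ∷ y ∷ []) v₀ (v₀ ⊕ ι v₁ ⊕ v₁) refl ⟩
      fun k g ∙ y ⁻ ∙ y                 ≡⟨ cong (λ h → fun k h ∙ y ⁻ ∙ y) (solve (g ∷ y ∷ []) v₀ (v₀ ⊕ ι v₁ ⊕ v₁) refl) ⟩
      κ (g ∙ y ⁻) ∙ y                   ≡⟨ cong (_∙ y) (trans (sym (f≡κ _)) (everywhere (g ∙ y ⁻))) ⟩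
      g ∙ y ⁻ ∙ y                       ≡⟨ solve (g ∷ y ∷ []) (v₀ ⊕ ι v₁ ⊕ v₁) v₀ refl ⟩
      g                                 ∎
      where
      open ≡-Reasoning
      everywhere : ∀ v → f v ≡ v
      everywhere v with v ∈? M
      ... | yes v∈ = onM v v∈
      ... | no v∉ = subst (λ v → f v ≡ v) (solve (u ∷ v ∷ []) (v₀ ⊕ (ι v₀ ⊕ v₁)) v₁ refl)
              (trans (f-∙ f-homogeneous u _ x∈) (cong₂ _∙_ fu (onM _ x∈)))
        where x∈ = index-2 M-sub 2m≡n u∉ v∉
    half-fixed : card (Fixed Mᶜ f) + card (Fixed Mᶜ f) ≤ m
    half-fixed with Fin.any? (λ u → fixedIn? Mᶜ f u)
    ... | no none = ≤-trans (≤-reflexive (cong₂ _+_ empty empty)) z≤n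
      where
      empty : card (Fixed Mᶜ f) ≡ 0
      empty = card-empty {P = Fixed Mᶜ f} λ p → none (_ , ∊⁻ (fixedIn? Mᶜ f) p)
    ... | yes (u , u∈ , fu) with Fin.any? (λ x → (x ∈? M) ×-dec ¬? (x ∈? FixM))
    ...   | no none = ⊥-elim (all-fixed u (x∈∁p⇒x∉p u∈) fu onM)
      where
      onM : ∀ x → x ∈ M → f x ≡ x
      onM x x∈ with x ∈? FixM
      ... | yes p = proj₂ (∊⁻ fixedM? p)
      ... | no ¬p = contradiction (x , x∈ , ¬p) none
    ...   | yes (x , x∈ , x∉) = ≤-trans (+-mono-≤ fixed≤ fixed≤)
            (proper-card FixM-sub M-sub (λ p → proj₁ (∊⁻ fixedM? p)) x∈ x∉)
      where
      fixed≤ : card (Fixed Mᶜ f) ≤ card FixM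
      fixed≤ = length-≤-inj (u ⁻ ∙_) (elems-unique (Fixed Mᶜ f)) into (λ _ _ → ∙-cancelˡ (u ⁻))
        where
        into : ∀ {v} → v ∈ˡ elems (Fixed Mᶜ f) → u ⁻ ∙ v ∈ˡ elems FixM
        into {v} p = let v∈ , fv = ∊⁻ (fixedIn? Mᶜ f) (∈-elems⁻ {P = Fixed Mᶜ f} p)
                         w∈ = index-2 M-sub 2m≡n (x∈∁p⇒x∉p u∈) (x∈∁p⇒x∉p v∈) in
          ∈-elems (∊⁺ fixedM? (w∈ , ∙-cancelˡ u (trans (cong (_∙ f (u ⁻ ∙ v)) (sym fu))
            (trans (sym (f-∙ f-homogeneous u _ w∈)) (trans (cong f u[u⁻v]) (trans fv (sym u[u⁻v])))))))
          where
          u[u⁻v] : u ∙ (u ⁻ ∙ v) ≡ v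
          u[u⁻v] = solve (u ∷ v ∷ []) (v₀ ⊕ (ι v₀ ⊕ v₁)) v₁ refl

  -- Maps that multiply each coset of P by an element of P

  module CosetMoves (P : Subset n) where

    inCoset? : ∀ v w → Dec (v ⁻ ∙ w ∈ P)
    inCoset? v w = v ⁻ ∙ w ∈? P

    choose : Subset n → Fin n
    choose Q with Fin.any? (_∈? Q)
    ... | yes (w , _) = w
    ... | no _ = e

    choose∈ : ∀ {Q w} → w ∈ Q → choose Q ∈ Q
    choose∈ {Q} {w} w∈ with Fin.any? (_∈? Q)
    ... | yes (_ , p) = p
    ... | no none = contradiction (w , w∈) none

    rep : Fin n → Fin n
    rep v = choose ⟪ inCoset? v ⟫

    -- A listed point y ∈ vP encodes right multiplication of the coset vP by (rep v)⁻¹ y; unlisted cosets are multiplied by d.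
    move : Fin n → List (Fin n) → Fin n → Fin n
    move d ys v with Any.any? (inCoset? v) ys
    ... | yes p = v ∙ (rep v ⁻ ∙ proj₁ (find p))
    ... | no _ = v ∙ d

    reps : List (Fin n)
    reps = filter (λ w → rep w Fin.≟ w) (elems Mᶜ)

    choices : List (List (Fin n))
    choices = selections (λ w → map (w ∙_) (elems P)) reps

    module _ (P-proper : ProperSubgroup P) where

      P-sub = proj₁ P-proper
      P⊆M : ∀ {x} → x ∈ P → x ∈ M
      P⊆M = proj₁ (proj₂ P-proper)

      2P≤m : card P + card P ≤ m
      2P≤m = let _ , x∈ , x∉ = proj₂ (proj₂ P-proper) in proper-card P-sub M-sub P⊆M x∈ x∉

      rep∈ : ∀ v → v ⁻ ∙ rep v ∈ P
      rep∈ v = ∊⁻ (inCoset? v) (choose∈ (∊⁺ (inCoset? v) (subst (_∈ P) (solve (v ∷ []) ε (ι v₀ ⊕ v₀) refl) (has-e P-sub))))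

      -- The choice is made from the coset as a subset, and subsets with the same elements are
      -- equal, so only the coset matters.
      rep-cong : ∀ {v w} → v ⁻ ∙ w ∈ P → rep v ≡ rep w
      rep-cong {v} {w} vw = cong choose (⊆-antisym
        (λ {x} p → ∊⁺ (inCoset? w) (subst (_∈ P) (solve (v ∷ w ∷ x ∷ []) (ι (ι v₀ ⊕ v₁) ⊕ (ι v₀ ⊕ v₂)) (ι v₁ ⊕ v₂) refl)
          (has-∙ P-sub (has-⁻ P-sub vw) (∊⁻ (inCoset? v) p))))
        (λ {x} p → ∊⁺ (inCoset? v) (subst (_∈ P) (solve (v ∷ w ∷ x ∷ []) (ι v₀ ⊕ v₁ ⊕ (ι v₁ ⊕ v₂)) (ι v₀ ⊕ v₂) refl)
          (has-∙ P-sub vw (∊⁻ (inCoset? w) p)))))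

      rep-idem : ∀ v → rep (rep v) ≡ rep v
      rep-idem v = sym (rep-cong (rep∈ v))

      rep∉M : ∀ {v} → v ∉ M → rep v ∉ M
      rep∉M {v} v∉ p = v∉ (subst (_∈ M) (solve (v ∷ rep v ∷ []) (v₁ ⊕ ι (ι v₀ ⊕ v₁)) v₀ refl)
        (has-∙ M-sub p (has-⁻ M-sub (P⊆M (rep∈ v)))))

      rep∈reps : ∀ {v} → v ∉ M → rep v ∈ˡ reps
      rep∈reps {v} v∉ = ∈-filter⁺ (λ w → rep w Fin.≟ w) (∈-elems (x∉p⇒x∈∁p (rep∉M v∉))) (rep-idem v)

      reps⁻ : ∀ {w} → w ∈ˡ reps → w ∉ M × rep w ≡ w
      reps⁻ p = let w∈ , eq = ∈-filter⁻ (λ w → rep w Fin.≟ w) {xs = elems Mᶜ} p in x∈∁p⇒x∉p (∈-elems⁻ w∈) , eq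

      reps-unique : Unique reps
      reps-unique = Unique.filter⁺ (λ w → rep w Fin.≟ w) (elems-unique Mᶜ)

      choices-length : length choices ≡ card P ^ length reps
      choices-length = selections-length (λ w → map (w ∙_) (elems P)) reps (λ w → length-map (w ∙_) (elems P))

      reps-length : length reps * card P ≤ m
      reps-length = begin
        length reps * card P ≡⟨ product-length _,_ reps (elems P) ⟨
        length (cartesianProduct reps (elems P)) ≤⟨ length-≤-inj (λ (w , p) → w ∙ p)
          (Unique.cartesianProduct⁺ reps-unique (elems-unique P)) into inj ⟩
        card Mᶜ ≡⟨ card-Mᶜ ⟩
        m ∎
        where
        open ≤-Reasoning
        split : ∀ {w p} → (w , p) ∈ˡ cartesianProduct reps (elems P) → w ∈ˡ reps × p ∈ P
        split q = let w∈ , p∈ = ∈-cartesianProduct⁻ reps (elems P) q in w∈ , ∈-elems⁻ p∈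
        into : ∀ {wp} → wp ∈ˡ cartesianProduct reps (elems P) → proj₁ wp ∙ proj₂ wp ∈ˡ elems Mᶜ
        into q = let w∈ , p∈ = split q in ∈-elems (x∉p⇒x∈∁p (∙-∉ (proj₁ (reps⁻ w∈)) (P⊆M p∈)))
        inj : ∀ {wp wp′} → wp ∈ˡ cartesianProduct reps (elems P) → wp′ ∈ˡ cartesianProduct reps (elems P) →
          proj₁ wp ∙ proj₂ wp ≡ proj₁ wp′ ∙ proj₂ wp′ → wp ≡ wp′
        inj {w , p} {w′ , p′} q q′ eq = cong₂ _,_ w≡ (∙-cancelˡ w′ (trans (cong (_∙ p) (sym w≡)) eq))
          where
          w≡ : w ≡ w′
          w≡ = trans (sym (proj₂ (reps⁻ (proj₁ (split q))))) (trans (rep-cong (subst (_∈ P)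
            (trans (solve (w ∷ p ∷ p′ ∷ []) (v₁ ⊕ ι v₂) (ι v₀ ⊕ (v₀ ⊕ v₁ ⊕ ι v₂)) refl)
              (cong (w ⁻ ∙_) (trans (cong (_∙ p′ ⁻) eq) (solve (w′ ∷ p′ ∷ []) (v₀ ⊕ v₁ ⊕ ι v₁) v₀ refl))))
            (has-∙ P-sub (proj₂ (split q)) (has-⁻ P-sub (proj₂ (split q′)))))) (proj₂ (reps⁻ (proj₁ (split q′)))))

      module _ {S : Subset n} {d : Fin n} {δ : Fin n → Fin n} {ys : List (Fin n)} (δ∈ : ∀ v → δ v ∈ P)
        (δ-invariant : ∀ v → v ∉ M → lookup S (v ∙ δ (rep v)) ≡ lookup S v)
        (ys-form : ∀ {y} → y ∈ˡ ys → ∃ λ w → rep w ≡ w × y ≡ w ∙ δ w)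
        (covered : ∀ v → v ∉ M → δ (rep v) ≡ d ⊎ rep v ∙ δ (rep v) ∈ˡ ys) where

        -- A listed point w δ(w) in the coset of v has w = rep v, so it decodes to the multiplier
        -- δ(rep v); by `covered`, a coset without listed points has multiplier d.
        move-spec : ∀ v → v ∉ M → move d ys v ≡ v ∙ δ (rep v)
        move-spec v v∉ with Any.any? (inCoset? v) ys
        move-spec v v∉ | yes p with find p
        ... | y , y∈ , vy with ys-form y∈
        ... | w , rep-w , refl = trans (cong (λ r → v ∙ (r ⁻ ∙ (w ∙ δ w))) rep≡)
              (trans (solve (v ∷ w ∷ δ w ∷ []) (v₀ ⊕ (ι v₁ ⊕ (v₁ ⊕ v₂))) (v₀ ⊕ v₂) refl) (cong (λ r → v ∙ δ r) (sym rep≡)))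
          where
          rep≡ : rep v ≡ w
          rep≡ = trans (rep-cong (subst (_∈ P) (solve (v ∷ w ∷ δ w ∷ []) (ι v₀ ⊕ (v₁ ⊕ v₂) ⊕ ι v₂) (ι v₀ ⊕ v₁) refl)
            (has-∙ P-sub vy (has-⁻ P-sub (δ∈ w))))) rep-w
        move-spec v v∉ | no ¬p with covered v v∉
        ... | inj₁ δ≡d = cong (v ∙_) (sym δ≡d)
        ... | inj₂ y∈ = contradiction (lose y∈ (subst (_∈ P) (assoc _ _ _) (has-∙ P-sub (rep∈ v) (δ∈ (rep v))))) ¬p

        -- A point and its image lie in the same coset of P, so equal images come from one coset and
        -- hence share a multiplier, which cancels.
        move-symmetry : Symmetry S (move d ys)
        move-symmetry = record
          { injective = λ {u} {v} u∈ v∈ eq → inj (x∈∁p⇒x∉p u∈) (x∈∁p⇒x∉p v∈) eq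
          ; preserves = λ {v} v∈ → subst (_∈ Mᶜ) (sym (move-spec v (x∈∁p⇒x∉p v∈))) (x∉p⇒x∈∁p (∙-∉ (x∈∁p⇒x∉p v∈) (P⊆M (δ∈ _))))
          ; invariant = λ v v∈ → trans (cong (lookup S) (move-spec v (x∈∁p⇒x∉p v∈))) (δ-invariant v (x∈∁p⇒x∉p v∈))
          }
          where
          inj : ∀ {u v} → u ∉ M → v ∉ M → move d ys u ≡ move d ys v → u ≡ v
          inj {u} {v} u∉ v∉ eq = ∙-cancelʳ (δ (rep u)) (trans eq′ (cong (λ r → v ∙ δ r) (sym rep≡)))
            where
            eq′ : u ∙ δ (rep u) ≡ v ∙ δ (rep v)
            eq′ = trans (sym (move-spec u u∉)) (trans eq (move-spec v v∉))
            rep≡ : rep u ≡ rep v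
            rep≡ = rep-cong (subst (_∈ P) (trans (solve (u ∷ δ (rep u) ∷ δ (rep v) ∷ []) (v₁ ⊕ ι v₂) (ι v₀ ⊕ (v₀ ⊕ v₁ ⊕ ι v₂)) refl)
              (cong (u ⁻ ∙_) (trans (cong (_∙ δ (rep v) ⁻) eq′) (solve (v ∷ δ (rep v) ∷ []) (v₀ ⊕ v₁ ⊕ ι v₁) v₀ refl))))
              (has-∙ P-sub (δ∈ _) (has-⁻ P-sub (δ∈ _))))

  open CosetMoves

  -- Lists of the periodic sets

  module _ (j c : ℕ) where

    offData : List (List (Fin n) × Fin n × Fin n)
    offData = cartesianProduct (tuples (elems M) j) (cartesianProduct (elems M) (elems Mᶜ))

    offMove : List (Fin n) × Fin n × Fin n → Fin n → Fin n
    offMove (hs , d , y) = move (closure (hs ++ d ∷ [])) d (y ∷ [])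

    offBad : List (Subset n)
    offBad = sieve (⌊3m/4⌋ m) (map offMove offData)

    -- The test keeps the list short for every tuple of generators, even when the generated subgroup
    -- has too many choices. Proper subgroups of M of order at least 16 pass it by `letters-bound`.
    fromChoices : ∀ P → Fin n → Dec (length (choices P) ^ 4 ≤ 2 ^ m) → List (Subset n)
    fromChoices P d (yes _) = sieve ⌊ m /2⌋ (map (move P d) (choices P))
    fromChoices P d (no _) = []

    choicesBad : List (Fin n) × Fin n → List (Subset n)
    choicesBad (hs , d) = fromChoices P d (length (choices P) ^ 4 ≤? 2 ^ m)
      where P = closure (hs ++ d ∷ [])

    lettersBad : List (Subset n)
    lettersBad = concatMap choicesBad (cartesianProduct (tuples (elems M) j) (elems M))

    -- For |P| < 16 two generators besides d suffice, and c = 15 will bound the number of cosets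
    -- whose multiplier differs from d.
    fewData : List (List (Fin n) × Fin n × List (Fin n))
    fewData = cartesianProduct (tuples (elems M) 2) (cartesianProduct (elems M) (tuples (elems Mᶜ) c))

    fewMove : List (Fin n) × Fin n × List (Fin n) → Fin n → Fin n
    fewMove (hs , d , ys) = move (closure (hs ++ d ∷ [])) d ys

    fewBad : List (Subset n)
    fewBad = sieve ⌊ m /2⌋ (map fewMove fewData)

    -- As d ≠ e, the closure of d has at least two elements, which saves one generator.
    proper-generators : ∀ {P d} → ProperSubgroup P → d ∈ P → d ≢ e → ∀ k → card P < 2 ^ (2 + k) →
      ∃ λ hs → hs ∈ˡ tuples (elems M) k × closure (hs ++ d ∷ []) ≡ P
    proper-generators {P} {d} (P-sub , P⊆M , _) d∈ d≢e k small =
      let hs , len , hs⊆ , gen = generators P-sub k (d ∷ []) (λ { (here refl) → d∈ }) (<-≤-trans small (begin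
            2 ^ (2 + k)                               ≡⟨ *-comm 2 (2 ^ suc k) ⟩
            2 ^ suc k * 2                             ≤⟨ *-monoʳ-≤ (2 ^ suc k) two ⟩
            2 ^ suc k * card (closure (d ∷ []))       ∎))
      in hs , subst (λ l → hs ∈ˡ tuples (elems M) l) len (∈-tuples (∈-elems ∘ P⊆M ∘ hs⊆)) , gen
      where
      open ≤-Reasoning
      two : 2 ≤ card (closure (d ∷ []))
      two = length-⊆ {xs = e ∷ d ∷ []} (((d≢e ∘ sym) ∷ []) ∷ [] ∷ [])
        λ { (here refl) → ∈-elems (has-e (closure-sub (d ∷ []))) ; (there (here refl)) → ∈-elems (closure-∋ {gs = d ∷ []} (here refl)) }

    small-card : ∀ {P} → ProperSubgroup P → m < 2 ^ (3 + j) → card P < 2 ^ (2 + j)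
    small-card {P} proper m< = *-cancelˡ-< 2 (card P) (2 ^ (2 + j))
      (≤-<-trans (≤-trans (≤-reflexive (cong (card P +_) (+-identityʳ (card P)))) (2P≤m P proper)) m<)

    module _ {S : Subset n} (S⊆Mᶜ : ∀ {x} → x ∈ S → x ∈ Mᶜ) where

      off-bad : m < 2 ^ (3 + j) → PeriodicOffCoset S → S ∈ˡ offBad
      off-bad m< (P , proper , d , d∈ , d≢e , u , u∉ , periodic) =
          let hs , hs∈ , gen = proper-generators proper d∈ d≢e j (small-card proper m<) in ∈-sieve-half S⊆Mᶜ (move-symmetry P proper {δ = δ} {ys} δ∈ invariant form covered)
              (subst (λ Q → move Q d ys ∈ˡ map offMove offData) gen
                (∈-map⁺ offMove (∈-cartesianProduct⁺ hs∈ (∈-cartesianProduct⁺ (∈-elems (P⊆M P proper d∈))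
                  (∈-elems (x∉p⇒x∈∁p (∙-∉ (rep∉M P proper u∉) (P⊆M P proper (δ∈ (rep P u))))))))))
              (≤-trans (+-mono-≤ fixed≤ fixed≤) (2P≤m P proper))
        where
        -- No period is known on the coset uP, so its multiplier is e; the one point in `ys` records
        -- this. All fixed points then lie in uP, at most half of R ∖ M.
        δ : Fin n → Fin n
        δ v with u ⁻ ∙ v ∈? P
        ... | yes _ = e
        ... | no _ = d
        δ∈ : ∀ v → δ v ∈ P
        δ∈ v with u ⁻ ∙ v ∈? P
        ... | yes _ = has-e (P-sub P proper)
        ... | no _ = d∈
        ys = rep P u ∙ δ (rep P u) ∷ []
        back : ∀ {v} → u ⁻ ∙ v ∈ P → u ⁻ ∙ rep P v ∈ P
        back {v} p = subst (_∈ P) (solve (u ∷ v ∷ rep P v ∷ []) (ι v₀ ⊕ v₁ ⊕ (ι v₁ ⊕ v₂)) (ι v₀ ⊕ v₂) refl) (has-∙ (P-sub P proper) p (rep∈ P proper v))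
        forth : ∀ {v} → u ⁻ ∙ rep P v ∈ P → u ⁻ ∙ v ∈ P
        forth {v} p = subst (_∈ P) (solve (u ∷ v ∷ rep P v ∷ []) (ι v₀ ⊕ v₂ ⊕ ι (ι v₁ ⊕ v₂)) (ι v₀ ⊕ v₁) refl)
          (has-∙ (P-sub P proper) p (has-⁻ (P-sub P proper) (rep∈ P proper v)))
        invariant : ∀ v → v ∉ M → lookup S (v ∙ δ (rep P v)) ≡ lookup S v
        invariant v v∉ with u ⁻ ∙ rep P v ∈? P
        ... | yes _ = cong (lookup S) (identityʳ v)
        ... | no ¬p = periodic v v∉ (¬p ∘ back)
        form : ∀ {y} → y ∈ˡ ys → ∃ λ w → rep P w ≡ w × y ≡ w ∙ δ w
        form (here refl) = rep P u , rep-idem P proper u , refl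
        covered : ∀ v → v ∉ M → δ (rep P v) ≡ d ⊎ rep P v ∙ δ (rep P v) ∈ˡ ys
        covered v v∉ with u ⁻ ∙ v ∈? P
        ... | yes p = inj₂ (here (cong (λ r → r ∙ δ r) (sym (rep-cong P proper p))))
        ... | no ¬p with u ⁻ ∙ rep P v ∈? P
        ...   | yes p = contradiction (forth p) ¬p
        ...   | no _ = inj₁ refl
        fixed≤ : card (Fixed Mᶜ (move P d ys)) ≤ card P
        fixed≤ = length-≤-inj (u ⁻ ∙_) (elems-unique (Fixed Mᶜ (move P d ys))) into (λ _ _ → ∙-cancelˡ (u ⁻))
          where
          into : ∀ {v} → v ∈ˡ elems (Fixed Mᶜ (move P d ys)) → u ⁻ ∙ v ∈ˡ elems P
          into {v} q with ∊⁻ (fixedIn? Mᶜ (move P d ys)) (∈-elems⁻ {P = Fixed Mᶜ (move P d ys)} q)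
          ... | v∈ , fixed with trans (sym (move-spec P proper {S = S} δ∈ invariant form covered v (x∈∁p⇒x∉p v∈))) fixed
          ... | eq with u ⁻ ∙ rep P v ∈? P
          ...   | yes p = ∈-elems (forth p)
          ...   | no _ = contradiction (∙-cancelˡ v (trans eq (sym (identityʳ v)))) d≢e

      on-bad : 15 ≤ c → m < 2 ^ (3 + j) → PeriodicOnCosets S → S ∈ˡ lettersBad ⊎ S ∈ˡ fewBad
      on-bad 15≤c m< (P , proper , d , d∈ , d≢e , δ , δ∈ , δ≢e , periodic , few) = dispatch (16 ≤? card P)
        where
        invariant : ∀ v → v ∉ M → lookup S (v ∙ δ (rep P v)) ≡ lookup S v
        invariant v v∉ = trans (cong (λ u → lookup S (u ∙ δ (rep P v))) v≡) (trans (periodic (rep P v) (rep P v ⁻ ∙ v) (rep∉M P proper v∉)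
          (subst (_∈ P) (solve (v ∷ rep P v ∷ []) (ι (ι v₀ ⊕ v₁)) (ι v₁ ⊕ v₀) refl) (has-⁻ (P-sub P proper) (rep∈ P proper v)))) (cong (lookup S) (sym v≡)))
          where
          v≡ : v ≡ rep P v ∙ (rep P v ⁻ ∙ v)
          v≡ = solve (v ∷ rep P v ∷ []) v₀ (v₁ ⊕ (ι v₁ ⊕ v₀)) refl

        moves : ∀ {ys} → (∀ v → v ∉ M → move P d ys v ≡ v ∙ δ (rep P v)) → ∀ v → v ∉ M → move P d ys v ≢ v
        moves spec v v∉ fixed = δ≢e (rep P v) (rep∉M P proper v∉)
          (∙-cancelˡ v (trans (sym (spec v v∉)) (trans fixed (sym (identityʳ v)))))

        module AllLetters (16≤P : 16 ≤ card P) where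
          ys = map (λ w → w ∙ δ w) (reps P)
          form : ∀ {y} → y ∈ˡ ys → ∃ λ w → rep P w ≡ w × y ≡ w ∙ δ w
          form p = let w , w∈ , eq = ∈-map⁻ (λ w → w ∙ δ w) p in w , proj₂ (reps⁻ P proper w∈) , eq
          covered : ∀ v → v ∉ M → δ (rep P v) ≡ d ⊎ rep P v ∙ δ (rep P v) ∈ˡ ys
          covered v v∉ = inj₂ (∈-map⁺ (λ w → w ∙ δ w) (rep∈reps P proper v∉))
          gated : (dec : Dec (length (choices P) ^ 4 ≤ 2 ^ m)) → S ∈ˡ fromChoices P d dec
          gated (no ¬le) = contradiction (subst (λ a → a ^ 4 ≤ 2 ^ m) (sym (choices-length P proper))
            (letters-bound (length (reps P)) 16≤P (reps-length P proper))) ¬le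
          gated (yes _) = ∈-sieve-none S⊆Mᶜ (move-symmetry P proper {S} {d} {δ} {ys} δ∈ invariant form covered)
            (∈-map⁺ (move P d) (∈-selections (λ w → w ∙ δ w) (reps P) (λ w → ∈-map⁺ (w ∙_) (∈-elems (δ∈ w)))))
            (moves {ys} (move-spec P proper {S} δ∈ invariant form covered))
          bad : (∃ λ hs → hs ∈ˡ tuples (elems M) j × closure (hs ++ d ∷ []) ≡ P) → S ∈ˡ lettersBad
          bad (hs , hs∈ , gen) = ∈-sublists choicesBad (∈-cartesianProduct⁺ hs∈ (∈-elems (P⊆M P proper d∈)))
            (subst (λ Q → S ∈ˡ fromChoices Q d (length (choices Q) ^ 4 ≤? 2 ^ m)) (sym gen) (gated (length (choices P) ^ 4 ≤? 2 ^ m)))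

        module FewLetters (P<16 : card P < 16) where
          exceptional? : ∀ w → Dec (δ w ≢ d)
          exceptional? w = ¬? (δ w Fin.≟ d)
          exc = filter exceptional? (reps P)
          exc⁻ : ∀ {w} → w ∈ˡ exc → (w ∉ M × rep P w ≡ w) × δ w ≢ d
          exc⁻ p = let w∈ , ne = ∈-filter⁻ exceptional? {xs = reps P} p in reps⁻ P proper w∈ , ne
          exc-length : length exc ≤ c
          exc-length = ≤-trans (few exc (All.tabulate (λ p → proj₁ (proj₁ (exc⁻ p)) , proj₂ (exc⁻ p)))
            (Unique⇒AllPairs (Unique.filter⁺ exceptional? (reps-unique P proper)) (proj₂ ∘ proj₁ ∘ exc⁻)
              (λ rv rw v≢w vw → v≢w (trans (sym rv) (trans (rep-cong P proper vw) rw))))) (≤-trans (≤-pred P<16) 15≤c)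
          r = rep P (proj₁ t)
          -- The padding to length c repeats the correct entry for the coset of r, so it does not
          -- change the encoded map.
          ys = map (λ w → w ∙ δ w) exc ++ replicate (c ∸ length exc) (r ∙ δ r)
          ys-length : length ys ≡ c
          ys-length = trans (length-++ (map (λ w → w ∙ δ w) exc)) (trans (cong₂ _+_ (length-map (λ w → w ∙ δ w) exc)
            (length-replicate (c ∸ length exc))) (m+[n∸m]≡n exc-length))
          form′ : ∀ {y} → y ∈ˡ ys → ∃ λ w → (w ∉ M × rep P w ≡ w) × y ≡ w ∙ δ w
          form′ p = split (∈-++⁻ (map (λ w → w ∙ δ w) exc) p)
            where
            split : ∀ {y} → y ∈ˡ map (λ w → w ∙ δ w) exc ⊎ y ∈ˡ replicate (c ∸ length exc) (r ∙ δ r) →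
              ∃ λ w → (w ∉ M × rep P w ≡ w) × y ≡ w ∙ δ w
            split (inj₂ q) = r , (rep∉M P proper (proj₂ t) , rep-idem P proper (proj₁ t)) , ∈-replicate (c ∸ length exc) q
            split (inj₁ q) = let w , w∈ , eq = ∈-map⁻ (λ w → w ∙ δ w) q in w , proj₁ (exc⁻ w∈) , eq
          form : ∀ {y} → y ∈ˡ ys → ∃ λ w → rep P w ≡ w × y ≡ w ∙ δ w
          form p = let w , (_ , rw) , eq = form′ p in w , rw , eq
          ys∈ : ∀ {y} → y ∈ˡ ys → y ∈ˡ elems Mᶜ
          ys∈ p = let w , (w∉ , _) , eq = form′ p in ∈-elems (subst (_∈ Mᶜ) (sym eq) (x∉p⇒x∈∁p (∙-∉ w∉ (P⊆M P proper (δ∈ w)))))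
          covered : ∀ v → v ∉ M → δ (rep P v) ≡ d ⊎ rep P v ∙ δ (rep P v) ∈ˡ ys
          covered v v∉ with δ (rep P v) Fin.≟ d
          ... | yes eq = inj₁ eq
          ... | no ne = inj₂ (∈-++⁺ˡ (∈-map⁺ (λ w → w ∙ δ w) (∈-filter⁺ exceptional? (rep∈reps P proper v∉) ne)))
          bad : (∃ λ hs → hs ∈ˡ tuples (elems M) 2 × closure (hs ++ d ∷ []) ≡ P) → S ∈ˡ fewBad
          bad (hs , hs∈ , gen) = ∈-sieve-none S⊆Mᶜ (move-symmetry P proper {S} {d} {δ} {ys} δ∈ invariant form covered)
            (subst (λ Q → move Q d ys ∈ˡ map fewMove fewData) gen
              (∈-map⁺ fewMove (∈-cartesianProduct⁺ hs∈ (∈-cartesianProduct⁺ (∈-elems (P⊆M P proper d∈))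
                (subst (λ l → ys ∈ˡ tuples (elems Mᶜ) l) ys-length (∈-tuples ys∈))))))
            (moves {ys} (move-spec P proper {S} δ∈ invariant form covered))

        dispatch : Dec (16 ≤ card P) → S ∈ˡ lettersBad ⊎ S ∈ˡ fewBad
        dispatch (yes 16≤P) = inj₁ (AllLetters.bad 16≤P (proper-generators proper d∈ d≢e j (small-card proper m<)))
        dispatch (no 16≰P) = inj₂ (FewLetters.bad (≰⇒> 16≰P) (proper-generators proper d∈ d≢e 2 (≰⇒> 16≰P)))

  -- Automorphisms and the bipartition

  module _ {S : Subset n} (S⊆Mᶜ : ∀ {x} → x ∈ S → x ∈ Mᶜ) (φ : Perm.Permutation′ n) (φ-aut : IsAut _·_ e _⁻¹ S φ) where

    φ-arc : ∀ g h → lookup S ((φ ⟨$⟩ʳ g) ∙ (φ ⟨$⟩ʳ h) ⁻) ≡ lookup S (g ∙ h ⁻)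
    φ-arc g h with g ∙ h ⁻ ∈? S
    ... | yes p = trans (Vec.[]=⇒lookup (Equivalence.to (φ-aut g h) p)) (sym (Vec.[]=⇒lookup p))
    ... | no ¬p = trans (lookup-∉ (¬p ∘ Equivalence.from (φ-aut g h))) (sym (lookup-∉ ¬p))

    Preserves : Set
    Preserves = ∀ {g h} → g ~ h → (φ ⟨$⟩ʳ g) ~ (φ ⟨$⟩ʳ h)

    keepsHalf? : ∀ x → Dec (x ∈ M × ∀ h → (φ ⟨$⟩ʳ h) ~ (φ ⟨$⟩ʳ (x ∙ h)))
    keepsHalf? x = (x ∈? M) ×-dec Fin.all? λ h → (φ ⟨$⟩ʳ h) ⁻ ∙ (φ ⟨$⟩ʳ (x ∙ h)) ∈? M

    -- The aim is Q = M: then φ sends two points of one half into one half.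
    Q : Subset n
    Q = ⟪ keepsHalf? ⟫

    ~-refl : ∀ {g} → g ~ g
    ~-refl {g} = subst (_∈ M) (sym (inverseˡ g)) (has-e M-sub)

    Q-sub : Subgroup Q
    Q-sub = record
      { has-e = ∊⁺ keepsHalf? (has-e M-sub , λ h → subst (λ g → (φ ⟨$⟩ʳ h) ~ (φ ⟨$⟩ʳ g)) (sym (identityˡ h)) ~-refl)
      ; has-∙ = λ {x} {y} p q → let x∈ , kx = ∊⁻ keepsHalf? p ; y∈ , ky = ∊⁻ keepsHalf? q in
          ∊⁺ keepsHalf? (has-∙ M-sub x∈ y∈ , λ h → ~-trans (ky h)
            (subst (λ g → (φ ⟨$⟩ʳ (y ∙ h)) ~ (φ ⟨$⟩ʳ g)) (sym (assoc x y h)) (kx (y ∙ h))))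
      ; has-⁻ = λ {x} p → let x∈ , kx = ∊⁻ keepsHalf? p in
          ∊⁺ keepsHalf? (has-⁻ M-sub x∈ , λ h → ~-sym (subst (λ g → (φ ⟨$⟩ʳ (x ⁻ ∙ h)) ~ (φ ⟨$⟩ʳ g))
            (solve (x ∷ h ∷ []) (v₀ ⊕ (ι v₀ ⊕ v₁)) v₁ refl) (kx (x ⁻ ∙ h))))
      }

    arc-switches : ∀ {s} → s ∈ S → ∀ h → ¬ (φ ⟨$⟩ʳ (s ∙ h)) ~ (φ ⟨$⟩ʳ h)
    arc-switches {s} s∈ h p = x∈∁p⇒x∉p (S⊆Mᶜ image∈) (subst (_∈ M)
      (solve ((φ ⟨$⟩ʳ (s ∙ h)) ∷ (φ ⟨$⟩ʳ h) ∷ []) (ι (ι (ι v₀) ⊕ (ι v₀ ⊕ v₁) ⊕ ι v₀)) (v₀ ⊕ ι v₁) refl)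
      (has-⁻ M-sub (conj-∈ ((φ ⟨$⟩ʳ (s ∙ h)) ⁻) p)))
      where
      image∈ : (φ ⟨$⟩ʳ (s ∙ h)) ∙ (φ ⟨$⟩ʳ h) ⁻ ∈ S
      image∈ = Vec.lookup⇒[]= _ S (trans (φ-arc (s ∙ h) h)
        (trans (cong (lookup S) (solve (s ∷ h ∷ []) (v₀ ⊕ v₁ ⊕ ι v₁) v₀ refl)) (Vec.[]=⇒lookup s∈)))

    -- Both h and s⁻¹s′h are joined to the point s′h, and φ sends the ends of an arc to different
    -- halves, so their images share a half.
    S-differences : ∀ {s s′} → s ∈ S → s′ ∈ S → s ⁻ ∙ s′ ∈ Q
    S-differences {s} {s′} s∈ s′∈ = ∊⁺ keepsHalf?
      (index-2 M-sub 2m≡n (x∈∁p⇒x∉p (S⊆Mᶜ s∈)) (x∈∁p⇒x∉p (S⊆Mᶜ s′∈)) , λ h →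
        ≁-trans (subst (λ g → ¬ (φ ⟨$⟩ʳ g) ~ (φ ⟨$⟩ʳ h)) (sym (step h)) (arc-switches s′∈ h)) (arc-switches s∈ (s ⁻ ∙ s′ ∙ h)))
      where
      step : ∀ h → s ∙ (s ⁻ ∙ s′ ∙ h) ≡ s′ ∙ h
      step h = solve (s ∷ s′ ∷ h ∷ []) (v₀ ⊕ (ι v₀ ⊕ v₁ ⊕ v₂)) (v₁ ⊕ v₂) refl

    -- S lies in one coset of Q, so if Q ≠ M then S is degenerate or vanishes off a coset of Q.
    preserves-halves : S ∉ˡ degenerate → ¬ PeriodicOffCoset S → Preserves
    preserves-halves ¬deg ¬off {g} {h} g~h with h ∙ g ⁻ ∈? Q
    ... | yes p = subst (λ u → (φ ⟨$⟩ʳ g) ~ (φ ⟨$⟩ʳ u)) (solve (g ∷ h ∷ []) (v₁ ⊕ ι v₀ ⊕ v₀) v₁ refl) (proj₂ (∊⁻ keepsHalf? p) g)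
    ... | no ¬p with Fin.any? (λ d → (d ∈? Q) ×-dec ¬? (d Fin.≟ e))
    ...   | no none = contradiction (∈-degenerate single) ¬deg
      where
      single : ∀ {x y} → x ∈ S → y ∈ S → x ≡ y
      single {x} {y} x∈ y∈ with x ⁻ ∙ y Fin.≟ e
      ... | yes eq = ∙-cancelˡ (x ⁻) (trans (inverseˡ x) (sym eq))
      ... | no ne = contradiction (x ⁻ ∙ y , S-differences x∈ y∈ , ne) none
    ...   | yes (d , d∈ , d≢e) with Fin.any? (_∈? S)
    ...     | no empty = contradiction (∈-degenerate (λ {x} x∈ → contradiction (x , x∈) empty)) ¬deg
    ...     | yes (s , s∈) = contradiction
      (Q , (Q-sub , (λ {x} q → proj₁ (∊⁻ keepsHalf? {x} q)) , h ∙ g ⁻ , hg⁻∈ , ¬p) , d , d∈ , d≢e , s , x∈∁p⇒x∉p (S⊆Mᶜ s∈) , periodic) ¬off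
      where
      hg⁻∈ : h ∙ g ⁻ ∈ M
      hg⁻∈ = subst (_∈ M) (solve (g ∷ h ∷ []) (ι (ι v₀) ⊕ (ι v₀ ⊕ v₁) ⊕ ι v₀) (v₁ ⊕ ι v₀) refl) (conj-∈ (g ⁻) g~h)
      periodic : ∀ v → v ∉ M → s ⁻ ∙ v ∉ Q → lookup S (v ∙ d) ≡ lookup S v
      periodic v _ ¬q = trans (lookup-∉ (λ vd∈ → ¬q (subst (_∈ Q) (solve (s ∷ v ∷ d ∷ []) (ι v₀ ⊕ (v₁ ⊕ v₂) ⊕ ι v₂) (ι v₀ ⊕ v₁) refl)
        (has-∙ Q-sub (S-differences s∈ vd∈) (has-⁻ Q-sub d∈))))) (sym (lookup-∉ (¬q ∘ S-differences s∈)))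

    -- If the preimages of g and h were in different halves, the preimage of a point w in the half
    -- opposite to g would share a half with one of them; applying φ gives w ~ g, a contradiction.
    preserves-halves⁻ : Preserves → ∀ {g h} → g ~ h → (φ ⟨$⟩ˡ g) ~ (φ ⟨$⟩ˡ h)
    preserves-halves⁻ pres {g} {h} g~h with (φ ⟨$⟩ˡ g) ⁻ ∙ (φ ⟨$⟩ˡ h) ∈? M
    ... | yes p = p
    ... | no ¬p = contradiction g~w (λ r → proj₂ t (subst (_∈ M) (solve (g ∷ proj₁ t ∷ []) (ι v₀ ⊕ (v₀ ⊕ v₁)) v₁ refl) r))
      where
      w = g ∙ proj₁ t
      g~w : g ~ w
      g~w with (φ ⟨$⟩ˡ g) ⁻ ∙ (φ ⟨$⟩ˡ w) ∈? M
      ... | yes r = subst₂ _~_ (Perm.inverseʳ φ) (Perm.inverseʳ φ) (pres r)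
      ... | no ¬r = ~-trans g~h (subst₂ _~_ (Perm.inverseʳ φ) (Perm.inverseʳ φ) (pres (≁-trans ¬p ¬r)))

    toAut : Preserves → Aut S
    toAut pres = record
      { fun = φ ⟨$⟩ʳ_
      ; inv = φ ⟨$⟩ˡ_
      ; inv-fun = λ _ → Perm.inverseˡ φ
      ; fun-inv = λ _ → Perm.inverseʳ φ
      ; arc = φ-arc
      ; half = pres
      ; half⁻ = preserves-halves⁻ pres
      }

  -- Counting the exceptional sets

  module _ (j : ℕ) where

    bad : List (Subset n)
    bad = degenerate ++ normalBad ++ offBad j 15 ++ lettersBad j 15 ++ fewBad j 15

    -- Composing φ with the translation by (φ e)⁻¹ gives an automorphism fixing e, which is the
    -- identity by `semiregular`.
    not-bad⇒DRR : m < 2 ^ (3 + j) → ∀ {S} → (∀ {x} → x ∈ S → x ∈ Mᶜ) → S ∉ˡ bad → IsDRR _·_ e _⁻¹ S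
    not-bad⇒DRR m< {S} S⊆Mᶜ S∉ φ φ-aut = r , λ g → trans (solve ((φ ⟨$⟩ʳ g) ∷ r ∷ []) v₀ (v₀ ⊕ ι v₁ ⊕ v₁) refl)
        (cong (_∙ r) (semiregular (normalRigid S⊆Mᶜ ¬normal) ¬off ¬on (ρ (r ⁻) ∘ᴬ toAut S⊆Mᶜ φ φ-aut pres) e
          (inverseʳ r) g))
      where
      r = φ ⟨$⟩ʳ e
      ¬degenerate : S ∉ˡ degenerate
      ¬degenerate p = S∉ (∈-++⁺ˡ p)
      rest₁ = S∉ ∘ ∈-++⁺ʳ degenerate
      ¬normal : S ∉ˡ normalBad
      ¬normal = rest₁ ∘ ∈-++⁺ˡ
      rest₂ = rest₁ ∘ ∈-++⁺ʳ normalBad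
      ¬off : ¬ PeriodicOffCoset S
      ¬off = rest₂ ∘ ∈-++⁺ˡ ∘ off-bad j 15 S⊆Mᶜ m<
      rest₃ = rest₂ ∘ ∈-++⁺ʳ (offBad j 15)
      ¬on : ¬ PeriodicOnCosets S
      ¬on on with on-bad j 15 S⊆Mᶜ ≤-refl m< on
      ... | inj₁ p = rest₃ (∈-++⁺ˡ p)
      ... | inj₂ p = rest₃ (∈-++⁺ʳ (lettersBad j 15) p)
      pres : Preserves S⊆Mᶜ φ φ-aut
      pres = preserves-halves S⊆Mᶜ φ φ-aut ¬degenerate ¬off

    module _ (6≤j : 6 ≤ j) (2^≤m : 2 ^ (2 + j) ≤ m) (m< : m < 2 ^ (3 + j)) (large : 5 * (m ^ (3 + j) * 2 ^ ⌊3m/4⌋ m) < 2 ^ m) where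

      W : ℕ
      W = m ^ (3 + j) * 2 ^ ⌊3m/4⌋ m

      4≤m : 4 ≤ m
      4≤m = ≤-trans (^-monoʳ-≤ 2 (m≤m+n 2 j)) 2^≤m

      instance
        m-nonZero : NonZero m
        m-nonZero = >-nonZero 1≤m

      normal-length : length normalBad ≤ W
      normal-length = ≤-trans (sieve-length (⌊3m/4⌋ m) (map decode homogeneousCodes)) (*-monoˡ-≤ (2 ^ ⌊3m/4⌋ m) (≤-trans
        (≤-reflexive (length-map decode homogeneousCodes)) codes))
        where
        codes : length homogeneousCodes ≤ m ^ (3 + j)
        codes = let gs , len , _ , gen = generators M-sub (2 + j) [] (λ ()) (<-≤-trans m< (m≤m*n (2 ^ (3 + j)) (card (closure [])) {{>-nonZero (card-pos (closure-sub []))}})) in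
          subst (λ l → length homogeneousCodes ≤ m ^ suc l) len
            (homogeneousCodes-length (trans (cong closure (sym (++-identityʳ gs))) gen))

      off-length : length (offBad j 15) ≤ W
      off-length = ≤-trans (sieve-length (⌊3m/4⌋ m) (map (offMove j 15) (offData j 15))) (*-monoˡ-≤ (2 ^ ⌊3m/4⌋ m) (begin
        length (map (offMove j 15) (offData j 15))    ≡⟨ length-map (offMove j 15) (offData j 15) ⟩
        length (offData j 15)                         ≡⟨ product-length _,_ (tuples (elems M) j) _ ⟩
        length (tuples (elems M) j) * length (cartesianProduct (elems M) (elems Mᶜ))
          ≡⟨ cong₂ _*_ (tuples-length (elems M) j) (trans (product-length _,_ (elems M) (elems Mᶜ)) (cong (m *_) card-Mᶜ)) ⟩
        m ^ j * (m * m)                               ≤⟨ m≤n*m (m ^ j * (m * m)) m ⟩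
        m * (m ^ j * (m * m))                         ≡⟨ regroup m (m ^ j) ⟩
        m ^ (3 + j)                                   ∎))
        where
        open ≤-Reasoning
        regroup : ∀ a b → a * (b * (a * a)) ≡ a * (a * (a * b))
        regroup = solve-∀

      letters-length : length (lettersBad j 15) ≤ W
      letters-length = begin
        length (lettersBad j 15)        ≤⟨ concatMap-length (choicesBad j 15) pairs each ⟩
        length pairs * 2 ^ (1 + ⌊3m/4⌋ m)    ≡⟨ cong (_* 2 ^ (1 + ⌊3m/4⌋ m)) (trans (product-length _,_ (tuples (elems M) j) (elems M)) (cong (_* m) (tuples-length (elems M) j))) ⟩
        m ^ j * m * (2 * 2 ^ ⌊3m/4⌋ m)       ≤⟨ *-monoʳ-≤ (m ^ j * m) (*-monoˡ-≤ (2 ^ ⌊3m/4⌋ m) (≤-trans (≤-trans (m≤m+n 2 2) 4≤m) (m≤m*n m m))) ⟩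
        m ^ j * m * (m * m * 2 ^ ⌊3m/4⌋ m)   ≡⟨ regroup m (m ^ j) (2 ^ ⌊3m/4⌋ m) ⟩
        W                               ∎
        where
        open ≤-Reasoning
        pairs = cartesianProduct (tuples (elems M) j) (elems M)
        regroup : ∀ a b c → b * a * (a * a * c) ≡ a * (a * (a * b)) * c
        regroup = solve-∀
        gate : ∀ P d dec → length (fromChoices j 15 P d dec) ≤ 2 ^ (1 + ⌊3m/4⌋ m)
        gate P d (no _) = z≤n
        gate P d (yes le) = ≤-trans (sieve-length ⌊ m /2⌋ (map (CosetMoves.move P d) (CosetMoves.choices P)))
          (≤-trans (≤-reflexive (cong (_* 2 ^ ⌊ m /2⌋) (length-map (CosetMoves.move P d) (CosetMoves.choices P))))
            (letters-total m (length (CosetMoves.choices P)) ⌊ m /2⌋ le (double-half≤ m)))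
        each : ∀ hd → length (choicesBad j 15 hd) ≤ 2 ^ (1 + ⌊3m/4⌋ m)
        each (hs , d) = gate P d (length (CosetMoves.choices P) ^ 4 ≤? 2 ^ m)
          where P = closure (hs ++ d ∷ [])

      few-length : length (fewBad j 15) ≤ W
      few-length = begin
        length (fewBad j 15)                          ≤⟨ sieve-length ⌊ m /2⌋ (map (fewMove j 15) (fewData j 15)) ⟩
        length (map (fewMove j 15) (fewData j 15)) * 2 ^ ⌊ m /2⌋ ≡⟨ cong (_* 2 ^ ⌊ m /2⌋) (trans (length-map (fewMove j 15) (fewData j 15)) (count 15)) ⟩
        m ^ 2 * (m * m ^ 15) * 2 ^ ⌊ m /2⌋            ≡⟨ cong (_* 2 ^ ⌊ m /2⌋) (^-distribˡ-+-* m 2 16) ⟨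
        -- 18 = 2 · 9 ≤ 2 (3 + j) is where j ≥ 6 enters. The second factor m^(3+j) is affordable
        -- because these maps have no fixed points in R ∖ M.
        m ^ 18 * 2 ^ ⌊ m /2⌋                          ≤⟨ *-monoˡ-≤ (2 ^ ⌊ m /2⌋) (^-monoʳ-≤ m {18} {(3 + j) + (3 + j)} (+-mono-≤ (+-monoʳ-≤ 3 6≤j) (+-monoʳ-≤ 3 6≤j))) ⟩
        m ^ ((3 + j) + (3 + j)) * 2 ^ ⌊ m /2⌋         ≡⟨ cong (_* 2 ^ ⌊ m /2⌋) (^-distribˡ-+-* m (3 + j) (3 + j)) ⟩
        m ^ (3 + j) * m ^ (3 + j) * 2 ^ ⌊ m /2⌋       ≡⟨ *-assoc (m ^ (3 + j)) (m ^ (3 + j)) _ ⟩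
        m ^ (3 + j) * (m ^ (3 + j) * 2 ^ ⌊ m /2⌋)     ≤⟨ *-monoʳ-≤ (m ^ (3 + j)) (few-letters-total m (m ^ (3 + j)) ⌊ m /2⌋ large (double-half≤ m)) ⟩
        W                                             ∎
        where
        open ≤-Reasoning
        count : ∀ c → length (fewData j c) ≡ m ^ 2 * (m * m ^ c)
        count c = trans (product-length _,_ (tuples (elems M) 2) _) (cong₂ _*_ (tuples-length (elems M) 2)
          (trans (product-length _,_ (elems M) _) (cong (m *_) (trans (tuples-length (elems Mᶜ) c) (cong (_^ c) card-Mᶜ)))))

      degenerate-bound : length degenerate ≤ W
      degenerate-bound = begin
        length degenerate     ≡⟨ degenerate-length ⟩
        suc n                 ≡⟨ cong suc 2m≡n ⟨
        1 + m * 2             ≤⟨ +-mono-≤ 1≤m (≤-reflexive (*-comm m 2)) ⟩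
        m + 2 * m             ≡⟨⟩
        3 * m                 ≤⟨ *-monoˡ-≤ m (≤-trans (m≤m+n 3 1) 4≤m) ⟩
        m * m                 ≤⟨ *-monoʳ-≤ m (m≤m*n m (m * m ^ j) {{>-nonZero (*-mono-≤ 1≤m (m^n>0 m j))}}) ⟩
        m ^ (3 + j)           ≤⟨ m≤m*n (m ^ (3 + j)) (2 ^ ⌊3m/4⌋ m) {{>-nonZero (2^-pos (⌊3m/4⌋ m))}} ⟩
        W                     ∎
        where open ≤-Reasoning

      bad-length : length bad ≤ 5 * W
      bad-length = begin
        length bad            ≡⟨ trans (length-++ degenerate) (cong (length degenerate +_) (trans (length-++ normalBad)
                                   (cong (length normalBad +_) (trans (length-++ (offBad j 15)) (cong (length (offBad j 15) +_) (length-++ (lettersBad j 15))))))) ⟩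
        length degenerate + (length normalBad + (length (offBad j 15) + (length (lettersBad j 15) + length (fewBad j 15))))
                              ≤⟨ +-mono-≤ degenerate-bound (+-mono-≤ normal-length (+-mono-≤ off-length (+-mono-≤ letters-length few-length))) ⟩
        W + (W + (W + (W + W))) ≡⟨ five W ⟩
        5 * W                 ∎
        where
        open ≤-Reasoning
        five : ∀ w → w + (w + (w + (w + w))) ≡ 5 * w
        five = solve-∀

    bad? : ∀ S → Dec (S ∈ˡ bad)
    bad? S = Any.any? (Vec.≡-dec Bool._≟_ S) bad

    good : List (Subset n)
    good = filter (λ S → ¬? (bad? S)) (subsetsOf Mᶜ)

    good-unique : Unique good
    good-unique = Unique.filter⁺ (λ S → ¬? (bad? S)) (subsetsOf-unique Mᶜ)

    good-DRR : m < 2 ^ (3 + j) → ∀ {S} → S ∈ˡ good → (∀ x → x ∈ S → x ∉ M) × IsDRR _·_ e _⁻¹ S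
    good-DRR m< {S} p = (λ x x∈ → x∈∁p⇒x∉p (S⊆ x∈)) , not-bad⇒DRR m< S⊆ (proj₂ (∈-filter⁻ (λ S → ¬? (bad? S)) {xs = subsetsOf Mᶜ} p))
      where
      S⊆ : ∀ {x} → x ∈ S → x ∈ Mᶜ
      S⊆ = subsetsOf-⊆ Mᶜ (proj₁ (∈-filter⁻ (λ S → ¬? (bad? S)) {xs = subsetsOf Mᶜ} p))

    good-deficit : 2 ^ m ∸ length good ≤ length bad
    good-deficit = begin
      2 ^ m ∸ length good ≡⟨ cong (λ k → 2 ^ k ∸ length good) (trans (sym card-Mᶜ) (card-∣∣ Mᶜ)) ⟩
      2 ^ ∣ Mᶜ ∣ ∸ length good ≡⟨ cong (_∸ length good) (trans (sym (subsetsOf-length Mᶜ)) (sym (length-filter-split bad? (subsetsOf Mᶜ)))) ⟩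
      length (filter bad? (subsetsOf Mᶜ)) + length good ∸ length good ≡⟨ m+n∸n≡m _ (length good) ⟩
      length (filter bad? (subsetsOf Mᶜ)) ≤⟨ length-⊆ (Unique.filter⁺ bad? (subsetsOf-unique Mᶜ)) (λ p → proj₂ (∈-filter⁻ bad? {xs = subsetsOf Mᶜ} p)) ⟩
      length bad ∎
      where open ≤-Reasoning

  DRRs : Set
  DRRs = ∃ λ (L : List (Subset n)) → Unique L × All (λ S → (∀ x → x ∈ S → x ∉ M) × IsDRR _·_ e _⁻¹ S) L × DRRCountBound n (length L)

  -- The exponent D + 1 is admissible in `deficit-bound` since 2^D ≤ m gives 2^(D+1) ≤ 2m = n.
  count-bound : ∀ D → 2 ^ D ≤ m → ∀ {l} → 2 ^ m ∸ l ≤ 5 * (m ^ suc D * 2 ^ ⌊3m/4⌋ m) → DRRCountBound n l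
  count-bound D 2^D≤m {l} deficit = subst (λ n → DRRCountBound n l) 2m≡n
    (deficit-bound {m} {suc D} {⌊3m/4⌋ m} (s≤s z≤n) (≤-trans (*-monoʳ-≤ 2 2^D≤m) (≤-reflexive (*-comm 2 m))) (4q≤3m m) _
      (subst (λ k → 2 ^ k ∸ l ≤ 5 * (m ^ suc D * 2 ^ ⌊3m/4⌋ m)) (trans (n≡⌊n+n/2⌋ m) (cong ⌊_/2⌋ (trans (cong (m +_) (sym (+-identityʳ m))) (*-comm 2 m)))) deficit))

  drrs : DRRs
  drrs with log-exists m 1≤m
  ... | D , 2^D≤m , m< with 2 ^ m ≤? 5 * (m ^ suc D * 2 ^ ⌊3m/4⌋ m)
  -- The subtracted term is at least 2^m, so the empty list suffices.
  ... | yes trivial = [] , [] , [] , count-bound D 2^D≤m {0} trivial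
  ... | no ¬trivial with m≤n⇒∃[o]m+o≡n (large-log m D 2^D≤m m< (≰⇒> ¬trivial))
  ... | i , refl = good j , good-unique j , All.tabulate (good-DRR j m<) ,
      count-bound (2 + j) 2^D≤m {length (good j)} (≤-trans (good-deficit j) (bad-length j (m≤m+n 6 i) 2^D≤m m< (≰⇒> ¬trivial)))
    where j = 6 + i

theorem1p3 : (n : ℕ) (_·_ : Fin n → Fin n → Fin n) (e : Fin n) (_⁻¹ : Fin n → Fin n)
    → IsGroup _≡_ _·_ e _⁻¹
    → (M : Subset n)
    → IsSubgroup _·_ e _⁻¹ M
    → IsAbelianSub _·_ e _⁻¹ M
    → ∣ M ∣ * 2 ≡ n
    → ∃ λ (L : List (Subset n))
    → Unique L
    × All (λ S → (∀ x → x ∈ S → x ∉ M) × IsDRR _·_ e _⁻¹ S) L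
    × DRRCountBound n (length L)
theorem1p3 n _·_ e _⁻¹ isGroup M (e∈ , ∙∈ , ⁻∈) abelian 2m≡n =
  Index2.drrs _·_ e _⁻¹ isGroup M (record { has-e = e∈ ; has-∙ = ∙∈ _ _ ; has-⁻ = ⁻∈ _ }) (abelian _ _)
    (trans (cong (_* 2) (card-∣∣ M)) 2m≡n)
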